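{- There exists an absolute constant $C>0$ such that, if $L$ is an order-$n$ Latin square chosen uniformly at random, then $\Pr\left(\varepsilon(L) \le C n^2 \log^2 n\right) \to 1$ as $n\to\infty$. That is, asymptotically almost every order-$n$ Latin square $L$ satisfies $\varepsilon(L) = O(n^2\log^2 n)$.
   Context: Write $[n]=\{1,\dots,n\}$. An order-$n$ Latin square is a map $L:[n]\times[n]\to[n]$ such that for each fixed $i$ the map $j\mapsto L(i,j)$ is a bijection and for each fixed $j$ the map $i\mapsto L(i,j)$ is a bijection. For $X,Y,Z\subseteq[n]$, the box $X\times Y\times Z$ is called an empty box of $L$ if there are no $i\in X$, $j\in Y$ with $L(i,j)\in Z$; its volume is $|X||Y||Z|$. $\varepsilon(L)$ denotes the maximum volume of an empty box of $L$. -}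

module Defs where

open import Data.Nat using (ℕ; zero; suc; _*_; _≤_; _⊔_)
open import Data.Nat.Properties using (_≤?_)
open import Data.Fin using (Fin)
open import Data.Fin.Properties using (all?; any?; _≟_)
open import Data.Fin.Subset using (Subset; _∈_; _∉_; ∣_∣; inside; outside)
open import Data.Fin.Subset.Properties using (_∈?_)
open import Data.Vec using (Vec; []; _∷_; lookup)
open import Data.List using (List; []; _∷_; map; concatMap; allFin; filter; length; foldr)
open import Data.Product using (_×_; _,_; ∃; proj₁; proj₂)
open import Function.Definitions using (Bijective; Injective; Surjective)
open import Relation.Nullary using (Dec; yes; no; ¬_; ¬?)
open import Relation.Nullary.Decidable using (_×-dec_; _→-dec_; map′)
open import Relation.Binary.PropositionalEquality using (_≡_; refl)

Grid : ℕ → Set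
Grid n = Fin n → Fin n → Fin n

IsLatin : ∀ {n} → Grid n → Set
IsLatin {n} L = (∀ i → Bijective _≡_ _≡_ (λ j → L i j))
              × (∀ j → Bijective _≡_ _≡_ (λ i → L i j))

IsEmptyBox : ∀ {n} → Grid n → Subset n → Subset n → Subset n → Set
IsEmptyBox {n} L X Y Z = ∀ i j → i ∈ X → j ∈ Y → L i j ∉ Z

volume : ∀ {n} → Subset n → Subset n → Subset n → ℕ
volume X Y Z = ∣ X ∣ * ∣ Y ∣ * ∣ Z ∣

bij? : ∀ {n} (f : Fin n → Fin n) → Dec (Bijective _≡_ _≡_ f)
bij? f = inj? ×-dec surj?
  where
  inj? : Dec (Injective _≡_ _≡_ f)
  inj? = map′ (λ h {x} {y} → h x y) (λ h x y → h {x} {y})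
              (all? (λ x → all? (λ y → (f x ≟ f y) →-dec (x ≟ y))))
  surj? : Dec (Surjective _≡_ _≡_ f)
  surj? = map′ (λ h y → proj₁ (h y) , λ { refl → proj₂ (h y) })
               (λ h y → proj₁ (h y) , proj₂ (h y) refl)
               (all? (λ y → any? (λ x → f x ≟ y)))

isLatin? : ∀ {n} (L : Grid n) → Dec (IsLatin L)
isLatin? L = all? (λ i → bij? (λ j → L i j)) ×-dec all? (λ j → bij? (λ i → L i j))

isEmptyBox? : ∀ {n} (L : Grid n) X Y Z → Dec (IsEmptyBox L X Y Z)
isEmptyBox? L X Y Z =
  all? (λ i → all? (λ j → (i ∈? X) →-dec ((j ∈? Y) →-dec ¬? (L i j ∈? Z))))

allVecs : ∀ {A : Set} → List A → (k : ℕ) → List (Vec A k)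
allVecs xs zero    = [] ∷ []
allVecs xs (suc k) = concatMap (λ x → map (x ∷_) (allVecs xs k)) xs

allSubsets : (n : ℕ) → List (Subset n)
allSubsets n = allVecs (inside ∷ outside ∷ []) n

allGrids : (n : ℕ) → List (Grid n)
allGrids n = map (λ v i j → lookup (lookup v i) j) (allVecs (allVecs (allFin n) n) n)

latinSquares : (n : ℕ) → List (Grid n)
latinSquares n = filter isLatin? (allGrids n)

allBoxes : (n : ℕ) → List (Subset n × Subset n × Subset n)
allBoxes n = concatMap (λ X → concatMap (λ Y → map (λ Z → X , Y , Z)
               (allSubsets n)) (allSubsets n)) (allSubsets n)

-- ε(L): maximum volume of an empty box (the empty box ∅×∅×∅ always exists).
ε : ∀ {n} → Grid n → ℕ
ε {n} L = foldr (λ { (X , Y , Z) m → volume X Y Z ⊔ m }) 0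
            (filter (λ { (X , Y , Z) → isEmptyBox? L X Y Z }) (allBoxes n))

countGood : (n B : ℕ) → ℕ
countGood n B = length (filter (λ L → ε L ≤? B) (latinSquares n))

countLatin : ℕ → ℕ
countLatin n = length (latinSquares n)

{-# OPTIONS --safe #-}
module Submission where

-- Build a Latin square row by row.  When d rows are missing, the number of choices for the next row is the
-- permanent of a 0/1 matrix with line sums d, which lies between (d/e)^n up to a factor (4d)^(n/d) and Brègman's
-- bound (d!)^(n/d); multiplying over d, the number of Latin squares is ∏ (d!)^(n/d) up to a factor
-- exp(O(n log² n)).  If the rows of an empty box X × Y × Z come first, then each of them sees |Y| columns in which
-- |Z| of the d symbols are forbidden, and as ((d-1)!)^(1/(d-1)) ≤ 2^(-1/d) (d!)^(1/d), Brègman's bound loses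
-- a factor 2^(-|Y||Z|/n) in every such row.  So at most a proportion 2^(-|X||Y||Z|/n) exp(O(n log² n)) of the Latin
-- squares have this empty box, and there are only 8^n boxes.
--
-- The lower bound for permanents avoids van der Waerden's theorem.  Repeating every row and every column twice
-- multiplies the permanent by at most the factor 4^n times itself: with y = u + v and z = u - v,
--   4^n per(A)² = ∏ (∂u² - ∂v²) ∏ (u² - v²)
-- up to normalisation, where all terms have the same sign, and dropping every v leaves the repeated permanent.
-- Iterating, per(A)^N ≥ N^(-nN) per(A ⊗ J_N), and in per(A ⊗ J_N) one counts the matchings that use every
-- entry of A equally often.

open import Defs
open import Data.Nat using (ℕ; zero; suc; pred; _+_; _*_; _^_; _∸_; _/_; _%_; _⊔_; _!; ⌈_/2⌉; _≤_; _<_; z≤n; s≤s; s<s⁻¹; NonZero; >-nonZero; ≢-nonZero)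
import Data.Nat.Properties as ℕ
import Data.Nat.DivMod as ℕ
import Data.Nat.Divisibility as ℕ
import Data.Nat.Tactic.RingSolver as ℕ-Solver
open import Data.Nat.Logarithm using (⌈log₂_⌉)
open import Data.Nat.Logarithm.Core using (⌈log2⌉)
open import Data.Nat.Induction using (<-wellFounded)
open import Induction.WellFounded using (Acc; acc)
open import Data.Integer as ℤ using (ℤ) renaming (+_ to infix 8 ⁺_)
import Data.Integer.Properties as ℤ
import Data.Integer.Tactic.RingSolver as ℤ-Solver
open import Data.Bool using (Bool; true; false; if_then_else_; _∧_)
open import Data.Empty using (⊥-elim)
open import Data.Product using (∃-syntax; _×_; _,_; proj₁; proj₂)
open import Data.Sum using (_⊎_; inj₁; inj₂)
open import Data.Fin using (Fin; zero; suc; punchIn; punchOut)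
open import Data.Fin.Properties using (_≟_; any?; injective⇒≤; punchOut-injective; punchInᵢ≢i)
open import Data.Fin.Subset using (Subset; ∣_∣)
open import Data.List using (List; []; _∷_; length; removeAt; allFin; map; concatMap; filter; foldr; _++_)
import Data.List as List
import Data.List.Properties as List
open import Data.List.Membership.Propositional as ∈ using ()
open import Data.List.Membership.Propositional.Properties using (∈-lookup)
open import Data.List.Relation.Unary.Any using (here; there)
open import Data.List.Relation.Unary.All as All using (All; []; _∷_)
import Data.List.Relation.Unary.All.Properties as All
open import Data.List.Relation.Binary.Permutation.Propositional as Perm using (_↭_)
open import Data.Vec using (Vec; []; _∷_; lookup; updateAt; replicate; zipWith; toList)
import Data.Vec as Vec
import Data.Vec.Properties as Vec
import Data.Vec.Relation.Unary.All as VecAll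
open VecAll using ([]; _∷_) renaming (All to AllV)
open import Function using (_∘_; id)
open import Function.Definitions using (Bijective)
open import Relation.Nullary using (¬_; Dec; yes; no; does)
open import Relation.Unary using (Decidable)
open import Relation.Binary.PropositionalEquality hiding ([_])
import Algebra.Properties.Semiring.Sum as SemiringSum
import Algebra.Properties.CommutativeMonoid.Sum as MonoidSum
open SemiringSum ℕ.+-*-semiring
  using (sum-cong-≗; sum-remove; ∑-distrib-+; *-distribˡ-sum; *-distribʳ-sum; ∑-comm; sum-replicate-zero)
  renaming (sum to ∑)
open MonoidSum ℕ.*-1-commutativeMonoid
  using ()
  renaming (sum to ∏; sum-cong-≗ to ∏-cong; ∑-distrib-+ to ∏-distrib-*; ∑-comm to ∏-comm; sum-replicate-zero to ∏-replicate-one)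
module ℤΣ = SemiringSum ℤ.+-*-semiring

-- Inequalities around e

-- Roots are avoided by powers. With D = n!, every d ≤ n divides D, so (d!)^(D/d) is an integer and
-- the bounds are multiplied over the rows as D-th powers; the saving 2^(-|Y||Z|/n) per row asks for
-- a further n-th power. The square of the logarithm is a product of two: the two permanent bounds
-- with d rows missing differ by about (4n)^(n/d), and summing n log n / d over d brings a second
-- log n. A box of volume V saves 2^(-V/n), and this must beat 2^(O(n log² n)), whence V of order n²
-- log² n; the number of boxes is negligible beside it. The obstacle in the lower bound is that
-- doubling reaches only powers of two s, while using every entry equally often asks for a multiple
-- of d. The remainder s mod d is filled with a permutation matrix E, whose entries then need
-- positive weight, so the bound is proved for tA + E first. The errors are polynomial in s and
-- vanish under the root when s is large; afterwards t → ∞ removes E.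

*-cancel-pos : ∀ {k} a b → 0 < k → k * a ≤ k * b → a ≤ b
*-cancel-pos {k} a b k>0 = ℕ.*-cancelˡ-≤ k {{>-nonZero k>0}}

^-pos : ∀ {m} n → 0 < m → 0 < m ^ n
^-pos {m} n m>0 = ℕ.m^n>0 m {{>-nonZero m>0}} n

n^n>0 : ∀ n → 0 < n ^ n
n^n>0 zero    = s≤s z≤n
n^n>0 (suc n) = ^-pos (suc n) (s≤s z≤n)

0^n≡0 : ∀ {n} → 0 < n → 0 ^ n ≡ 0
0^n≡0 (s≤s _) = refl

*-pos : ∀ {m n} → 0 < m → 0 < n → 0 < m * n
*-pos = ℕ.*-mono-<

^-distrib-* : ∀ a b n → (a * b) ^ n ≡ a ^ n * b ^ n
^-distrib-* a b zero    = refl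
^-distrib-* a b (suc n) = trans (cong (a * b *_) (^-distrib-* a b n)) (r a b (a ^ n) (b ^ n))
  where
  r : ∀ a b c d → a * b * (c * d) ≡ a * c * (b * d)
  r = ℕ-Solver.solve-∀

^-root : ∀ {a b} n → 0 < n → a ^ n ≤ b ^ n → a ≤ b
^-root {a} {b} n@(suc _) _ p with a ℕ.≤? b
... | yes a≤b = a≤b
... | no a≰b  = ⊥-elim (ℕ.<⇒≱ (ℕ.^-monoˡ-< n (ℕ.≰⇒> a≰b)) p)

^-swap : ∀ a m n → (a ^ m) ^ n ≡ (a ^ n) ^ m
^-swap a m n = trans (ℕ.^-*-assoc a m n) (trans (cong (a ^_) (ℕ.*-comm m n)) (sym (ℕ.^-*-assoc a n m)))

rearrangement : ∀ {a b c d} → a ≤ b → c ≤ d → a * d + b * c ≤ a * c + b * d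
rearrangement {a} {_} {c} a≤b c≤d with ℕ.m≤n⇒∃[o]m+o≡n a≤b | ℕ.m≤n⇒∃[o]m+o≡n c≤d
... | x , refl | y , refl = ℕ.≤-trans (ℕ.m≤m+n _ (x * y)) (ℕ.≤-reflexive (r a x c y))
  where
  r : ∀ a x c y → a * (c + y) + (a + x) * c + x * y ≡ a * c + (a + x) * (c + y)
  r = ℕ-Solver.solve-∀

-- The graph of x^(m+1) lies above its tangent at b. After the previous case is multiplied by b,
-- what remains is a rearrangement inequality for a, b and their powers.
tangent : ∀ m a b → suc m * (a * b ^ m) ≤ a ^ suc m + m * b ^ suc m
tangent zero    a b = ℕ.≤-reflexive (r a)
  where
  r : ∀ a → 1 * (a * 1) ≡ a * 1 + 0
  r = ℕ-Solver.solve-∀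
tangent (suc m) a b = begin
  suc (suc m) * (a * b ^ suc m)                        ≡⟨ r₁ m a b (b ^ m) ⟩
  b * (suc m * (a * b ^ m)) + a * b ^ suc m            ≤⟨ ℕ.+-monoˡ-≤ (a * b ^ suc m) (ℕ.*-monoʳ-≤ b (tangent m a b)) ⟩
  b * (a ^ suc m + m * b ^ suc m) + a * b ^ suc m      ≡⟨ r₂ m a b (a ^ suc m) (b ^ suc m) ⟩
  (a * b ^ suc m + b * a ^ suc m) + m * b ^ suc (suc m) ≤⟨ ℕ.+-monoˡ-≤ (m * b ^ suc (suc m)) mixed ⟩
  (a ^ suc (suc m) + b ^ suc (suc m)) + m * b ^ suc (suc m) ≡⟨ ℕ.+-assoc (a ^ suc (suc m)) _ _ ⟩
  a ^ suc (suc m) + suc m * b ^ suc (suc m)            ∎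
  where
  open ℕ.≤-Reasoning
  r₁ : ∀ m a b c → suc (suc m) * (a * (b * c)) ≡ b * (suc m * (a * c)) + a * (b * c)
  r₁ = ℕ-Solver.solve-∀
  r₂ : ∀ m a b c d → b * (c + m * d) + a * d ≡ (a * d + b * c) + m * (b * d)
  r₂ = ℕ-Solver.solve-∀
  mixed : a * b ^ suc m + b * a ^ suc m ≤ a * a ^ suc m + b * b ^ suc m
  mixed with ℕ.≤-total a b
  ... | inj₁ a≤b = rearrangement a≤b (ℕ.^-monoˡ-≤ (suc m) a≤b)
  ... | inj₂ b≤a = subst₂ _≤_ (ℕ.+-comm (b * a ^ suc m) _) (ℕ.+-comm (b * b ^ suc m) _) (rearrangement b≤a (ℕ.^-monoˡ-≤ (suc m) b≤a))

-- The means S/n and (S + y)/(n + 1), both scaled by n (n + 1) to stay integral, are the two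
-- arguments of `tangent`.
am-gm-step : ∀ n S y → y * S ^ n * suc n ^ suc n ≤ n ^ n * (S + y) ^ suc n
am-gm-step zero    S y = ℕ.≤-trans (ℕ.≤-reflexive (r y)) (ℕ.≤-trans (ℕ.m≤n+m y S) (ℕ.≤-reflexive (r′ (S + y))))
  where
  r : ∀ y → y * 1 * 1 ≡ y
  r = ℕ-Solver.solve-∀
  r′ : ∀ z → z ≡ 1 * (z * 1)
  r′ = ℕ-Solver.solve-∀
am-gm-step n@(suc _) S y = *-cancel-pos {n} _ _ (s≤s z≤n) (ℕ.+-cancelʳ-≤ (n * (suc n * S) ^ suc n) _ _ (begin
  n * (y * S ^ n * suc n ^ suc n) + n * (suc n * S) ^ suc n
    ≡⟨ cong (λ z → n * (y * S ^ n * suc n ^ suc n) + n * z) (^-distrib-* (suc n) S (suc n)) ⟩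
  n * (y * S ^ n * suc n ^ suc n) + n * (suc n ^ suc n * S ^ suc n)
    ≡⟨ r₁ n y S (suc n ^ n) (S ^ n) ⟩
  suc n * ((n * (S + y)) * (suc n ^ n * S ^ n))
    ≡⟨ cong (λ z → suc n * ((n * (S + y)) * z)) (sym (^-distrib-* (suc n) S n)) ⟩
  suc n * ((n * (S + y)) * (suc n * S) ^ n)
    ≤⟨ tangent n (n * (S + y)) (suc n * S) ⟩
  (n * (S + y)) ^ suc n + n * (suc n * S) ^ suc n
    ≡⟨ cong (_+ n * (suc n * S) ^ suc n) (trans (^-distrib-* n (S + y) (suc n)) (ℕ.*-assoc n (n ^ n) _)) ⟩
  n * (n ^ n * (S + y) ^ suc n) + n * (suc n * S) ^ suc n ∎))
  where
  open ℕ.≤-Reasoning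
  r₁ : ∀ n y S p q → n * (y * q * (suc n * p)) + n * (suc n * p * (S * q)) ≡ suc n * ((n * (S + y)) * (p * q))
  r₁ = ℕ-Solver.solve-∀

am-gm : ∀ p q x y → x ^ p * y ^ q * (p + q) ^ (p + q) ≤ (p * x + q * y) ^ (p + q)
am-gm p zero x y rewrite ℕ.+-identityʳ p | ℕ.+-identityʳ (p * x) | ℕ.*-identityʳ (x ^ p) =
  ℕ.≤-reflexive (trans (ℕ.*-comm (x ^ p) (p ^ p)) (sym (^-distrib-* p x p)))
am-gm p (suc q) x y rewrite ℕ.+-suc p q = go (x ^ p * y ^ q) (am-gm p q x y)
  where
  open ℕ.≤-Reasoning
  n = p + q
  S = p * x + q * y
  r₁ : ∀ a b y c z → c * (a * (y * b) * z) ≡ y * (a * b * c) * z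
  r₁ = ℕ-Solver.solve-∀
  r₂ : ∀ p x q y → p * x + q * y + y ≡ p * x + suc q * y
  r₂ = ℕ-Solver.solve-∀
  go : ∀ _ → x ^ p * y ^ q * n ^ n ≤ S ^ n → x ^ p * (y * y ^ q) * suc n ^ suc n ≤ (p * x + suc q * y) ^ suc n
  go _ ih = *-cancel-pos {n ^ n} _ _ (n^n>0 n) (begin
    n ^ n * (x ^ p * (y * y ^ q) * suc n ^ suc n)  ≡⟨ r₁ (x ^ p) (y ^ q) y (n ^ n) (suc n ^ suc n) ⟩
    y * (x ^ p * y ^ q * n ^ n) * suc n ^ suc n    ≤⟨ ℕ.*-monoˡ-≤ (suc n ^ suc n) (ℕ.*-monoʳ-≤ y ih) ⟩
    y * S ^ n * suc n ^ suc n                      ≤⟨ am-gm-step n S y ⟩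
    n ^ n * (S + y) ^ suc n                        ≡⟨ cong (λ z → n ^ n * z ^ suc n) (r₂ p x q y) ⟩
    n ^ n * (p * x + suc q * y) ^ suc n            ∎)

-- (1 + 1/k)^k ≤ (1 + 1/j)^(j+1), both sides being on either side of e.
e-bounds : ∀ k j → suc k ^ k * j ^ suc j ≤ suc j ^ suc j * k ^ k
e-bounds zero j = ℕ.≤-trans (ℕ.≤-reflexive (ℕ.*-identityˡ (j ^ suc j))) (ℕ.≤-trans (ℕ.^-monoˡ-≤ (suc j) (ℕ.n≤1+n j)) (ℕ.≤-reflexive (sym (ℕ.*-identityʳ (suc j ^ suc j)))))
e-bounds k@(suc _) j = *-cancel-pos {suc j ^ k * k ^ suc j * n ^ n} _ _
  (*-pos (*-pos (^-pos k (s≤s z≤n)) (^-pos (suc j) (s≤s z≤n))) (^-pos n (s≤s z≤n))) (begin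
  suc j ^ k * k ^ suc j * n ^ n * (suc k ^ k * j ^ suc j)
    ≡⟨ r₁ (suc j ^ k) (k ^ suc j) (n ^ n) (suc k ^ k) (j ^ suc j) ⟩
  (suc k ^ k * suc j ^ k) * (j ^ suc j * k ^ suc j) * n ^ n
    ≡⟨ cong₂ (λ a b → a * b * n ^ n) (sym (^-distrib-* (suc k) (suc j) k)) (sym (^-distrib-* j k (suc j))) ⟩
  (suc k * suc j) ^ k * (j * k) ^ suc j * n ^ n
    -- Up to the scale k (j + 1), these are k copies of 1 + 1/k and j + 1 copies of 1 - 1/(j + 1).
    -- They add up to k + j + 1, so their mean is 1.
    ≤⟨ am-gm k (suc j) (suc k * suc j) (j * k) ⟩
  (k * (suc k * suc j) + suc j * (j * k)) ^ n
    ≡⟨ cong (_^ n) (r₂ k j) ⟩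
  (suc j * k * n) ^ n
    ≡⟨ trans (^-distrib-* (suc j * k) n n) (cong (_* n ^ n) (^-distrib-* (suc j) k n)) ⟩
  suc j ^ n * k ^ n * n ^ n
    ≡⟨ cong₂ (λ a b → a * b * n ^ n) (ℕ.^-distribˡ-+-* (suc j) k (suc j)) (ℕ.^-distribˡ-+-* k k (suc j)) ⟩
  suc j ^ k * suc j ^ suc j * (k ^ k * k ^ suc j) * n ^ n
    ≡⟨ r₃ (suc j ^ k) (suc j ^ suc j) (k ^ k) (k ^ suc j) (n ^ n) ⟩
  suc j ^ k * k ^ suc j * n ^ n * (suc j ^ suc j * k ^ k) ∎)
  where
  open ℕ.≤-Reasoning
  n = k + suc j
  r₁ : ∀ a b c d e → a * b * c * (d * e) ≡ (d * a) * (e * b) * c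
  r₁ = ℕ-Solver.solve-∀
  r₂ : ∀ k j → k * (suc k * suc j) + suc j * (j * k) ≡ suc j * k * (k + suc j)
  r₂ = ℕ-Solver.solve-∀
  r₃ : ∀ a b c d e → a * b * (c * d) * e ≡ a * d * e * (b * c)
  r₃ = ℕ-Solver.solve-∀

[1+k]^k≤4k^k : ∀ k → suc k ^ k ≤ 4 * k ^ k
[1+k]^k≤4k^k k = ℕ.≤-trans (ℕ.≤-reflexive (sym (ℕ.*-identityʳ _))) (e-bounds k 1)

-- Passing from s^s to the next such power costs (s + 1) (1 + 1/s)^s ≤ 4 (s + 1). The use is x = q d
-- with r the remainder of a power of two modulo d.
^-self-+ : ∀ r x → (x + r) ^ (x + r) ≤ (4 * (x + r)) ^ r * x ^ x
^-self-+ zero    x rewrite ℕ.+-identityʳ x = ℕ.≤-reflexive (sym (ℕ.*-identityˡ _))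
^-self-+ (suc r) x rewrite ℕ.+-suc x r = begin
  suc s * suc s ^ s                        ≤⟨ ℕ.*-monoʳ-≤ (suc s) ([1+k]^k≤4k^k s) ⟩
  suc s * (4 * s ^ s)                      ≡⟨ r₁ (suc s) (s ^ s) ⟩
  4 * suc s * s ^ s                        ≤⟨ ℕ.*-monoʳ-≤ (4 * suc s) (^-self-+ r x) ⟩
  4 * suc s * ((4 * s) ^ r * x ^ x)        ≤⟨ ℕ.*-monoʳ-≤ (4 * suc s) (ℕ.*-monoˡ-≤ (x ^ x) (ℕ.^-monoˡ-≤ r (ℕ.*-monoʳ-≤ 4 (ℕ.n≤1+n s)))) ⟩
  4 * suc s * ((4 * suc s) ^ r * x ^ x)    ≡⟨ sym (ℕ.*-assoc (4 * suc s) ((4 * suc s) ^ r) (x ^ x)) ⟩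
  (4 * suc s) ^ suc r * x ^ x ∎
  where
  open ℕ.≤-Reasoning
  s = x + r
  r₁ : ∀ a b → a * (4 * b) ≡ 4 * a * b
  r₁ = ℕ-Solver.solve-∀

-- With E a = a^a / a!: E (m + d) ≤ 4 d E d E m.
exp-+ : ∀ d m → 0 < d → (m + d) ^ (m + d) * (d ! * m !) ≤ 4 * d * (d ^ d * m ^ m) * (m + d) !
exp-+ 1 m _ rewrite ℕ.+-comm m 1 = begin
  suc m ^ suc m * (1 * m !)                 ≡⟨ r₁ (suc m) (suc m ^ m) (m !) ⟩
  suc m ^ m * (suc m * m !)                 ≤⟨ ℕ.*-monoˡ-≤ (suc m !) ([1+k]^k≤4k^k m) ⟩
  4 * m ^ m * (suc m !)                     ≡⟨ r₂ (m ^ m) (suc m !) ⟩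
  4 * 1 * (1 ^ 1 * m ^ m) * (suc m !) ∎
  where
  open ℕ.≤-Reasoning
  r₁ : ∀ a b c → a * b * (1 * c) ≡ b * (a * c)
  r₁ = ℕ-Solver.solve-∀
  r₂ : ∀ a b → 4 * a * b ≡ 4 * 1 * (1 * a) * b
  r₂ = ℕ-Solver.solve-∀
exp-+ (suc d@(suc _)) m _ = step (exp-+ d m (s≤s z≤n))
  where
  open ℕ.≤-Reasoning
  k = m + d
  r₁ : ∀ a b c d e f g → a * b * ((c * d) * (e * f * g)) ≡ c * e * ((d * b) * (a * (f * g)))
  r₁ = ℕ-Solver.solve-∀
  r₂ : ∀ a b c d e f g h → a * b * ((c * d) * (4 * e * (f * g) * h)) ≡ d * (e * f) * (4 * b * (c * g) * (a * h))
  r₂ = ℕ-Solver.solve-∀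
  step : k ^ k * (d ! * m !) ≤ 4 * d * (d ^ d * m ^ m) * k ! →
         (m + suc d) ^ (m + suc d) * (suc d ! * m !) ≤ 4 * suc d * (suc d ^ suc d * m ^ m) * (m + suc d) !
  step ih rewrite ℕ.+-suc m d = *-cancel-pos {k ^ k * d ^ suc d} _ _ (*-pos (n^n>0 k) (^-pos (suc d) (s≤s z≤n))) (begin
    k ^ k * d ^ suc d * (suc k ^ suc k * (suc d * d ! * m !))
      ≡⟨ r₁ (k ^ k) (d ^ suc d) (suc k) (suc k ^ k) (suc d) (d !) (m !) ⟩
    suc k * suc d * ((suc k ^ k * d ^ suc d) * (k ^ k * (d ! * m !)))
      -- From d to d + 1, E (m + d) grows by (1 + 1/k)^k and d E d by (1 + 1/d)^(d+1). The factor d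
      -- in the bound is there to raise the last exponent from d to d + 1.
      ≤⟨ ℕ.*-monoʳ-≤ (suc k * suc d) (ℕ.*-mono-≤ (e-bounds k d) ih) ⟩
    suc k * suc d * ((suc d ^ suc d * k ^ k) * (4 * d * (d ^ d * m ^ m) * k !))
      ≡⟨ r₂ (suc k) (suc d) (suc d ^ suc d) (k ^ k) d (d ^ d) (m ^ m) (k !) ⟩
    k ^ k * d ^ suc d * (4 * suc d * (suc d ^ suc d * m ^ m) * (suc k * k !)) ∎)

exp-* : ∀ q d → 0 < d → (q * d) ^ (q * d) * (d !) ^ q ≤ (4 * d) ^ q * (d ^ d) ^ q * (q * d) !
exp-* zero    d d>0 = s≤s z≤n
exp-* (suc q) d d>0 rewrite ℕ.+-comm d (q * d) = *-cancel-pos {m !} _ _ (ℕ.1≤n! m) (begin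
  m ! * ((m + d) ^ (m + d) * (d ! * (d !) ^ q))
    ≡⟨ r₁ (m !) ((m + d) ^ (m + d)) (d !) ((d !) ^ q) ⟩
  ((m + d) ^ (m + d) * (d ! * m !)) * (d !) ^ q
    ≤⟨ ℕ.*-monoˡ-≤ ((d !) ^ q) (exp-+ d m d>0) ⟩
  4 * d * (d ^ d * m ^ m) * (m + d) ! * (d !) ^ q
    ≡⟨ r₂ (4 * d) (d ^ d) (m ^ m) ((m + d) !) ((d !) ^ q) ⟩
  4 * d * d ^ d * (m + d) ! * (m ^ m * (d !) ^ q)
    ≤⟨ ℕ.*-monoʳ-≤ (4 * d * d ^ d * (m + d) !) (exp-* q d d>0) ⟩
  4 * d * d ^ d * (m + d) ! * ((4 * d) ^ q * (d ^ d) ^ q * m !)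
    ≡⟨ r₃ (4 * d) (d ^ d) ((m + d) !) ((4 * d) ^ q) ((d ^ d) ^ q) (m !) ⟩
  m ! * ((4 * d) ^ suc q * (d ^ d) ^ suc q * (m + d) !) ∎)
  where
  open ℕ.≤-Reasoning
  m = q * d
  r₁ : ∀ a b c d → a * (b * (c * d)) ≡ b * (c * a) * d
  r₁ = ℕ-Solver.solve-∀
  r₂ : ∀ a b c d e → a * (b * c) * d * e ≡ a * b * d * (c * e)
  r₂ = ℕ-Solver.solve-∀
  r₃ : ∀ a b c d e f → a * b * c * (d * e * f) ≡ f * (a * d * (b * e) * c)
  r₃ = ℕ-Solver.solve-∀

-- Two uses of `exp-*` with d and q exchanged; since (d^d)^q (q^q)^d = x^x, one copy of x^x cancels.
-- These are the factors met when each of the d entries of a row is used q times.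
exp-both : ∀ q d → 0 < q → 0 < d → let x = q * d in
  x ^ x * ((d !) ^ q * (q !) ^ d) ≤ (4 * d) ^ q * (4 * q) ^ d * (x ! * x !)
exp-both q d q>0 d>0 = *-cancel-pos {x ^ x} _ _ (n^n>0 x) (begin
  x ^ x * (x ^ x * ((d !) ^ q * (q !) ^ d))
    ≡⟨ r₁ (x ^ x) ((d !) ^ q) ((q !) ^ d) ⟩
  (x ^ x * (d !) ^ q) * (x ^ x * (q !) ^ d)
    ≤⟨ ℕ.*-mono-≤ (exp-* q d d>0) (subst (λ z → z ^ z * (q !) ^ d ≤ (4 * q) ^ d * (q ^ q) ^ d * z !) (ℕ.*-comm d q) (exp-* d q q>0)) ⟩
  ((4 * d) ^ q * (d ^ d) ^ q * x !) * ((4 * q) ^ d * (q ^ q) ^ d * x !)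
    ≡⟨ r₂ ((4 * d) ^ q) ((d ^ d) ^ q) (x !) ((4 * q) ^ d) ((q ^ q) ^ d) ⟩
  ((q ^ q) ^ d * (d ^ d) ^ q) * ((4 * d) ^ q * (4 * q) ^ d * (x ! * x !))
    ≡⟨ cong (_* ((4 * d) ^ q * (4 * q) ^ d * (x ! * x !))) xx ⟩
  x ^ x * ((4 * d) ^ q * (4 * q) ^ d * (x ! * x !)) ∎)
  where
  open ℕ.≤-Reasoning
  x = q * d
  r₁ : ∀ a b c → a * (a * (b * c)) ≡ (a * b) * (a * c)
  r₁ = ℕ-Solver.solve-∀
  r₂ : ∀ a b c d e → (a * b * c) * (d * e * c) ≡ (e * b) * (a * d * (c * c))
  r₂ = ℕ-Solver.solve-∀
  xx : (q ^ q) ^ d * (d ^ d) ^ q ≡ x ^ x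
  xx = trans (cong₂ _*_ (ℕ.^-*-assoc q q d) (trans (ℕ.^-*-assoc d d q) (cong (d ^_) (ℕ.*-comm d q)))) (sym (^-distrib-* q d x))

n≤2^n : ∀ n → n < 2 ^ n
n≤2^n zero    = s≤s z≤n
n≤2^n (suc n) = ℕ.≤-trans (ℕ.+-mono-≤ (ℕ.m^n>0 2 n) (n≤2^n n)) (ℕ.≤-reflexive (cong (2 ^ n +_) (sym (ℕ.+-identityʳ (2 ^ n)))))

linear≤2^ : ∀ a b → ∃[ k ] a * k + b ≤ 2 ^ k
linear≤2^ a b = 2 * m , (begin
  a * (2 * m) + b          ≤⟨ ℕ.+-monoʳ-≤ (a * (2 * m)) (ℕ.m≤m*n b (suc m)) ⟩
  a * (2 * m) + b * suc m  ≤⟨ ℕ.+-monoˡ-≤ (b * suc m) (ℕ.≤-trans (ℕ.m≤m+n _ (2 * a)) (ℕ.≤-reflexive (r a m))) ⟩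
  2 * a * suc m + b * suc m ≡⟨ sym (ℕ.*-distribʳ-+ (suc m) (2 * a) b) ⟩
  m * suc m                ≤⟨ ℕ.*-mono-≤ (ℕ.<⇒≤ (n≤2^n m)) (n≤2^n m) ⟩
  2 ^ m * 2 ^ m            ≡⟨ trans (sym (ℕ.^-distribˡ-+-* 2 m m)) (cong (λ z → 2 ^ (m + z)) (sym (ℕ.+-identityʳ m))) ⟩
  2 ^ (2 * m) ∎)
  where
  open ℕ.≤-Reasoning
  m = 2 * a + b
  r : ∀ a m → a * (2 * m) + 2 * a ≡ 2 * a * suc m
  r = ℕ-Solver.solve-∀

-- Permanents and the doubling inequality

private variable n : ℕ

infix 9 _[_]
_[_] : ∀ {A : Set} → Vec A n → Fin n → A
_[_] = lookup

inc dec : Vec ℕ n → Fin n → Vec ℕ n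
inc C s = updateAt C s suc
dec C s = updateAt C s pred

total : Vec ℕ n → ℕ
total C = ∑ (lookup C)

𝟎 : Vec ℕ n
𝟎 = replicate _ 0

dec-inc : (C : Vec ℕ n) (s : Fin n) → dec (inc C s) s ≡ C
dec-inc (x ∷ C) zero    = refl
dec-inc (x ∷ C) (suc s) = cong (x ∷_) (dec-inc C s)

inc-dec : (C : Vec ℕ n) (s : Fin n) → C [ s ] ≢ 0 → inc (dec C s) s ≡ C
inc-dec (zero  ∷ C) zero    p = ⊥-elim (p refl)
inc-dec (suc x ∷ C) zero    p = refl
inc-dec (x ∷ C)     (suc s) p = cong (x ∷_) (inc-dec C s p)

total-inc : (C : Vec ℕ n) (s : Fin n) → total (inc C s) ≡ suc (total C)
total-inc (x ∷ C) zero    = refl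
total-inc (x ∷ C) (suc s) = trans (cong (λ t → x + t) (total-inc C s)) (ℕ.+-suc x _)

total-dec : (C : Vec ℕ n) (s : Fin n) → C [ s ] ≢ 0 → suc (total (dec C s)) ≡ total C
total-dec C s p = trans (sym (total-inc (dec C s) s)) (cong total (inc-dec C s p))

total-𝟎 : total (𝟎 {n}) ≡ 0
total-𝟎 {zero}  = refl
total-𝟎 {suc n} = total-𝟎 {n}

lookup-𝟎 : (s : Fin n) → 𝟎 [ s ] ≡ 0
lookup-𝟎 zero    = refl
lookup-𝟎 (suc s) = lookup-𝟎 s

-- The first-order operator Σₛ wₛ ∂/∂xₛ acting on functions of exponent vectors.
∂ : Vec ℕ n → (Vec ℕ n → ℕ) → Vec ℕ n → ℕ
∂ w F C = ∑ (λ s → C [ s ] * w [ s ] * F (dec C s))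

-- The permanent of the matrix with the given rows in which column s is repeated C [ s ] times.
pm : List (Vec ℕ n) → Vec ℕ n → ℕ
pm []       C = 1
pm (w ∷ ws) C = ∂ w (pm ws) C

-- Signed derivations of functionals on monomials

∂ℤ : Vec ℕ n → (Vec ℕ n → ℤ) → Vec ℕ n → ℤ
∂ℤ w F C = ℤΣ.sum (λ s → ⁺ (C [ s ] * w [ s ]) ℤ.* F (dec C s))

-- `dec` truncates at 0, but there the coefficient vanishes. Asking for equality only at genuine
-- decrements lets a condition on the degree pass to the smaller exponents.
∂ℤ-cong′ : ∀ {F G : Vec ℕ n → ℤ} w C → (∀ s → C [ s ] ≢ 0 → F (dec C s) ≡ G (dec C s)) → ∂ℤ w F C ≡ ∂ℤ w G C
∂ℤ-cong′ {F = F} {G} w C eq = ℤΣ.sum-cong-≗ λ s → term s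
  where
  term : ∀ s → ⁺ (C [ s ] * w [ s ]) ℤ.* F (dec C s) ≡ ⁺ (C [ s ] * w [ s ]) ℤ.* G (dec C s)
  term s with C [ s ] in e
  ... | zero  = refl
  ... | suc c = cong (⁺ (suc c * w [ s ]) ℤ.*_) (eq s (λ z → ℕ.1+n≢0 (trans (sym e) z)))

∂ℤ-cong : ∀ {F G : Vec ℕ n → ℤ} w C → (∀ x → F x ≡ G x) → ∂ℤ w F C ≡ ∂ℤ w G C
∂ℤ-cong {F = F} {G} w C eq = ∂ℤ-cong′ {F = F} {G} w C (λ s _ → eq (dec C s))

∂ℤ-+ : ∀ (F G : Vec ℕ n → ℤ) w C → ∂ℤ w (λ x → F x ℤ.+ G x) C ≡ ∂ℤ w F C ℤ.+ ∂ℤ w G C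
∂ℤ-+ F G w C = trans (ℤΣ.sum-cong-≗ (λ s → ℤ.*-distribˡ-+ (⁺ (C [ s ] * w [ s ])) (F (dec C s)) (G (dec C s))))
                     (ℤΣ.∑-distrib-+ (λ s → ⁺ (C [ s ] * w [ s ]) ℤ.* F (dec C s)) _)

∂ℤ-* : ∀ k (F : Vec ℕ n → ℤ) w C → ∂ℤ w (λ x → k ℤ.* F x) C ≡ k ℤ.* ∂ℤ w F C
∂ℤ-* k F w C = trans (ℤΣ.sum-cong-≗ (λ s → swap (⁺ (C [ s ] * w [ s ])) k (F (dec C s))))
                     (sym (ℤΣ.*-distribˡ-sum k (λ s → ⁺ (C [ s ] * w [ s ]) ℤ.* F (dec C s))))
  where
  swap : ∀ a b c → a ℤ.* (b ℤ.* c) ≡ b ℤ.* (a ℤ.* c)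
  swap = ℤ-Solver.solve-∀

∂ℤ-- : ∀ (F G : Vec ℕ n → ℤ) w C → ∂ℤ w (λ x → F x ℤ.- G x) C ≡ ∂ℤ w F C ℤ.- ∂ℤ w G C
∂ℤ-- F G w C = trans (∂ℤ-cong w C (λ x → neg (F x) (G x)))
               (trans (∂ℤ-+ F (λ x → ℤ.-1ℤ ℤ.* G x) w C)
               (trans (cong (λ z → ∂ℤ w F C ℤ.+ z) (∂ℤ-* ℤ.-1ℤ G w C))
                      (sym (neg (∂ℤ w F C) (∂ℤ w G C)))))
  where
  neg : ∀ a b → a ℤ.- b ≡ a ℤ.+ ℤ.-1ℤ ℤ.* b
  neg = ℤ-Solver.solve-∀

∑-zeroℤ : ∀ (f : Fin n → ℤ) → (∀ s → f s ≡ ⁺ 0) → ℤΣ.sum f ≡ ⁺ 0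
∑-zeroℤ {n} f eq = trans (ℤΣ.sum-cong-≗ eq) (ℤΣ.sum-replicate-zero n)

∂ℤ-𝟎 : ∀ (F : Vec ℕ n → ℤ) w → ∂ℤ w F 𝟎 ≡ ⁺ 0
∂ℤ-𝟎 F w = ∑-zeroℤ _ λ s → cong (λ c → ⁺ (c * w [ s ]) ℤ.* F (dec 𝟎 s)) (lookup-𝟎 s)

+∑ : ∀ (f : Fin n → ℕ) → ℤΣ.sum (λ s → ⁺ f s) ≡ ⁺ ∑ f
+∑ {zero}  f = refl
+∑ {suc n} f = cong (λ z → ⁺ f zero ℤ.+ z) (+∑ (f ∘ suc))

∂ℤ-+N : ∀ (F : Vec ℕ n → ℕ) w C → ∂ℤ w (λ x → ⁺ F x) C ≡ ⁺ ∂ w F C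
∂ℤ-+N F w C = trans (ℤΣ.sum-cong-≗ λ s → sym (ℤ.pos-* (C [ s ] * w [ s ]) (F (dec C s)))) (+∑ (λ s → C [ s ] * w [ s ] * F (dec C s)))

-- The product rule for the monomial x_j x^C, with F read as a linear functional given by its values
-- on monomials.
∂ℤ-inc : ∀ (F : Vec ℕ n → ℤ) w C j →
  ∂ℤ w F (inc C j) ≡ ⁺ w [ j ] ℤ.* F C ℤ.+ ∂ℤ w (λ x → F (inc x j)) C
∂ℤ-inc {suc n} F w C j = begin
  ℤΣ.sum f                                                       ≡⟨ ℤΣ.sum-remove {i = j} f ⟩
  f j ℤ.+ ℤΣ.sum (f ∘ punchIn j)                                 ≡⟨ cong₂ ℤ._+_ fj (ℤΣ.sum-cong-≗ other) ⟩
  (⁺ w [ j ] ℤ.* F C ℤ.+ g j) ℤ.+ ℤΣ.sum (g ∘ punchIn j)         ≡⟨ ℤ.+-assoc (⁺ w [ j ] ℤ.* F C) (g j) _ ⟩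
  ⁺ w [ j ] ℤ.* F C ℤ.+ (g j ℤ.+ ℤΣ.sum (g ∘ punchIn j))         ≡⟨ cong (λ z → ⁺ w [ j ] ℤ.* F C ℤ.+ z) (sym (ℤΣ.sum-remove {i = j} g)) ⟩
  ⁺ w [ j ] ℤ.* F C ℤ.+ ℤΣ.sum g ∎
  where
  open ≡-Reasoning
  f g : Fin (suc n) → ℤ
  f s = ⁺ (inc C j [ s ] * w [ s ]) ℤ.* F (dec (inc C j) s)
  g s = ⁺ (C [ s ] * w [ s ]) ℤ.* F (inc (dec C s) j)
  F≡ : ⁺ (C [ j ] * w [ j ]) ℤ.* F C ≡ g j
  F≡ with C [ j ] in e
  ... | zero  = refl
  ... | suc c = cong (λ x → ⁺ (suc c * w [ j ]) ℤ.* F x) (sym (inc-dec C j (λ z → ℕ.1+n≢0 (trans (sym e) z))))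
  split : ∀ c v (z : ℤ) → ⁺ (suc c * v) ℤ.* z ≡ ⁺ v ℤ.* z ℤ.+ ⁺ (c * v) ℤ.* z
  split c v z = trans (cong (ℤ._* z) (ℤ.pos-+ v (c * v))) (ℤ.*-distribʳ-+ z (⁺ v) (⁺ (c * v)))
  fj : f j ≡ ⁺ w [ j ] ℤ.* F C ℤ.+ g j
  fj = begin
    f j ≡⟨ cong₂ (λ c x → ⁺ (c * w [ j ]) ℤ.* F x) (Vec.lookup∘updateAt j C) (dec-inc C j) ⟩
    ⁺ (suc (C [ j ]) * w [ j ]) ℤ.* F C ≡⟨ split (C [ j ]) (w [ j ]) (F C) ⟩
    ⁺ w [ j ] ℤ.* F C ℤ.+ ⁺ (C [ j ] * w [ j ]) ℤ.* F C ≡⟨ cong (λ z → ⁺ w [ j ] ℤ.* F C ℤ.+ z) F≡ ⟩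
    ⁺ w [ j ] ℤ.* F C ℤ.+ g j ∎
  other : ∀ x → f (punchIn j x) ≡ g (punchIn j x)
  other x = cong₂ (λ c y → ⁺ (c * w [ punchIn j x ]) ℤ.* F y)
    (Vec.lookup∘updateAt′ (punchIn j x) j (punchInᵢ≢i j x) C)
    (Vec.updateAt-commutes (punchIn j x) j (punchInᵢ≢i j x) C)

-- A linear functional, given by its values on monomials y^c z^c′ u^a v^b in which the four groups
-- of variables are formally independent. An operator acts on the monomial before the functional is
-- applied.
St : ℕ → Set
St n = (c c′ a b : Vec ℕ n) → ℤ

-- A polynomial in y = u + v, z = u − v, u, v with exponent vectors c, c′, a, b;
-- 𝒰 and 𝒱 are the derivatives in the directions u and v.
𝒰 𝒱 : Vec ℕ n → St n → St n
𝒰 w F c c′ a b = ∂ℤ w (λ x → F x c′ a b) c ℤ.+ ∂ℤ w (λ x → F c x a b) c′ ℤ.+ ∂ℤ w (λ x → F c c′ x b) a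
𝒱 w F c c′ a b = ∂ℤ w (λ x → F x c′ a b) c ℤ.- ∂ℤ w (λ x → F c x a b) c′ ℤ.+ ∂ℤ w (λ x → F c c′ a x) b

-- After all derivatives the polynomial is evaluated at u = 1 and v = 0, hence at y = z = 1. This
-- agrees with `pm [] C = 1` and still respects y = u + v and z = u - v.
Λ : List (Vec ℕ n) → St n
Λ []      c c′ a b = ⁺ (0 ^ total b)
Λ (w ∷ ρ) c c′ a b = 𝒰 w (𝒰 w (Λ ρ)) c c′ a b ℤ.- 𝒱 w (𝒱 w (Λ ρ)) c c′ a b

-- Since the variables are formally independent, the relations y = u + v and z = u - v have to be
-- imposed: such a functional descends to polynomials in u and v.
record Linear (F : St n) : Set where
  field
    y-split : ∀ j c c′ a b → F (inc c j) c′ a b ≡ F c c′ (inc a j) b ℤ.+ F c c′ a (inc b j)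
    z-split : ∀ j c c′ a b → F c (inc c′ j) a b ≡ F c c′ (inc a j) b ℤ.- F c c′ a (inc b j)
open Linear

-- The variables y, z and u all have derivative 1 in the direction u. So the extra term of the
-- product rule occurs once on either side, on the right in the summand with `inc a j`.
𝒰-linear : ∀ w {F : St n} → Linear F → Linear (𝒰 w F)
𝒰-linear w {F} L .y-split j c c′ a b
  rewrite ∂ℤ-inc (λ x → F x c′ a b) w c j
        | ∂ℤ-cong w c (λ x → y-split L j x c′ a b)
        | ∂ℤ-cong w c′ (λ x → y-split L j c x a b)
        | ∂ℤ-cong w a (λ x → y-split L j c c′ x b)
        | ∂ℤ-inc (λ x → F c c′ x b) w a j
        | ∂ℤ-+ (λ x → F x c′ (inc a j) b) (λ x → F x c′ a (inc b j)) w c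
        | ∂ℤ-+ (λ x → F c x (inc a j) b) (λ x → F c x a (inc b j)) w c′
        | ∂ℤ-+ (λ x → F c c′ (inc x j) b) (λ x → F c c′ x (inc b j)) w a
  = ring (⁺ w [ j ] ℤ.* F c c′ a b) (∂ℤ w (λ x → F x c′ (inc a j) b) c) (∂ℤ w (λ x → F x c′ a (inc b j)) c) (∂ℤ w (λ x → F c x (inc a j) b) c′) (∂ℤ w (λ x → F c x a (inc b j)) c′) (∂ℤ w (λ x → F c c′ (inc x j) b) a) (∂ℤ w (λ x → F c c′ x (inc b j)) a)
  where
  ring : ∀ t p q r s u v → (t ℤ.+ (p ℤ.+ q)) ℤ.+ (r ℤ.+ s) ℤ.+ (u ℤ.+ v) ≡ (p ℤ.+ r ℤ.+ (t ℤ.+ u)) ℤ.+ (q ℤ.+ s ℤ.+ v)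
  ring = ℤ-Solver.solve-∀
𝒰-linear w {F} L .z-split j c c′ a b
  rewrite ∂ℤ-inc (λ x → F c x a b) w c′ j
        | ∂ℤ-cong w c (λ x → z-split L j x c′ a b)
        | ∂ℤ-cong w c′ (λ x → z-split L j c x a b)
        | ∂ℤ-cong w a (λ x → z-split L j c c′ x b)
        | ∂ℤ-inc (λ x → F c c′ x b) w a j
        | ∂ℤ-- (λ x → F x c′ (inc a j) b) (λ x → F x c′ a (inc b j)) w c
        | ∂ℤ-- (λ x → F c x (inc a j) b) (λ x → F c x a (inc b j)) w c′
        | ∂ℤ-- (λ x → F c c′ (inc x j) b) (λ x → F c c′ x (inc b j)) w a
  = ring (⁺ w [ j ] ℤ.* F c c′ a b) (∂ℤ w (λ x → F x c′ (inc a j) b) c) (∂ℤ w (λ x → F x c′ a (inc b j)) c) (∂ℤ w (λ x → F c x (inc a j) b) c′) (∂ℤ w (λ x → F c x a (inc b j)) c′) (∂ℤ w (λ x → F c c′ (inc x j) b) a) (∂ℤ w (λ x → F c c′ x (inc b j)) a)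
  where
  ring : ∀ t p q r s u v → (p ℤ.- q) ℤ.+ (t ℤ.+ (r ℤ.- s)) ℤ.+ (u ℤ.- v) ≡ (p ℤ.+ r ℤ.+ (t ℤ.+ u)) ℤ.- (q ℤ.+ s ℤ.+ v)
  ring = ℤ-Solver.solve-∀

𝒱-linear : ∀ w {F : St n} → Linear F → Linear (𝒱 w F)
𝒱-linear w {F} L .y-split j c c′ a b
  rewrite ∂ℤ-inc (λ x → F x c′ a b) w c j
        | ∂ℤ-cong w c (λ x → y-split L j x c′ a b)
        | ∂ℤ-cong w c′ (λ x → y-split L j c x a b)
        | ∂ℤ-cong w b (λ x → y-split L j c c′ a x)
        | ∂ℤ-inc (λ x → F c c′ a x) w b j
        | ∂ℤ-+ (λ x → F x c′ (inc a j) b) (λ x → F x c′ a (inc b j)) w c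
        | ∂ℤ-+ (λ x → F c x (inc a j) b) (λ x → F c x a (inc b j)) w c′
        | ∂ℤ-+ (λ x → F c c′ (inc a j) x) (λ x → F c c′ a (inc x j)) w b
  = ring (⁺ w [ j ] ℤ.* F c c′ a b) (∂ℤ w (λ x → F x c′ (inc a j) b) c) (∂ℤ w (λ x → F x c′ a (inc b j)) c) (∂ℤ w (λ x → F c x (inc a j) b) c′) (∂ℤ w (λ x → F c x a (inc b j)) c′) (∂ℤ w (λ x → F c c′ (inc a j) x) b) (∂ℤ w (λ x → F c c′ a (inc x j)) b)
  where
  ring : ∀ t p q r s u v → (t ℤ.+ (p ℤ.+ q)) ℤ.- (r ℤ.+ s) ℤ.+ (u ℤ.+ v) ≡ (p ℤ.- r ℤ.+ u) ℤ.+ (q ℤ.- s ℤ.+ (t ℤ.+ v))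
  ring = ℤ-Solver.solve-∀
𝒱-linear w {F} L .z-split j c c′ a b
  rewrite ∂ℤ-inc (λ x → F c x a b) w c′ j
        | ∂ℤ-cong w c (λ x → z-split L j x c′ a b)
        | ∂ℤ-cong w c′ (λ x → z-split L j c x a b)
        | ∂ℤ-cong w b (λ x → z-split L j c c′ a x)
        | ∂ℤ-inc (λ x → F c c′ a x) w b j
        | ∂ℤ-- (λ x → F x c′ (inc a j) b) (λ x → F x c′ a (inc b j)) w c
        | ∂ℤ-- (λ x → F c x (inc a j) b) (λ x → F c x a (inc b j)) w c′
        | ∂ℤ-- (λ x → F c c′ (inc a j) x) (λ x → F c c′ a (inc x j)) w b
  = ring (⁺ w [ j ] ℤ.* F c c′ a b) (∂ℤ w (λ x → F x c′ (inc a j) b) c) (∂ℤ w (λ x → F x c′ a (inc b j)) c) (∂ℤ w (λ x → F c x (inc a j) b) c′) (∂ℤ w (λ x → F c x a (inc b j)) c′) (∂ℤ w (λ x → F c c′ (inc a j) x) b) (∂ℤ w (λ x → F c c′ a (inc x j)) b)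
  where
  ring : ∀ t p q r s u v → (p ℤ.- q) ℤ.- (t ℤ.+ (r ℤ.- s)) ℤ.+ (u ℤ.- v) ≡ (p ℤ.- r ℤ.+ u) ℤ.- (q ℤ.- s ℤ.+ (t ℤ.+ v))
  ring = ℤ-Solver.solve-∀

Λ-linear : ∀ (ρ : List (Vec ℕ n)) → Linear (Λ ρ)
Λ-linear [] .y-split j c c′ a b rewrite total-inc b j = sym (ℤ.+-identityʳ _)
Λ-linear [] .z-split j c c′ a b rewrite total-inc b j = sym (ℤ.+-identityʳ _)
Λ-linear (w ∷ ρ) = record
  { y-split = λ j c c′ a b → trans (cong₂ ℤ._-_ (y-split U j c c′ a b) (y-split V j c c′ a b))
      (ring₁ (𝒰 w (𝒰 w (Λ ρ)) c c′ (inc a j) b) (𝒰 w (𝒰 w (Λ ρ)) c c′ a (inc b j)) _ _)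
  ; z-split = λ j c c′ a b → trans (cong₂ ℤ._-_ (z-split U j c c′ a b) (z-split V j c c′ a b))
      (ring₂ (𝒰 w (𝒰 w (Λ ρ)) c c′ (inc a j) b) (𝒰 w (𝒰 w (Λ ρ)) c c′ a (inc b j)) _ _) }
  where
  U = 𝒰-linear w (𝒰-linear w (Λ-linear ρ))
  V = 𝒱-linear w (𝒱-linear w (Λ-linear ρ))
  ring₁ : ∀ p q r s → (p ℤ.+ q) ℤ.- (r ℤ.+ s) ≡ (p ℤ.- r) ℤ.+ (q ℤ.- s)
  ring₁ = ℤ-Solver.solve-∀
  ring₂ : ∀ p q r s → (p ℤ.- q) ℤ.- (r ℤ.- s) ≡ (p ℤ.- r) ℤ.- (q ℤ.- s)
  ring₂ = ℤ-Solver.solve-∀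

module _ (k : ℤ) (p : Vec ℕ n → ℤ) (w : Vec ℕ n) where

  private
    P Q : Vec ℕ n → ℤ
    P = ∂ℤ w p
    Q = ∂ℤ w P

    ∂left : ∀ (f g : Vec ℕ n → ℤ) c c′ → ∂ℤ w (λ x → k ℤ.* (f x ℤ.* g c′)) c ≡ k ℤ.* (∂ℤ w f c ℤ.* g c′)
    ∂left f g c c′ = trans (∂ℤ-cong w c (λ x → r (f x) (g c′)))
                    (trans (∂ℤ-* (k ℤ.* g c′) f w c) (sym (r (∂ℤ w f c) (g c′))))
      where
      r : ∀ a b → k ℤ.* (a ℤ.* b) ≡ (k ℤ.* b) ℤ.* a
      r a b = trans (cong (k ℤ.*_) (ℤ.*-comm a b)) (sym (ℤ.*-assoc k b a))

    ∂right : ∀ (f g : Vec ℕ n → ℤ) c c′ → ∂ℤ w (λ x → k ℤ.* (f c ℤ.* g x)) c′ ≡ k ℤ.* (f c ℤ.* ∂ℤ w g c′)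
    ∂right f g c c′ = trans (∂ℤ-cong w c′ (λ x → sym (ℤ.*-assoc k (f c) (g x))))
                    (trans (∂ℤ-* (k ℤ.* f c) g w c′) (ℤ.*-assoc k (f c) (∂ℤ w g c′)))

  -- On monomials in y and z alone, ∂u = ∂y + ∂z and ∂v = ∂y - ∂z, so ∂u² - ∂v² = 4 ∂y ∂z, and a
  -- functional that splits into a y part and a z part keeps this form.
  𝒰𝒰-𝒱𝒱 : ∀ (F : St n) → (∀ c c′ → F c c′ 𝟎 𝟎 ≡ k ℤ.* (p c ℤ.* p c′)) → ∀ c c′ →
    𝒰 w (𝒰 w F) c c′ 𝟎 𝟎 ℤ.- 𝒱 w (𝒱 w F) c c′ 𝟎 𝟎 ≡ (⁺ 4 ℤ.* k) ℤ.* (∂ℤ w p c ℤ.* ∂ℤ w p c′)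
  𝒰𝒰-𝒱𝒱 F eq c c′ = begin
    𝒰 w (𝒰 w F) c c′ 𝟎 𝟎 ℤ.- 𝒱 w (𝒱 w F) c c′ 𝟎 𝟎
      ≡⟨ cong₂ ℤ._-_ UU VV ⟩
    ((k ℤ.* (Q c ℤ.* p c′) ℤ.+ k ℤ.* (P c ℤ.* P c′)) ℤ.+ (k ℤ.* (P c ℤ.* P c′) ℤ.+ k ℤ.* (p c ℤ.* Q c′))) ℤ.-
    ((k ℤ.* (Q c ℤ.* p c′) ℤ.- k ℤ.* (P c ℤ.* P c′)) ℤ.- (k ℤ.* (P c ℤ.* P c′) ℤ.- k ℤ.* (p c ℤ.* Q c′)))
      ≡⟨ ring k (Q c ℤ.* p c′) (P c ℤ.* P c′) (p c ℤ.* Q c′) ⟩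
    (⁺ 4 ℤ.* k) ℤ.* (P c ℤ.* P c′) ∎
    where
    open ≡-Reasoning
    ring : ∀ k x y z → ((k ℤ.* x ℤ.+ k ℤ.* y) ℤ.+ (k ℤ.* y ℤ.+ k ℤ.* z)) ℤ.- ((k ℤ.* x ℤ.- k ℤ.* y) ℤ.- (k ℤ.* y ℤ.- k ℤ.* z)) ≡ (⁺ 4 ℤ.* k) ℤ.* y
    ring = ℤ-Solver.solve-∀
    U : ∀ c c′ → 𝒰 w F c c′ 𝟎 𝟎 ≡ k ℤ.* (P c ℤ.* p c′) ℤ.+ k ℤ.* (p c ℤ.* P c′)
    U c c′ = begin
      𝒰 w F c c′ 𝟎 𝟎
        ≡⟨ cong (λ z → ∂ℤ w (λ x → F x c′ 𝟎 𝟎) c ℤ.+ ∂ℤ w (λ x → F c x 𝟎 𝟎) c′ ℤ.+ z) (∂ℤ-𝟎 (λ x → F c c′ x 𝟎) w) ⟩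
      ∂ℤ w (λ x → F x c′ 𝟎 𝟎) c ℤ.+ ∂ℤ w (λ x → F c x 𝟎 𝟎) c′ ℤ.+ ⁺ 0
        ≡⟨ ℤ.+-identityʳ _ ⟩
      ∂ℤ w (λ x → F x c′ 𝟎 𝟎) c ℤ.+ ∂ℤ w (λ x → F c x 𝟎 𝟎) c′
        ≡⟨ cong₂ ℤ._+_ (trans (∂ℤ-cong w c (λ x → eq x c′)) (∂left p p c c′)) (trans (∂ℤ-cong w c′ (λ x → eq c x)) (∂right p p c c′)) ⟩
      k ℤ.* (P c ℤ.* p c′) ℤ.+ k ℤ.* (p c ℤ.* P c′) ∎
    V : ∀ c c′ → 𝒱 w F c c′ 𝟎 𝟎 ≡ k ℤ.* (P c ℤ.* p c′) ℤ.- k ℤ.* (p c ℤ.* P c′)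
    V c c′ = begin
      𝒱 w F c c′ 𝟎 𝟎
        ≡⟨ cong (λ z → ∂ℤ w (λ x → F x c′ 𝟎 𝟎) c ℤ.- ∂ℤ w (λ x → F c x 𝟎 𝟎) c′ ℤ.+ z) (∂ℤ-𝟎 (λ x → F c c′ 𝟎 x) w) ⟩
      ∂ℤ w (λ x → F x c′ 𝟎 𝟎) c ℤ.- ∂ℤ w (λ x → F c x 𝟎 𝟎) c′ ℤ.+ ⁺ 0
        ≡⟨ ℤ.+-identityʳ _ ⟩
      ∂ℤ w (λ x → F x c′ 𝟎 𝟎) c ℤ.- ∂ℤ w (λ x → F c x 𝟎 𝟎) c′
        ≡⟨ cong₂ ℤ._-_ (trans (∂ℤ-cong w c (λ x → eq x c′)) (∂left p p c c′)) (trans (∂ℤ-cong w c′ (λ x → eq c x)) (∂right p p c c′)) ⟩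
      k ℤ.* (P c ℤ.* p c′) ℤ.- k ℤ.* (p c ℤ.* P c′) ∎
    UU : 𝒰 w (𝒰 w F) c c′ 𝟎 𝟎 ≡ (k ℤ.* (Q c ℤ.* p c′) ℤ.+ k ℤ.* (P c ℤ.* P c′)) ℤ.+ (k ℤ.* (P c ℤ.* P c′) ℤ.+ k ℤ.* (p c ℤ.* Q c′))
    UU = begin
      𝒰 w (𝒰 w F) c c′ 𝟎 𝟎
        ≡⟨ cong (λ z → ∂ℤ w (λ x → 𝒰 w F x c′ 𝟎 𝟎) c ℤ.+ ∂ℤ w (λ x → 𝒰 w F c x 𝟎 𝟎) c′ ℤ.+ z) (∂ℤ-𝟎 (λ x → 𝒰 w F c c′ x 𝟎) w) ⟩
      ∂ℤ w (λ x → 𝒰 w F x c′ 𝟎 𝟎) c ℤ.+ ∂ℤ w (λ x → 𝒰 w F c x 𝟎 𝟎) c′ ℤ.+ ⁺ 0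
        ≡⟨ ℤ.+-identityʳ _ ⟩
      ∂ℤ w (λ x → 𝒰 w F x c′ 𝟎 𝟎) c ℤ.+ ∂ℤ w (λ x → 𝒰 w F c x 𝟎 𝟎) c′
        ≡⟨ cong₂ ℤ._+_
             (trans (∂ℤ-cong w c (λ x → U x c′))
               (trans (∂ℤ-+ (λ x → k ℤ.* (P x ℤ.* p c′)) (λ x → k ℤ.* (p x ℤ.* P c′)) w c)
                      (cong₂ ℤ._+_ (∂left P p c c′) (∂left p P c c′))))
             (trans (∂ℤ-cong w c′ (λ x → U c x))
               (trans (∂ℤ-+ (λ x → k ℤ.* (P c ℤ.* p x)) (λ x → k ℤ.* (p c ℤ.* P x)) w c′)
                      (cong₂ ℤ._+_ (∂right P p c c′) (∂right p P c c′)))) ⟩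
      (k ℤ.* (Q c ℤ.* p c′) ℤ.+ k ℤ.* (P c ℤ.* P c′)) ℤ.+ (k ℤ.* (P c ℤ.* P c′) ℤ.+ k ℤ.* (p c ℤ.* Q c′)) ∎
    VV : 𝒱 w (𝒱 w F) c c′ 𝟎 𝟎 ≡ (k ℤ.* (Q c ℤ.* p c′) ℤ.- k ℤ.* (P c ℤ.* P c′)) ℤ.- (k ℤ.* (P c ℤ.* P c′) ℤ.- k ℤ.* (p c ℤ.* Q c′))
    VV = begin
      𝒱 w (𝒱 w F) c c′ 𝟎 𝟎
        ≡⟨ cong (λ z → ∂ℤ w (λ x → 𝒱 w F x c′ 𝟎 𝟎) c ℤ.- ∂ℤ w (λ x → 𝒱 w F c x 𝟎 𝟎) c′ ℤ.+ z) (∂ℤ-𝟎 (λ x → 𝒱 w F c c′ 𝟎 x) w) ⟩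
      ∂ℤ w (λ x → 𝒱 w F x c′ 𝟎 𝟎) c ℤ.- ∂ℤ w (λ x → 𝒱 w F c x 𝟎 𝟎) c′ ℤ.+ ⁺ 0
        ≡⟨ ℤ.+-identityʳ _ ⟩
      ∂ℤ w (λ x → 𝒱 w F x c′ 𝟎 𝟎) c ℤ.- ∂ℤ w (λ x → 𝒱 w F c x 𝟎 𝟎) c′
        ≡⟨ cong₂ ℤ._-_
             (trans (∂ℤ-cong w c (λ x → V x c′))
               (trans (∂ℤ-- (λ x → k ℤ.* (P x ℤ.* p c′)) (λ x → k ℤ.* (p x ℤ.* P c′)) w c)
                      (cong₂ ℤ._-_ (∂left P p c c′) (∂left p P c c′))))
             (trans (∂ℤ-cong w c′ (λ x → V c x))
               (trans (∂ℤ-- (λ x → k ℤ.* (P c ℤ.* p x)) (λ x → k ℤ.* (p c ℤ.* P x)) w c′)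
                      (cong₂ ℤ._-_ (∂right P p c c′) (∂right p P c c′)))) ⟩
      (k ℤ.* (Q c ℤ.* p c′) ℤ.- k ℤ.* (P c ℤ.* P c′)) ℤ.- (k ℤ.* (P c ℤ.* P c′) ℤ.- k ℤ.* (p c ℤ.* Q c′)) ∎

Λ-yz : ∀ (ρ : List (Vec ℕ n)) c c′ → Λ ρ c c′ 𝟎 𝟎 ≡ ⁺ (4 ^ length ρ) ℤ.* (⁺ pm ρ c ℤ.* ⁺ pm ρ c′)
Λ-yz {n} [] c c′ rewrite total-𝟎 {n} = refl
Λ-yz (w ∷ ρ) c c′ = trans (𝒰𝒰-𝒱𝒱 (⁺ (4 ^ length ρ)) (λ x → ⁺ pm ρ x) w (Λ ρ) (Λ-yz ρ) c c′)
  (cong₂ (λ k z → k ℤ.* z) (sym (ℤ.pos-* 4 (4 ^ length ρ))) (cong₂ ℤ._*_ (∂ℤ-+N (pm ρ) w c) (∂ℤ-+N (pm ρ) w c′)))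

-- Λ on monomials in u and v alone, up to its sign.
Λ⁺ : List (Vec ℕ n) → (a b : Vec ℕ n) → ℕ
Λ⁺ []      a b = 1
Λ⁺ (w ∷ ρ) a b = ∂ w (∂ w (λ x → Λ⁺ ρ x b)) a + ∂ w (∂ w (λ x → Λ⁺ ρ a x)) b

-- This is (-1)^(m/2) for even m. For odd degree in v both sides of `Λ-uv` vanish, as variables
-- leave in pairs, so there the initial value is a default.
sg : ℕ → ℤ
sg 0             = ⁺ 1
sg 1             = ⁺ 1
sg (suc (suc m)) = ℤ.- sg m

∂ℤ-sg : ∀ e (F : Vec ℕ n → ℕ) w C → ∂ℤ w (λ x → e ℤ.* ⁺ F x) C ≡ e ℤ.* ⁺ ∂ w F C
∂ℤ-sg e F w C = trans (∂ℤ-* e (λ x → ⁺ F x) w C) (cong (e ℤ.*_) (∂ℤ-+N F w C))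

pred-double : ∀ {m} s → suc s ≡ 2 * suc m → s ≡ suc (2 * m)
pred-double {m} s e = ℕ.suc-injective (trans e (ℕ.*-suc 2 m))

-- The sign of -∂v² appears exactly when two variables v are removed, so it depends on the degree in
-- v alone. The condition on the total degree forces all variables to be used up, and at b = 0 the
-- base case is 1.
Λ-uv : ∀ (ρ : List (Vec ℕ n)) a b → total a + total b ≡ 2 * length ρ →
  Λ ρ 𝟎 𝟎 a b ≡ sg (total b) ℤ.* ⁺ Λ⁺ ρ a b
Λ-uv [] a b e rewrite ℕ.m+n≡0⇒n≡0 (total a) e = refl
Λ-uv {n} (w ∷ ρ) a b e = begin
  𝒰 w (𝒰 w (Λ ρ)) 𝟎 𝟎 a b ℤ.- 𝒱 w (𝒱 w (Λ ρ)) 𝟎 𝟎 a b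
    ≡⟨ cong₂ ℤ._-_ (trans (U-𝟎 (𝒰 w (Λ ρ)) a b) UU) (trans (V-𝟎 (𝒱 w (Λ ρ)) a b) VV) ⟩
  σ ℤ.* ⁺ ∂ w (∂ w (λ x → Λ⁺ ρ x b)) a ℤ.- ℤ.- σ ℤ.* ⁺ ∂ w (∂ w (λ x → Λ⁺ ρ a x)) b
    ≡⟨ ring σ (⁺ ∂ w (∂ w (λ x → Λ⁺ ρ x b)) a) (⁺ ∂ w (∂ w (λ x → Λ⁺ ρ a x)) b) ⟩
  σ ℤ.* (⁺ ∂ w (∂ w (λ x → Λ⁺ ρ x b)) a ℤ.+ ⁺ ∂ w (∂ w (λ x → Λ⁺ ρ a x)) b)
    ≡⟨⟩
  σ ℤ.* ⁺ Λ⁺ (w ∷ ρ) a b ∎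
  where
  open ≡-Reasoning
  σ = sg (total b)
  ring : ∀ s x y → s ℤ.* x ℤ.- ℤ.- s ℤ.* y ≡ s ℤ.* (x ℤ.+ y)
  ring = ℤ-Solver.solve-∀
  U-𝟎 : ∀ (F : St n) a b → 𝒰 w F 𝟎 𝟎 a b ≡ ∂ℤ w (λ x → F 𝟎 𝟎 x b) a
  U-𝟎 F a b rewrite ∂ℤ-𝟎 (λ x → F x 𝟎 a b) w | ∂ℤ-𝟎 (λ x → F 𝟎 x a b) w = ℤ.+-identityˡ _
  V-𝟎 : ∀ (F : St n) a b → 𝒱 w F 𝟎 𝟎 a b ≡ ∂ℤ w (λ x → F 𝟎 𝟎 a x) b
  V-𝟎 F a b rewrite ∂ℤ-𝟎 (λ x → F x 𝟎 a b) w | ∂ℤ-𝟎 (λ x → F 𝟎 x a b) w = ℤ.+-identityˡ _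
  UU : ∂ℤ w (λ x → 𝒰 w (Λ ρ) 𝟎 𝟎 x b) a ≡ σ ℤ.* ⁺ ∂ w (∂ w (λ x → Λ⁺ ρ x b)) a
  UU = begin
    ∂ℤ w (λ x → 𝒰 w (Λ ρ) 𝟎 𝟎 x b) a
      ≡⟨ ∂ℤ-cong′ {F = λ x → 𝒰 w (Λ ρ) 𝟎 𝟎 x b} {G = λ x → σ ℤ.* ⁺ ∂ w (λ x → Λ⁺ ρ x b) x} w a (λ s a≢0 → begin
           𝒰 w (Λ ρ) 𝟎 𝟎 (dec a s) b
             ≡⟨ U-𝟎 (Λ ρ) (dec a s) b ⟩
           ∂ℤ w (λ x → Λ ρ 𝟎 𝟎 x b) (dec a s)
             ≡⟨ ∂ℤ-cong′ {F = λ x → Λ ρ 𝟎 𝟎 x b} {G = λ x → σ ℤ.* ⁺ Λ⁺ ρ x b} w (dec a s) (λ t a′≢0 → Λ-uv ρ _ b (degree s t a≢0 a′≢0)) ⟩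
           ∂ℤ w (λ x → σ ℤ.* ⁺ Λ⁺ ρ x b) (dec a s)
             ≡⟨ ∂ℤ-sg σ (λ x → Λ⁺ ρ x b) w (dec a s) ⟩
           σ ℤ.* ⁺ ∂ w (λ x → Λ⁺ ρ x b) (dec a s) ∎) ⟩
    ∂ℤ w (λ x → σ ℤ.* ⁺ ∂ w (λ x → Λ⁺ ρ x b) x) a
      ≡⟨ ∂ℤ-sg σ (∂ w (λ x → Λ⁺ ρ x b)) w a ⟩
    σ ℤ.* ⁺ ∂ w (∂ w (λ x → Λ⁺ ρ x b)) a ∎
    where
    degree : ∀ s t → a [ s ] ≢ 0 → dec a s [ t ] ≢ 0 → total (dec (dec a s) t) + total b ≡ 2 * length ρ
    degree s t p q = ℕ.suc-injective (trans (cong (_+ total b) (total-dec (dec a s) t q))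
      (pred-double _ (trans (cong (_+ total b) (total-dec a s p)) e)))
  VV : ∂ℤ w (λ x → 𝒱 w (Λ ρ) 𝟎 𝟎 a x) b ≡ ℤ.- σ ℤ.* ⁺ ∂ w (∂ w (λ x → Λ⁺ ρ a x)) b
  VV = begin
    ∂ℤ w (λ x → 𝒱 w (Λ ρ) 𝟎 𝟎 a x) b
      ≡⟨ ∂ℤ-cong′ {F = λ x → 𝒱 w (Λ ρ) 𝟎 𝟎 a x} {G = λ x → ℤ.- σ ℤ.* ⁺ ∂ w (λ x → Λ⁺ ρ a x) x} w b (λ s b≢0 → begin
           𝒱 w (Λ ρ) 𝟎 𝟎 a (dec b s)
             ≡⟨ V-𝟎 (Λ ρ) a (dec b s) ⟩
           ∂ℤ w (λ x → Λ ρ 𝟎 𝟎 a x) (dec b s)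
             ≡⟨ ∂ℤ-cong′ {F = λ x → Λ ρ 𝟎 𝟎 a x} {G = λ x → ℤ.- σ ℤ.* ⁺ Λ⁺ ρ a x} w (dec b s) (λ t b′≢0 →
                  trans (Λ-uv ρ a _ (degree s t b≢0 b′≢0)) (cong (ℤ._* ⁺ Λ⁺ ρ a (dec (dec b s) t)) (sign s t b≢0 b′≢0))) ⟩
           ∂ℤ w (λ x → ℤ.- σ ℤ.* ⁺ Λ⁺ ρ a x) (dec b s)
             ≡⟨ ∂ℤ-sg (ℤ.- σ) (λ x → Λ⁺ ρ a x) w (dec b s) ⟩
           ℤ.- σ ℤ.* ⁺ ∂ w (λ x → Λ⁺ ρ a x) (dec b s) ∎) ⟩
    ∂ℤ w (λ x → ℤ.- σ ℤ.* ⁺ ∂ w (λ x → Λ⁺ ρ a x) x) b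
      ≡⟨ ∂ℤ-sg (ℤ.- σ) (∂ w (λ x → Λ⁺ ρ a x)) w b ⟩
    ℤ.- σ ℤ.* ⁺ ∂ w (∂ w (λ x → Λ⁺ ρ a x)) b ∎
    where
    total2 : ∀ s t → b [ s ] ≢ 0 → dec b s [ t ] ≢ 0 → suc (suc (total (dec (dec b s) t))) ≡ total b
    total2 s t p q = trans (cong suc (total-dec (dec b s) t q)) (total-dec b s p)
    degree : ∀ s t → b [ s ] ≢ 0 → dec b s [ t ] ≢ 0 → total a + total (dec (dec b s) t) ≡ 2 * length ρ
    degree s t p q = ℕ.suc-injective (pred-double _ (trans (sym (trans (ℕ.+-suc (total a) _) (cong suc (ℕ.+-suc (total a) _))))
      (trans (cong (λ z → total a + z) (total2 s t p q)) e)))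
    sign : ∀ s t → b [ s ] ≢ 0 → dec b s [ t ] ≢ 0 → sg (total (dec (dec b s) t)) ≡ ℤ.- σ
    sign s t p q = trans (sym (ℤ.neg-involutive _)) (cong (λ z → ℤ.- sg z) (total2 s t p q))

_⊕_ : Vec ℕ n → Vec ℕ n → Vec ℕ n
_⊕_ = zipWith _+_

inc-⊕ˡ : ∀ (a b : Vec ℕ n) j → inc a j ⊕ b ≡ inc (a ⊕ b) j
inc-⊕ˡ (x ∷ a) (y ∷ b) zero    = refl
inc-⊕ˡ (x ∷ a) (y ∷ b) (suc j) = cong (x + y ∷_) (inc-⊕ˡ a b j)

inc-⊕ʳ : ∀ (a b : Vec ℕ n) j → a ⊕ inc b j ≡ inc (a ⊕ b) j
inc-⊕ʳ (x ∷ a) (y ∷ b) zero    = cong (_∷ (a ⊕ b)) (ℕ.+-suc x y)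
inc-⊕ʳ (x ∷ a) (y ∷ b) (suc j) = cong (x + y ∷_) (inc-⊕ʳ a b j)

total≡0⇒𝟎 : (C : Vec ℕ n) → total C ≡ 0 → C ≡ 𝟎
total≡0⇒𝟎 []      e = refl
total≡0⇒𝟎 (x ∷ C) e = cong₂ _∷_ (ℕ.m+n≡0⇒m≡0 x e) (total≡0⇒𝟎 C (ℕ.m+n≡0⇒n≡0 x e))

total-pos : ∀ {k} (C : Vec ℕ n) → total C ≡ suc k → ∃[ j ] C [ j ] ≢ 0
total-pos (suc x ∷ C) e = zero , λ ()
total-pos (zero ∷ C)  e with total-pos C e
... | j , p = suc j , p

⊕-𝟎ˡ : (a : Vec ℕ n) → 𝟎 ⊕ a ≡ a
⊕-𝟎ˡ []      = refl
⊕-𝟎ˡ (x ∷ a) = cong (x ∷_) (⊕-𝟎ˡ a)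

-- Expanding (uⱼ² − vⱼ²)^{cⱼ} term by term, every resulting monomial contributes with the same sign.
Λ-≥ : ∀ k (ρ : List (Vec ℕ n)) c a b → total c ≡ k → 2 * total c + (total a + total b) ≡ 2 * length ρ →
  ∃[ x ] (Λ ρ c c a b ≡ sg (total b) ℤ.* ⁺ x × Λ⁺ ρ ((c ⊕ c) ⊕ a) b ≤ x)
Λ-≥ {n} zero ρ c a b ek e with total≡0⇒𝟎 c ek
... | refl = Λ⁺ ρ a b , Λ-uv ρ a b (trans (cong (λ z → 2 * z + (total a + total b)) (sym (total-𝟎 {n}))) e)
  , ℕ.≤-reflexive (cong (λ z → Λ⁺ ρ z b) (trans (cong (_⊕ a) (⊕-𝟎ˡ 𝟎)) (⊕-𝟎ˡ a)))
Λ-≥ {n} (suc k) ρ c a b ek e with total-pos c ek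
... | j , cj≢0 = x₁ + x₂ , eq , ℕ.≤-trans (ℕ.≤-reflexive (cong (λ z → Λ⁺ ρ z b) vec)) (ℕ.≤-trans p₁ (ℕ.m≤m+n x₁ x₂))
  where
  open ≡-Reasoning
  d = dec c j
  c≡ : inc d j ≡ c
  c≡ = inc-dec c j cj≢0
  tot : ∀ s → suc (total d) + s ≡ total c + s
  tot s = cong (_+ s) (total-dec c j cj≢0)
  e₀ : 2 * suc (total d) + (total a + total b) ≡ 2 * length ρ
  e₀ = trans (cong (λ z → 2 * z + (total a + total b)) (total-dec c j cj≢0)) e
  two : (v : Vec ℕ n) → total (inc (inc v j) j) ≡ 2 + total v
  two v = trans (total-inc (inc v j) j) (cong suc (total-inc v j))
  shift₁ : ∀ d a b → 2 * d + ((2 + a) + b) ≡ 2 * suc d + (a + b)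
  shift₁ = ℕ-Solver.solve-∀
  shift₂ : ∀ d a b → 2 * d + (a + (2 + b)) ≡ 2 * suc d + (a + b)
  shift₂ = ℕ-Solver.solve-∀
  ih₁ = Λ-≥ k ρ d (inc (inc a j) j) b (ℕ.suc-injective (trans (total-dec c j cj≢0) ek))
    (trans (cong (λ z → 2 * total d + (z + total b)) (two a)) (trans (shift₁ (total d) (total a) (total b)) e₀))
  ih₂ = Λ-≥ k ρ d a (inc (inc b j) j) (ℕ.suc-injective (trans (total-dec c j cj≢0) ek))
    (trans (cong (λ z → 2 * total d + (total a + z)) (two b)) (trans (shift₂ (total d) (total a) (total b)) e₀))
  x₁ = proj₁ ih₁
  x₂ = proj₁ ih₂
  p₁ = proj₂ (proj₂ ih₁)
  σ = sg (total b)
  L = Λ-linear ρ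
  ring₁ : ∀ p q r → (p ℤ.- q) ℤ.+ (q ℤ.- r) ≡ p ℤ.- r
  ring₁ = ℤ-Solver.solve-∀
  ring₂ : ∀ s x y → s ℤ.* x ℤ.- ℤ.- s ℤ.* y ≡ s ℤ.* (x ℤ.+ y)
  ring₂ = ℤ-Solver.solve-∀
  eq : Λ ρ c c a b ≡ σ ℤ.* ⁺ (x₁ + x₂)
  eq = begin
    Λ ρ c c a b
      ≡⟨ cong (λ c → Λ ρ c c a b) (sym c≡) ⟩
    Λ ρ (inc d j) (inc d j) a b
      ≡⟨ Linear.y-split L j d (inc d j) a b ⟩
    Λ ρ d (inc d j) (inc a j) b ℤ.+ Λ ρ d (inc d j) a (inc b j)
      ≡⟨ cong₂ ℤ._+_ (Linear.z-split L j d d (inc a j) b) (Linear.z-split L j d d a (inc b j)) ⟩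
    (Λ ρ d d (inc (inc a j) j) b ℤ.- Λ ρ d d (inc a j) (inc b j)) ℤ.+ (Λ ρ d d (inc a j) (inc b j) ℤ.- Λ ρ d d a (inc (inc b j) j))
      -- The mixed monomials with u_j v_j cancel, because y_j z_j = u_j² - v_j². The minus sign is
      -- taken up by `sg`, since `total b` grows by two.
      ≡⟨ ring₁ (Λ ρ d d (inc (inc a j) j) b) (Λ ρ d d (inc a j) (inc b j)) (Λ ρ d d a (inc (inc b j) j)) ⟩
    Λ ρ d d (inc (inc a j) j) b ℤ.- Λ ρ d d a (inc (inc b j) j)
      ≡⟨ cong₂ ℤ._-_ (proj₁ (proj₂ ih₁)) (trans (proj₁ (proj₂ ih₂)) (cong (λ z → sg z ℤ.* ⁺ x₂) (two b))) ⟩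
    σ ℤ.* ⁺ x₁ ℤ.- ℤ.- σ ℤ.* ⁺ x₂
      ≡⟨ ring₂ σ (⁺ x₁) (⁺ x₂) ⟩
    σ ℤ.* ⁺ (x₁ + x₂) ∎
  vec : (c ⊕ c) ⊕ a ≡ (d ⊕ d) ⊕ inc (inc a j) j
  vec = begin
    (c ⊕ c) ⊕ a                        ≡⟨ cong (λ c → (c ⊕ c) ⊕ a) (sym c≡) ⟩
    (inc d j ⊕ inc d j) ⊕ a            ≡⟨ cong (_⊕ a) (trans (inc-⊕ˡ d (inc d j) j) (cong (λ z → inc z j) (inc-⊕ʳ d d j))) ⟩
    inc (inc (d ⊕ d) j) j ⊕ a          ≡⟨ trans (inc-⊕ˡ (inc (d ⊕ d) j) a j) (cong (λ z → inc z j) (inc-⊕ˡ (d ⊕ d) a j)) ⟩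
    inc (inc ((d ⊕ d) ⊕ a) j) j        ≡⟨ sym (trans (inc-⊕ʳ (d ⊕ d) (inc a j) j) (cong (λ z → inc z j) (inc-⊕ʳ (d ⊕ d) a j))) ⟩
    (d ⊕ d) ⊕ inc (inc a j) j ∎

-- Repeated doubling of rows and columns

double : ∀ {A : Set} → List A → List A
double []       = []
double (x ∷ xs) = x ∷ x ∷ double xs

∂-cong : ∀ {F G : Vec ℕ n → ℕ} w C → (∀ x → F x ≡ G x) → ∂ w F C ≡ ∂ w G C
∂-cong w C eq = sum-cong-≗ (λ s → cong (C [ s ] * w [ s ] *_) (eq (dec C s)))

∂-𝟎 : ∀ (F : Vec ℕ n → ℕ) w → ∂ w F 𝟎 ≡ 0
∂-𝟎 {n} F w = trans (sum-cong-≗ (λ s → cong (λ c → c * w [ s ] * F (dec 𝟎 s)) (lookup-𝟎 s))) (sum-replicate-zero n)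

Λ⁺-double : ∀ (ρ : List (Vec ℕ n)) a → Λ⁺ ρ a 𝟎 ≡ pm (double ρ) a
Λ⁺-double []      a = refl
Λ⁺-double (w ∷ ρ) a = trans (cong (λ z → ∂ w (∂ w (λ x → Λ⁺ ρ x 𝟎)) a + z) (∂-𝟎 (∂ w (λ x → Λ⁺ ρ a x)) w))
  (trans (ℕ.+-identityʳ _) (∂-cong w a (λ x → ∂-cong w x (Λ⁺-double ρ))))

⊕-𝟎ʳ : (a : Vec ℕ n) → a ⊕ 𝟎 ≡ a
⊕-𝟎ʳ []      = refl
⊕-𝟎ʳ (x ∷ a) = cong₂ _∷_ (ℕ.+-identityʳ x) (⊕-𝟎ʳ a)

pm-double : ∀ (ρ : List (Vec ℕ n)) c → total c ≡ length ρ →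
  pm (double ρ) (c ⊕ c) ≤ 4 ^ length ρ * (pm ρ c * pm ρ c)
pm-double {n} ρ c e with Λ-≥ (total c) ρ c 𝟎 𝟎 refl
  (trans (cong (λ z → 2 * total c + (z + z)) (total-𝟎 {n})) (trans (ℕ.+-identityʳ _) (cong (2 *_) e)))
... | x , eq , Λ⁺≤x = begin
  pm (double ρ) (c ⊕ c)         ≡⟨ trans (sym (Λ⁺-double ρ (c ⊕ c))) (cong (λ z → Λ⁺ ρ z 𝟎) (sym (⊕-𝟎ʳ (c ⊕ c)))) ⟩
  Λ⁺ ρ ((c ⊕ c) ⊕ 𝟎) 𝟎           ≤⟨ Λ⁺≤x ⟩
  x                             ≡⟨ x≡ ⟩
  4 ^ length ρ * (pm ρ c * pm ρ c) ∎
  where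
  open ℕ.≤-Reasoning
  x≡ : x ≡ 4 ^ length ρ * (pm ρ c * pm ρ c)
  x≡ = ℤ.+-injective (trans (trans (sym (ℤ.*-identityˡ (⁺ x))) (cong (λ z → sg z ℤ.* ⁺ x) (sym (total-𝟎 {n}))))
    (trans (sym eq) (trans (Λ-yz ρ c c) (trans (cong (λ z → ⁺ (4 ^ length ρ) ℤ.* z) (sym (ℤ.pos-* (pm ρ c) (pm ρ c))))
      (sym (ℤ.pos-* (4 ^ length ρ) (pm ρ c * pm ρ c)))))))

blow : ∀ {A : Set} → ℕ → List A → List A
blow N []      = []
blow N (w ∷ ρ) = List.replicate N w ++ blow N ρ

double-blow : ∀ {A : Set} N (ρ : List A) → double (blow N ρ) ≡ blow (N + N) ρ
double-blow N []      = refl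
double-blow {A} N (w ∷ ρ) = trans (rep N (blow N ρ)) (cong (List.replicate (N + N) w ++_) (double-blow N ρ))
  where
  rep : ∀ N (xs : List A) → double (List.replicate N w ++ xs) ≡ List.replicate (N + N) w ++ double xs
  rep zero    xs = refl
  rep (suc N) xs rewrite ℕ.+-suc N N = cong (λ z → w ∷ w ∷ z) (rep N xs)

length-blow : ∀ {A : Set} N (ρ : List A) → length (blow N ρ) ≡ length ρ * N
length-blow N []      = refl
length-blow N (w ∷ ρ) = trans (List.length-++ (List.replicate N w)) (cong₂ _+_ (List.length-replicate N) (length-blow N ρ))

total-replicate : ∀ n N → total (replicate n N) ≡ n * N
total-replicate zero    N = refl
total-replicate (suc n) N = cong (N +_) (total-replicate n N)

⊕-replicate : ∀ n a b → replicate n a ⊕ replicate n b ≡ replicate n (a + b)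
⊕-replicate zero    a b = refl
⊕-replicate (suc n) a b = cong (a + b ∷_) (⊕-replicate n a b)

-- Iterating pm-double keeps the powers 2 ^ k only; the limit over such multiples suffices.
pm-blow : ∀ k (ρ : List (Vec ℕ n)) → length ρ ≡ n → let N = 2 ^ k in
  pm (blow N ρ) (replicate n N) ≤ (N ^ N) ^ n * pm ρ (replicate n 1) ^ N
pm-blow {n} zero ρ e = ℕ.≤-reflexive (trans (cong (λ z → pm z (replicate n 1)) (blow-1 ρ)) (sym (trans (cong₂ _*_ (ℕ.^-zeroˡ n) (ℕ.*-identityʳ (pm ρ (replicate n 1)))) (ℕ.*-identityˡ _))))
  where
  blow-1 : ∀ {A : Set} (ρ : List A) → blow 1 ρ ≡ ρ
  blow-1 []      = refl
  blow-1 (w ∷ ρ) = cong (w ∷_) (blow-1 ρ)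
pm-blow {n} (suc k) ρ e rewrite ℕ.+-identityʳ (2 ^ k) = begin
  pm (blow (N + N) ρ) (replicate n (N + N))
    ≡⟨ cong₂ pm (sym (double-blow N ρ)) (sym (⊕-replicate n N N)) ⟩
  pm (double (blow N ρ)) (replicate n N ⊕ replicate n N)
    ≤⟨ pm-double (blow N ρ) (replicate n N) (trans (total-replicate n N) (sym len)) ⟩
  4 ^ length (blow N ρ) * (X * X)
    ≤⟨ ℕ.*-monoʳ-≤ (4 ^ length (blow N ρ)) (ℕ.*-mono-≤ ih ih) ⟩
  4 ^ length (blow N ρ) * (((N ^ N) ^ n * P ^ N) * ((N ^ N) ^ n * P ^ N))
    ≡⟨ cong (λ z → z * (((N ^ N) ^ n * P ^ N) * ((N ^ N) ^ n * P ^ N))) (trans (cong (4 ^_) (trans len (ℕ.*-comm n N))) (sym (ℕ.^-*-assoc 4 N n))) ⟩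
  (4 ^ N) ^ n * (((N ^ N) ^ n * P ^ N) * ((N ^ N) ^ n * P ^ N))
    ≡⟨ r₁ ((4 ^ N) ^ n) ((N ^ N) ^ n) (P ^ N) ⟩
  ((4 ^ N) ^ n * ((N ^ N) ^ n * (N ^ N) ^ n)) * (P ^ N * P ^ N)
    ≡⟨ cong₂ _*_ (trans (cong ((4 ^ N) ^ n *_) (sym (^-distrib-* (N ^ N) (N ^ N) n))) (trans (sym (^-distrib-* (4 ^ N) (N ^ N * N ^ N) n)) (cong (_^ n) NN))) (sym (ℕ.^-distribˡ-+-* P N N)) ⟩
  ((N + N) ^ (N + N)) ^ n * P ^ (N + N) ∎
  where
  open ℕ.≤-Reasoning
  N = 2 ^ k
  P = pm ρ (replicate n 1)
  X = pm (blow N ρ) (replicate n N)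
  ih = pm-blow k ρ e
  len : length (blow N ρ) ≡ n * N
  len = trans (length-blow N ρ) (cong (_* N) e)
  r₁ : ∀ a b c → a * ((b * c) * (b * c)) ≡ (a * (b * b)) * (c * c)
  r₁ = ℕ-Solver.solve-∀
  r₂ : ∀ a b → (a * a) * (b * b) ≡ (a * b) * (a * b)
  r₂ = ℕ-Solver.solve-∀
  NN : 4 ^ N * (N ^ N * N ^ N) ≡ (N + N) ^ (N + N)
  NN = trans (cong (_* (N ^ N * N ^ N)) (^-distrib-* 2 2 N))
    (trans (r₂ (2 ^ N) (N ^ N))
    (trans (cong₂ _*_ (sym (^-distrib-* 2 N N)) (sym (^-distrib-* 2 N N)))
    (trans (sym (ℕ.^-distribˡ-+-* (2 * N) N N)) (cong (λ z → (N + z) ^ (N + N)) (ℕ.+-identityʳ N)))))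

-- Lower bound for regular matrices

fct : Vec ℕ n → ℕ
fct []      = 1
fct (x ∷ M) = x ! * fct M

mono : Vec ℕ n → Vec ℕ n → ℕ
mono []      []      = 1
mono (x ∷ w) (y ∷ M) = x ^ y * mono w M

fct-inc : (M : Vec ℕ n) (j : Fin n) → fct (inc M j) ≡ suc (M [ j ]) * fct M
fct-inc (x ∷ M) zero    = ℕ.*-assoc (suc x) (x !) (fct M)
fct-inc (x ∷ M) (suc j) = trans (cong (x ! *_) (fct-inc M j)) (r (x !) (suc (M [ j ])) (fct M))
  where
  r : ∀ a b c → a * (b * c) ≡ b * (a * c)
  r = ℕ-Solver.solve-∀

mono-inc : (w M : Vec ℕ n) (j : Fin n) → mono w (inc M j) ≡ w [ j ] * mono w M
mono-inc (x ∷ w) (y ∷ M) zero    = ℕ.*-assoc x (x ^ y) (mono w M)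
mono-inc (x ∷ w) (y ∷ M) (suc j) = trans (cong (x ^ y *_) (mono-inc w M j)) (r (x ^ y) (w [ j ]) (mono w M))
  where
  r : ∀ a b c → a * (b * c) ≡ b * (a * c)
  r = ℕ-Solver.solve-∀

fct-𝟎 : ∀ n → fct (𝟎 {n}) ≡ 1
fct-𝟎 zero    = refl
fct-𝟎 (suc n) = trans (ℕ.+-identityʳ _) (fct-𝟎 n)

fct-pos : (M : Vec ℕ n) → 0 < fct M
fct-pos []      = s≤s z≤n
fct-pos (x ∷ M) = *-pos (ℕ.1≤n! x) (fct-pos M)

∑-mono : ∀ {f g : Fin n → ℕ} → (∀ i → f i ≤ g i) → ∑ f ≤ ∑ g
∑-mono {zero}  h = z≤n
∑-mono {suc n} h = ℕ.+-mono-≤ (h zero) (∑-mono (h ∘ suc))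

lookup-inc : (C : Vec ℕ n) (j : Fin n) → inc C j [ j ] ≡ suc (C [ j ])
lookup-inc C j = Vec.lookup∘updateAt j C

-- Only the terms in which exactly M [ s ] of the N copies of row w use column s are kept.
pm-replicate : ∀ N w rest (M C : Vec ℕ n) → total M ≡ N →
  N ! * mono w M * fct (M ⊕ C) * pm rest C ≤ pm (List.replicate N w ++ rest) (M ⊕ C) * (fct M * fct C)
pm-replicate {n} zero w rest M C e rewrite total≡0⇒𝟎 M e = ℕ.≤-reflexive
  (trans (cong₂ (λ a b → 1 * a * fct b * pm rest C) (mono-𝟎 w) (⊕-𝟎ˡ C))
  (trans (r (fct C) (pm rest C)) (cong₂ (λ b a → pm rest b * (a * fct C)) (sym (⊕-𝟎ˡ C)) (sym (fct-𝟎 n)))))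
  where
  mono-𝟎 : ∀ {n} (w : Vec ℕ n) → mono w 𝟎 ≡ 1
  mono-𝟎 []      = refl
  mono-𝟎 (x ∷ w) = trans (ℕ.+-identityʳ _) (mono-𝟎 w)
  r : ∀ a b → 1 * 1 * a * b ≡ b * (1 * a)
  r = ℕ-Solver.solve-∀
pm-replicate {n} (suc N) w rest M C e = begin
  suc N ! * mono w M * fct (M ⊕ C) * pm rest C
    ≡⟨ r₁ (suc N) (N !) (mono w M) (fct (M ⊕ C)) (pm rest C) ⟩
  suc N * T
    ≡⟨ cong (_* T) (sym e) ⟩
  total M * T
    -- The factor N + 1 is distributed over the columns: the share `M [ s ] * T` is charged to the
    -- term in which the first copy of w uses column s.
    ≡⟨ *-distribʳ-sum T (lookup M) ⟩
  ∑ (λ s → M [ s ] * T)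
    ≤⟨ ∑-mono term ⟩
  ∑ (λ s → (M ⊕ C) [ s ] * w [ s ] * F (dec (M ⊕ C) s) * (fct M * fct C))
    ≡⟨ sym (*-distribʳ-sum (fct M * fct C) (λ s → (M ⊕ C) [ s ] * w [ s ] * F (dec (M ⊕ C) s))) ⟩
  ∂ w F (M ⊕ C) * (fct M * fct C) ∎
  where
  open ℕ.≤-Reasoning
  T = N ! * mono w M * fct (M ⊕ C) * pm rest C
  F = pm (List.replicate N w ++ rest)
  r₁ : ∀ a b c d e → a * b * c * d * e ≡ a * (b * c * d * e)
  r₁ = ℕ-Solver.solve-∀
  term : ∀ s → M [ s ] * T ≤ (M ⊕ C) [ s ] * w [ s ] * F (dec (M ⊕ C) s) * (fct M * fct C)
  term s with M [ s ] ℕ.≟ 0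
  ... | yes z rewrite z = z≤n
  ... | no nz = go (dec M s) (inc-dec M s nz)
    where
    go : ∀ M₀ → inc M₀ s ≡ M → M [ s ] * T ≤ (M ⊕ C) [ s ] * w [ s ] * F (dec (M ⊕ C) s) * (fct M * fct C)
    go M₀ refl = begin
      m * (N ! * mono w M * fct (M ⊕ C) * pm rest C)
        ≡⟨ cong₂ (λ a b → m * (N ! * a * b * pm rest C)) (mono-inc w M₀ s)
             (trans (cong fct (inc-⊕ˡ M₀ C s)) (fct-inc (M₀ ⊕ C) s)) ⟩
      m * (N ! * (w [ s ] * mono w M₀) * (suc ((M₀ ⊕ C) [ s ]) * fct (M₀ ⊕ C)) * pm rest C)
        ≡⟨ r₂ m (N !) (w [ s ]) (mono w M₀) (suc ((M₀ ⊕ C) [ s ])) (fct (M₀ ⊕ C)) (pm rest C) ⟩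
      suc ((M₀ ⊕ C) [ s ]) * w [ s ] * m * (N ! * mono w M₀ * fct (M₀ ⊕ C) * pm rest C)
        ≤⟨ ℕ.*-monoʳ-≤ (suc ((M₀ ⊕ C) [ s ]) * w [ s ] * m)
             (pm-replicate N w rest M₀ C (ℕ.suc-injective (trans (sym (total-inc M₀ s)) e))) ⟩
      suc ((M₀ ⊕ C) [ s ]) * w [ s ] * m * (F (M₀ ⊕ C) * (fct M₀ * fct C))
        ≡⟨ r₃ (suc ((M₀ ⊕ C) [ s ])) (w [ s ]) m (F (M₀ ⊕ C)) (fct M₀) (fct C) ⟩
      suc ((M₀ ⊕ C) [ s ]) * w [ s ] * F (M₀ ⊕ C) * (m * fct M₀ * fct C)
        ≡⟨ cong₂ (λ a b → suc ((M₀ ⊕ C) [ s ]) * w [ s ] * a * (b * fct C))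
             (cong F (sym (trans (cong (λ z → dec z s) (inc-⊕ˡ M₀ C s)) (dec-inc (M₀ ⊕ C) s))))
             (trans (cong (_* fct M₀) (lookup-inc M₀ s)) (sym (fct-inc M₀ s))) ⟩
      suc ((M₀ ⊕ C) [ s ]) * w [ s ] * F (dec (M ⊕ C) s) * (fct M * fct C)
        ≡⟨ cong (λ a → a * w [ s ] * F (dec (M ⊕ C) s) * (fct M * fct C))
             (trans (sym (lookup-inc (M₀ ⊕ C) s)) (cong (_[ s ]) (sym (inc-⊕ˡ M₀ C s)))) ⟩
      (M ⊕ C) [ s ] * w [ s ] * F (dec (M ⊕ C) s) * (fct M * fct C) ∎
      where
      m = M [ s ]
      r₂ : ∀ m a b c d e f → m * (a * (b * c) * (d * e) * f) ≡ d * b * m * (a * c * e * f)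
      r₂ = ℕ-Solver.solve-∀
      r₃ : ∀ a b m d e f → a * b * m * (d * (e * f)) ≡ a * b * d * (m * e * f)
      r₃ = ℕ-Solver.solve-∀

sumV : List (Vec ℕ n) → Vec ℕ n
sumV = foldr _⊕_ 𝟎

∏L : {A : Set} → (A → ℕ) → List A → ℕ
∏L f []       = 1
∏L f (x ∷ xs) = f x * ∏L f xs

module _ {A : Set} (w M : A → Vec ℕ n) where

  -- Each distinct row x is given its own type M x. The factorials of the remaining column
  -- multiplicities telescope: `fct S` cancels at every step and only the factorial of the full sum
  -- survives.
  pm-types : ∀ N (L : List A) → All (λ x → total (M x) ≡ N) L →
    (N !) ^ length L * ∏L (λ x → mono (w x) (M x)) L * fct (sumV (map M L))
      ≤ pm (blow N (map w L)) (sumV (map M L)) * ∏L (λ x → fct (M x)) L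
  pm-types N []      []       = ℕ.≤-reflexive (trans (ℕ.*-identityˡ (fct (𝟎 {n}))) (fct-𝟎 n))
  pm-types N (x ∷ L) (e ∷ es) = *-cancel-pos {fct S} _ _ (fct-pos S) (begin
    fct S * ((N ! * N! ) * (μ * μs) * f)
      ≡⟨ r₁ (fct S) (N !) N! μ μs f ⟩
    (N ! * μ * f) * (N! * μs * fct S)
      ≤⟨ ℕ.*-monoʳ-≤ (N ! * μ * f) (pm-types N L es) ⟩
    (N ! * μ * f) * (p * φs)
      ≡⟨ sym (ℕ.*-assoc (N ! * μ * f) p φs) ⟩
    N ! * μ * f * p * φs
      ≤⟨ ℕ.*-monoˡ-≤ φs (pm-replicate N (w x) (blow N (map w L)) (M x) S e) ⟩
    q * (fct (M x) * fct S) * φs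
      ≡⟨ r₂ q (fct (M x)) (fct S) φs ⟩
    fct S * (q * (fct (M x) * φs)) ∎)
    where
    open ℕ.≤-Reasoning
    S = sumV (map M L)
    N! = (N !) ^ length L
    μ = mono (w x) (M x)
    μs = ∏L (λ x → mono (w x) (M x)) L
    f = fct (M x ⊕ S)
    p = pm (blow N (map w L)) S
    φs = ∏L (λ x → fct (M x)) L
    q = pm (blow N (map w (x ∷ L))) (M x ⊕ S)
    r₁ : ∀ a b c d e f → a * ((b * c) * (d * e) * f) ≡ (b * d * f) * (c * e * a)
    r₁ = ℕ-Solver.solve-∀
    r₂ : ∀ a b c d → a * (b * c) * d ≡ c * (a * (b * d))
    r₂ = ℕ-Solver.solve-∀

-- Matchings of a prescribed type in a perturbed matrix

lin : ℕ → ℕ → Vec ℕ n → Vec ℕ n → Vec ℕ n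
lin x y = zipWith (λ a e → x * a + y * e)

total-lin : ∀ x y (a e : Vec ℕ n) → total (lin x y a e) ≡ x * total a + y * total e
total-lin x y []      []      = sym (cong₂ _+_ (ℕ.*-zeroʳ x) (ℕ.*-zeroʳ y))
total-lin x y (a ∷ v) (e ∷ u) = trans (cong (λ z → x * a + y * e + z) (total-lin x y v u)) (r x y a e (total v) (total u))
  where
  r : ∀ x y a e b f → x * a + y * e + (x * b + y * f) ≡ x * (a + b) + y * (e + f)
  r = ℕ-Solver.solve-∀

lin-⊕ : ∀ x y (a e a′ e′ : Vec ℕ n) → lin x y a e ⊕ lin x y a′ e′ ≡ lin x y (a ⊕ a′) (e ⊕ e′)
lin-⊕ x y []      []      []        []        = refl
lin-⊕ x y (a ∷ v) (e ∷ u) (a′ ∷ v′) (e′ ∷ u′) = cong₂ _∷_ (r x y a e a′ e′) (lin-⊕ x y v u v′ u′)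
  where
  r : ∀ x y a e b f → x * a + y * e + (x * b + y * f) ≡ x * (a + b) + y * (e + f)
  r = ℕ-Solver.solve-∀

lin-replicate : ∀ n x y a e → lin x y (replicate n a) (replicate n e) ≡ replicate n (x * a + y * e)
lin-replicate zero    x y a e = refl
lin-replicate (suc n) x y a e = cong (_ ∷_) (lin-replicate n x y a e)

Bits : Vec ℕ n → Set
Bits = AllV (_≤ 1)

-- A cell with a = 1 has weight at least t and multiplicity at least q. A cell with e = 1 alone has
-- weight 1, and an empty cell contributes 0^0 = 1.
mono-lin : ∀ t q r {a e : Vec ℕ n} → 0 < t → Bits a → Bits e → (t ^ q) ^ total a ≤ mono (lin t 1 a e) (lin q r a e)
mono-lin t q r t>0 [] [] = s≤s z≤n
mono-lin t q r {a ∷ v} {e ∷ u} t>0 (pa ∷ pv) (pe ∷ pu) = begin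
  (t ^ q) ^ (a + total v)            ≡⟨ ℕ.^-distribˡ-+-* (t ^ q) a (total v) ⟩
  (t ^ q) ^ a * (t ^ q) ^ total v    ≤⟨ ℕ.*-mono-≤ (cell pa pe) (mono-lin t q r t>0 pv pu) ⟩
  (t * a + 1 * e) ^ (q * a + r * e) * mono (lin t 1 v u) (lin q r v u) ∎
  where
  open ℕ.≤-Reasoning
  cell : ∀ {a e} → a ≤ 1 → e ≤ 1 → (t ^ q) ^ a ≤ (t * a + 1 * e) ^ (q * a + r * e)
  cell z≤n z≤n rewrite ℕ.*-zeroʳ t | ℕ.*-zeroʳ q | ℕ.*-zeroʳ r = s≤s z≤n
  cell z≤n (s≤s z≤n) rewrite ℕ.*-zeroʳ t | ℕ.*-zeroʳ q | ℕ.^-zeroˡ (r * 1) = s≤s z≤n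
  cell {_} {e} (s≤s z≤n) _ rewrite ℕ.*-identityʳ t | ℕ.*-identityʳ q | ℕ.*-identityʳ (t ^ q) = begin
    t ^ q                    ≤⟨ ℕ.^-monoˡ-≤ q (ℕ.m≤m+n t (1 * e)) ⟩
    (t + 1 * e) ^ q          ≤⟨ ℕ.^-monoʳ-≤ (t + 1 * e) {{>-nonZero (ℕ.≤-trans t>0 (ℕ.m≤m+n t (1 * e)))}} (ℕ.m≤m+n q (r * e)) ⟩
    (t + 1 * e) ^ (q + r * e) ∎

!-+ : ∀ q r s → q + r ≤ s → (q + r) ! ≤ q ! * s ^ r
!-+ q zero    s h rewrite ℕ.+-identityʳ q | ℕ.*-identityʳ (q !) = ℕ.≤-refl
!-+ q (suc r) s h rewrite ℕ.+-suc q r = begin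
  suc (q + r) * (q + r) !   ≤⟨ ℕ.*-mono-≤ h (!-+ q r s (ℕ.<⇒≤ h)) ⟩
  s * (q ! * s ^ r)         ≡⟨ c s (q !) (s ^ r) ⟩
  q ! * (s * s ^ r) ∎
  where
  open ℕ.≤-Reasoning
  c : ∀ a b c → a * (b * c) ≡ b * (a * c)
  c = ℕ-Solver.solve-∀

fct-lin : ∀ q r s {a e : Vec ℕ n} → q + r ≤ s → Bits a → Bits e → fct (lin q r a e) ≤ (q !) ^ total a * (s ^ r) ^ total e
fct-lin q r s h [] [] = s≤s z≤n
fct-lin q r s {a ∷ v} {e ∷ u} h (pa ∷ pv) (pe ∷ pu) = begin
  (q * a + r * e) ! * fct (lin q r v u)
    ≤⟨ ℕ.*-mono-≤ (cell pa pe) (fct-lin q r s h pv pu) ⟩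
  (q !) ^ a * (s ^ r) ^ e * ((q !) ^ total v * (s ^ r) ^ total u)
    ≡⟨ c ((q !) ^ a) ((s ^ r) ^ e) ((q !) ^ total v) ((s ^ r) ^ total u) ⟩
  ((q !) ^ a * (q !) ^ total v) * ((s ^ r) ^ e * (s ^ r) ^ total u)
    ≡⟨ cong₂ _*_ (sym (ℕ.^-distribˡ-+-* (q !) a (total v))) (sym (ℕ.^-distribˡ-+-* (s ^ r) e (total u))) ⟩
  (q !) ^ (a + total v) * (s ^ r) ^ (e + total u) ∎
  where
  open ℕ.≤-Reasoning
  c : ∀ a b c d → a * b * (c * d) ≡ a * c * (b * d)
  c = ℕ-Solver.solve-∀
  cell : ∀ {a e} → a ≤ 1 → e ≤ 1 → (q * a + r * e) ! ≤ (q !) ^ a * (s ^ r) ^ e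
  cell z≤n z≤n rewrite ℕ.*-zeroʳ q | ℕ.*-zeroʳ r = s≤s z≤n
  cell z≤n (s≤s z≤n) rewrite ℕ.*-zeroʳ q | ℕ.*-identityʳ r | ℕ.*-identityʳ (s ^ r) =
    !-+ 0 r s (ℕ.≤-trans (ℕ.m≤n+m r q) h)
  cell (s≤s z≤n) z≤n rewrite ℕ.*-zeroʳ r | ℕ.*-identityʳ q | ℕ.*-identityʳ (q !) | ℕ.+-identityʳ q =
    ℕ.≤-reflexive (sym (ℕ.*-identityʳ (q !)))
  cell (s≤s z≤n) (s≤s z≤n) rewrite ℕ.*-identityʳ q | ℕ.*-identityʳ r | ℕ.*-identityʳ (q !) | ℕ.*-identityʳ (s ^ r) = !-+ q r s h

Pair : ℕ → Set
Pair n = Vec ℕ n × Vec ℕ n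

-- A 0/1 matrix with line sums d, paired row by row with a permutation matrix: adding multiples of the
-- latter turns line sums q d into a power of 2 without assuming that the former has a perfect matching.
record Regular (d : ℕ) (L : List (Pair n)) : Set where
  field
    size    : length L ≡ n
    bits    : All (λ p → Bits (proj₁ p) × Bits (proj₂ p)) L
    rowsˡ   : All (λ p → total (proj₁ p) ≡ d) L
    rowsʳ   : All (λ p → total (proj₂ p) ≡ 1) L
    columnsˡ : sumV (map proj₁ L) ≡ replicate n d
    columnsʳ : sumV (map proj₂ L) ≡ replicate n 1

mix : ℕ → ℕ → Pair n → Vec ℕ n
mix x y (a , e) = lin x y a e

sumV-mix : ∀ x y (L : List (Pair n)) → sumV (map (mix x y) L) ≡ lin x y (sumV (map proj₁ L)) (sumV (map proj₂ L))
sumV-mix {n} x y [] = sym (trans (lin-replicate n x y 0 0) (cong (replicate n) (cong₂ _+_ (ℕ.*-zeroʳ x) (ℕ.*-zeroʳ y))))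
sumV-mix x y ((a , e) ∷ L) = trans (cong (lin x y a e ⊕_) (sumV-mix x y L)) (lin-⊕ x y a e _ _)

fct-replicate : ∀ n s → fct (replicate n s) ≡ (s !) ^ n
fct-replicate zero    s = refl
fct-replicate (suc n) s = cong (s ! *_) (fct-replicate n s)

∏L-≤ : ∀ {A : Set} {f : A → ℕ} {k} {L : List A} → All (λ x → f x ≤ k) L → ∏L f L ≤ k ^ length L
∏L-≤ []       = s≤s z≤n
∏L-≤ (p ∷ ps) = ℕ.*-mono-≤ p (∏L-≤ ps)

∏L-≥ : ∀ {A : Set} {f : A → ℕ} {k} {L : List A} → All (λ x → k ≤ f x) L → k ^ length L ≤ ∏L f L
∏L-≥ []       = s≤s z≤n
∏L-≥ (p ∷ ps) = ℕ.*-mono-≤ p (∏L-≥ ps)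

module _ {d : ℕ} {L : List (Pair n)} (R : Regular d L) where
  open Regular R

  -- The type with q copies of A and r copies of the permutation matrix has line sums q d + r = s,
  -- and all of its cells have positive weight. `pm-types` bounds the repeated permanent from below
  -- and `pm-blow` from above.
  blow-bound : ∀ t k q r → 0 < t → let s = 2 ^ k in s ≡ q * d + r → q + r ≤ s →
    (s !) ^ n * ((t ^ q) ^ d) ^ n * (s !) ^ n ≤
    (s ^ s) ^ n * pm (map (mix t 1) L) (replicate n 1) ^ s * ((q !) ^ d * s ^ r) ^ n
  blow-bound t k q r t>0 s≡ q+r≤s = begin
    (s !) ^ n * ((t ^ q) ^ d) ^ n * (s !) ^ n
      ≡⟨ cong₂ (λ a b → (s !) ^ a * ((t ^ q) ^ d) ^ a * b) (sym size) (sym (trans (cong fct S≡) (fct-replicate n s))) ⟩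
    (s !) ^ length L * ((t ^ q) ^ d) ^ length L * fct S
      ≤⟨ ℕ.*-monoˡ-≤ (fct S) (ℕ.*-monoʳ-≤ ((s !) ^ length L) (∏L-≥ (All.zipWith monos (bits , rowsˡ)))) ⟩
    (s !) ^ length L * ∏L (λ x → mono (w x) (M x)) L * fct S
      ≤⟨ pm-types w M s L (All.zipWith (λ {x} → tot {x}) (rowsˡ , rowsʳ)) ⟩
    pm (blow s (map w L)) S * ∏L (λ x → fct (M x)) L
      ≤⟨ ℕ.*-mono-≤ (ℕ.≤-trans (ℕ.≤-reflexive (cong (pm (blow s (map w L))) S≡)) (pm-blow k (map w L) (trans (List.length-map w L) size)))
                    (∏L-≤ (All.zipWith fcts (bits , All.zip (rowsˡ , rowsʳ)))) ⟩
    (s ^ s) ^ n * pm (map w L) (replicate n 1) ^ s * ((q !) ^ d * s ^ r) ^ length L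
      ≡⟨ cong (λ z → (s ^ s) ^ n * pm (map w L) (replicate n 1) ^ s * ((q !) ^ d * s ^ r) ^ z) size ⟩
    (s ^ s) ^ n * pm (map w L) (replicate n 1) ^ s * ((q !) ^ d * s ^ r) ^ n ∎
    where
    open ℕ.≤-Reasoning
    s = 2 ^ k
    w M : Pair n → Vec ℕ n
    w = mix t 1
    M = mix q r
    S = sumV (map M L)
    S≡ : S ≡ replicate n s
    S≡ = trans (sumV-mix q r L) (trans (cong₂ (lin q r) columnsˡ columnsʳ) (trans (lin-replicate n q r d 1)
      (cong (replicate n) (trans (cong (λ z → q * d + z) (ℕ.*-identityʳ r)) (sym s≡)))))
    tot : ∀ {x} → total (proj₁ x) ≡ d × total (proj₂ x) ≡ 1 → total (M x) ≡ s
    tot {a , e} (p , q′) = trans (total-lin q r a e) (trans (cong₂ (λ x y → q * x + r * y) p q′)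
      (trans (cong (λ z → q * d + z) (ℕ.*-identityʳ r)) (sym s≡)))
    monos : ∀ {x} → (Bits (proj₁ x) × Bits (proj₂ x)) × total (proj₁ x) ≡ d → (t ^ q) ^ d ≤ mono (w x) (M x)
    monos {a , e} ((pa , pe) , refl) = mono-lin t q r t>0 pa pe
    fcts : ∀ {x} → (Bits (proj₁ x) × Bits (proj₂ x)) × (total (proj₁ x) ≡ d × total (proj₂ x) ≡ 1) → fct (M x) ≤ (q !) ^ d * s ^ r
    fcts {a , e} ((pa , pe) , (refl , q′)) = ℕ.≤-trans (fct-lin q r s q+r≤s pa pe)
      (ℕ.≤-reflexive (cong ((q !) ^ total a *_) (trans (cong ((s ^ r) ^_) q′) (ℕ.*-identityʳ (s ^ r)))))

  -- This is the q-th root of `blow-bound` for a large power of two s. What is left over is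
  -- polynomial in s, hence at most 2^q, and the root of that is the factor 2.
  perturbed : ∀ t → 0 < t → 0 < d →
    (d !) ^ n * (t ^ d) ^ n ≤ 2 * ((4 * d) ^ n * pm (map (mix t 1) L) (replicate n 1) ^ d)
  perturbed t t>0 d>0 = ^-root q q>0 (begin
    ((d !) ^ n * (t ^ d) ^ n) ^ q
      ≡⟨ trans (^-distrib-* ((d !) ^ n) ((t ^ d) ^ n) q) (cong₂ _*_ (^-swap (d !) n q) (trans (^-swap (t ^ d) n q) (cong (_^ n) (^-swap t d q)))) ⟩
    ((d !) ^ q) ^ n * ((t ^ q) ^ d) ^ n
      ≤⟨ main ⟩
    (((4 * d) ^ q * (4 * q) ^ d) ^ n * ((4 * s) ^ r) ^ n * (s ^ r) ^ n) * Q ^ s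
      ≡⟨ regroup ⟩
    ((4 * d) ^ n * Q ^ d) ^ q * ((((4 * q) ^ d) ^ n * ((4 * s) ^ r) ^ n * (s ^ r) ^ n) * Q ^ r)
      ≤⟨ ℕ.*-monoʳ-≤ (((4 * d) ^ n * Q ^ d) ^ q) bracket ⟩
    ((4 * d) ^ n * Q ^ d) ^ q * 2 ^ q
      ≡⟨ trans (ℕ.*-comm _ (2 ^ q)) (sym (^-distrib-* 2 _ q)) ⟩
    (2 * ((4 * d) ^ n * Q ^ d)) ^ q ∎)
    where
    open ℕ.≤-Reasoning
    instance _ = >-nonZero d>0
    Q = pm (map (mix t 1) L) (replicate n 1)
    -- The left-over factors will be at most 2^E: three of them are bounded by (4 s)^(d n) = 2^((2 +
    -- k) d n), and Q^r by 2^((Q + 1) d). As c₁ k + c₀ = d (1 + E), the choice of k gives E < q.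
    c₁ = d * (3 * (d * n))
    c₀ = d * (1 + (3 * (2 * (d * n)) + suc Q * d))
    k = proj₁ (linear≤2^ c₁ c₀)
    E = 3 * ((2 + k) * (d * n)) + suc Q * d
    s = 2 ^ k
    q = s / d
    r = s % d
    r<d : r < d
    r<d = ℕ.m%n<n s d
    s≡ : s ≡ q * d + r
    s≡ = trans (ℕ.m≡m%n+[m/n]*n s d) (ℕ.+-comm r (q * d))
    E<q : E < q
    E<q = s<s⁻¹ (ℕ.*-cancelˡ-< d _ _ (begin-strict
      d * (1 + E)         ≡⟨ e d n k Q ⟩
      c₁ * k + c₀         ≤⟨ proj₂ (linear≤2^ c₁ c₀) ⟩
      s                   ≡⟨ s≡ ⟩
      q * d + r           <⟨ ℕ.+-monoʳ-< (q * d) r<d ⟩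
      q * d + d           ≡⟨ trans (ℕ.+-comm (q * d) d) (trans (cong (λ z → d + z) (ℕ.*-comm q d)) (sym (ℕ.*-suc d q))) ⟩
      d * suc q ∎))
      where
      e : ∀ d n k Q → d * (1 + (3 * ((2 + k) * (d * n)) + suc Q * d)) ≡ d * (3 * (d * n)) * k + d * (1 + (3 * (2 * (d * n)) + suc Q * d))
      e = ℕ-Solver.solve-∀
    q>0 : 0 < q
    q>0 = ℕ.≤-<-trans z≤n E<q
    x = q * d
    q≤x : q ≤ x
    q≤x = ℕ.m≤m*n q d
    q+r≤s : q + r ≤ s
    q+r≤s = ℕ.≤-trans (ℕ.+-monoˡ-≤ r q≤x) (ℕ.≤-reflexive (sym s≡))
    q≤s = ℕ.≤-trans (ℕ.m≤m+n q r) q+r≤s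
    x≤s : x ≤ s
    x≤s = ℕ.≤-trans (ℕ.m≤m+n x r) (ℕ.≤-reflexive (sym s≡))
    s>0 : 0 < s
    s>0 = ℕ.≤-trans q>0 q≤s
    !-mono : ∀ {a b} → a ≤ b → a ! ≤ b !
    !-mono {a} {b} a≤b with ℕ.m≤n⇒∃[o]m+o≡n a≤b
    ... | o , refl = go o
      where
      go : ∀ o → a ! ≤ (a + o) !
      go zero    = ℕ.≤-reflexive (cong _! (sym (ℕ.+-identityʳ a)))
      go (suc o) = ℕ.≤-trans (go o) (ℕ.≤-trans (ℕ.m≤n*m ((a + o) !) (suc (a + o))) (ℕ.≤-reflexive (cong _! (sym (ℕ.+-suc a o)))))
    main : ((d !) ^ q) ^ n * ((t ^ q) ^ d) ^ n ≤ (((4 * d) ^ q * (4 * q) ^ d) ^ n * ((4 * s) ^ r) ^ n * (s ^ r) ^ n) * Q ^ s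
    main = *-cancel-pos {(x ^ x) ^ n * ((q !) ^ d) ^ n} _ _ (*-pos (^-pos n (n^n>0 x)) (^-pos n (^-pos d (ℕ.1≤n! q)))) (begin
      ((x ^ x) ^ n * ((q !) ^ d) ^ n) * (((d !) ^ q) ^ n * T)
        ≡⟨ r₁ ((x ^ x) ^ n) (((q !) ^ d) ^ n) (((d !) ^ q) ^ n) T ⟩
      ((x ^ x) ^ n * (((d !) ^ q) ^ n * ((q !) ^ d) ^ n)) * T
        ≡⟨ cong (_* T) (trans (cong ((x ^ x) ^ n *_) (sym (^-distrib-* ((d !) ^ q) ((q !) ^ d) n))) (sym (^-distrib-* (x ^ x) _ n))) ⟩
      (x ^ x * ((d !) ^ q * (q !) ^ d)) ^ n * T
        ≤⟨ ℕ.*-monoˡ-≤ T (ℕ.^-monoˡ-≤ n (ℕ.≤-trans (exp-both q d q>0 d>0)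
             (ℕ.*-monoʳ-≤ ((4 * d) ^ q * (4 * q) ^ d) (ℕ.*-mono-≤ (!-mono x≤s) (!-mono x≤s))))) ⟩
      ((4 * d) ^ q * (4 * q) ^ d * (s ! * s !)) ^ n * T
        ≡⟨ cong (_* T) (trans (^-distrib-* ((4 * d) ^ q * (4 * q) ^ d) (s ! * s !) n) (cong (G *_) (^-distrib-* (s !) (s !) n))) ⟩
      G * ((s !) ^ n * (s !) ^ n) * T
        ≡⟨ r₂ G ((s !) ^ n) T ⟩
      G * ((s !) ^ n * T * (s !) ^ n)
        ≤⟨ ℕ.*-monoʳ-≤ G (blow-bound t k q r t>0 s≡ q+r≤s) ⟩
      G * ((s ^ s) ^ n * Q ^ s * ((q !) ^ d * s ^ r) ^ n)
        ≤⟨ ℕ.*-monoʳ-≤ G (ℕ.*-monoˡ-≤ (((q !) ^ d * s ^ r) ^ n) (ℕ.*-monoˡ-≤ (Q ^ s) (ℕ.^-monoˡ-≤ n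
             (subst (λ z → z ^ z ≤ (4 * z) ^ r * x ^ x) (sym s≡) (^-self-+ r x))))) ⟩
      G * (((4 * s) ^ r * x ^ x) ^ n * Q ^ s * ((q !) ^ d * s ^ r) ^ n)
        ≡⟨ cong₂ (λ a b → G * (a * Q ^ s * b)) (^-distrib-* ((4 * s) ^ r) (x ^ x) n) (^-distrib-* ((q !) ^ d) (s ^ r) n) ⟩
      G * (((4 * s) ^ r) ^ n * (x ^ x) ^ n * Q ^ s * (((q !) ^ d) ^ n * (s ^ r) ^ n))
        ≡⟨ r₃ G (((4 * s) ^ r) ^ n) ((x ^ x) ^ n) (Q ^ s) (((q !) ^ d) ^ n) ((s ^ r) ^ n) ⟩
      ((x ^ x) ^ n * ((q !) ^ d) ^ n) * ((G * ((4 * s) ^ r) ^ n * (s ^ r) ^ n) * Q ^ s) ∎)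
      where
      T = ((t ^ q) ^ d) ^ n
      G = ((4 * d) ^ q * (4 * q) ^ d) ^ n
      r₁ : ∀ a b c d → (a * b) * (c * d) ≡ (a * (c * b)) * d
      r₁ = ℕ-Solver.solve-∀
      r₂ : ∀ a b c → a * (b * b) * c ≡ a * (b * c * b)
      r₂ = ℕ-Solver.solve-∀
      r₃ : ∀ a b c d e f → a * (b * c * d * (e * f)) ≡ (c * e) * ((a * b * f) * d)
      r₃ = ℕ-Solver.solve-∀
    regroup : (((4 * d) ^ q * (4 * q) ^ d) ^ n * ((4 * s) ^ r) ^ n * (s ^ r) ^ n) * Q ^ s ≡
              ((4 * d) ^ n * Q ^ d) ^ q * ((((4 * q) ^ d) ^ n * ((4 * s) ^ r) ^ n * (s ^ r) ^ n) * Q ^ r)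
    regroup = trans (cong₂ (λ a b → (a * ((4 * s) ^ r) ^ n * (s ^ r) ^ n) * b)
        (trans (^-distrib-* ((4 * d) ^ q) ((4 * q) ^ d) n) (cong (_* ((4 * q) ^ d) ^ n) (^-swap (4 * d) q n)))
        (trans (cong (Q ^_) (trans s≡ (cong (_+ r) (ℕ.*-comm q d)))) (trans (ℕ.^-distribˡ-+-* Q (d * q) r) (cong (_* Q ^ r) (sym (ℕ.^-*-assoc Q d q))))))
      (trans (c (((4 * d) ^ n) ^ q) (((4 * q) ^ d) ^ n) (((4 * s) ^ r) ^ n) ((s ^ r) ^ n) ((Q ^ d) ^ q) (Q ^ r))
             (cong (_* ((((4 * q) ^ d) ^ n * ((4 * s) ^ r) ^ n * (s ^ r) ^ n) * Q ^ r)) (sym (^-distrib-* ((4 * d) ^ n) (Q ^ d) q))))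
      where
      c : ∀ a b c d e f → ((a * b) * c * d) * (e * f) ≡ (a * e) * ((b * c * d) * f)
      c = ℕ-Solver.solve-∀
    bracket : (((4 * q) ^ d) ^ n * ((4 * s) ^ r) ^ n * (s ^ r) ^ n) * Q ^ r ≤ 2 ^ q
    bracket = begin
      (((4 * q) ^ d) ^ n * ((4 * s) ^ r) ^ n * (s ^ r) ^ n) * Q ^ r
        ≤⟨ ℕ.*-mono-≤ (ℕ.*-mono-≤ (ℕ.*-mono-≤ (ℕ.^-monoˡ-≤ n (ℕ.^-monoˡ-≤ d (ℕ.*-monoʳ-≤ 4 q≤s)))
             (ℕ.^-monoˡ-≤ n (ℕ.^-monoʳ-≤ (4 * s) {{4s}} (ℕ.<⇒≤ r<d))))
             (ℕ.^-monoˡ-≤ n (ℕ.≤-trans (ℕ.^-monoˡ-≤ r (ℕ.m≤n*m s 4)) (ℕ.^-monoʳ-≤ (4 * s) {{4s}} (ℕ.<⇒≤ r<d)))))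
             (ℕ.≤-trans (ℕ.^-monoˡ-≤ r (ℕ.n≤1+n Q)) (ℕ.≤-trans (ℕ.^-monoʳ-≤ (suc Q) (ℕ.<⇒≤ r<d)) (ℕ.^-monoˡ-≤ d (ℕ.<⇒≤ (n≤2^n (suc Q)))))) ⟩
      (B * B * B) * (2 ^ suc Q) ^ d
        ≡⟨ cong₂ _*_ (trans (cong (λ z → z * z * z) B≡) (trans (cong (_* 2 ^ e) (sym (ℕ.^-distribˡ-+-* 2 e e))) (sym (ℕ.^-distribˡ-+-* 2 (e + e) e)))) (ℕ.^-*-assoc 2 (suc Q) d) ⟩
      2 ^ (e + e + e) * 2 ^ (suc Q * d)
        ≡⟨ trans (sym (ℕ.^-distribˡ-+-* 2 (e + e + e) (suc Q * d))) (cong (λ z → 2 ^ (z + suc Q * d)) (c e)) ⟩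
      2 ^ E
        ≤⟨ ℕ.^-monoʳ-≤ 2 (ℕ.<⇒≤ E<q) ⟩
      2 ^ q ∎
      where
      4s : NonZero (4 * s)
      4s = >-nonZero (*-pos {4} (s≤s z≤n) s>0)
      B = ((4 * s) ^ d) ^ n
      e = (2 + k) * (d * n)
      c : ∀ e → e + e + e ≡ 3 * e
      c = ℕ-Solver.solve-∀
      B≡ : B ≡ 2 ^ e
      B≡ = trans (ℕ.^-*-assoc (4 * s) d n) (trans (cong (_^ (d * n)) (sym (ℕ.^-distribˡ-+-* 2 2 k))) (ℕ.^-*-assoc 2 (2 + k) (d * n)))

-- Removing the perturbation

pm-mono : ∀ (w w′ : Pair n → Vec ℕ n) → (∀ p s → w p [ s ] ≤ w′ p [ s ]) → ∀ L C → pm (map w L) C ≤ pm (map w′ L) C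
pm-mono w w′ h []      C = ℕ.≤-refl
pm-mono w w′ h (p ∷ L) C = ∑-mono λ s → ℕ.*-mono-≤ (ℕ.*-monoʳ-≤ (C [ s ]) (h p s)) (pm-mono w w′ h L (dec C s))

-- The leading coefficient in t is the permanent of A, and all other terms lose a factor t. At a
-- cell of the permutation matrix the main term t g and the carried error K h are each at most t K
-- h; this doubles the error at every row and yields `2 ^ length L`.
pm-perturb : ∀ t → 0 < t → ∀ (L : List (Pair n)) C →
  pm (map (mix t 1) L) C * t ≤ t ^ length L * (t * pm (map proj₁ L) C + 2 ^ length L * pm (map (mix 1 1) L) C)
pm-perturb t t>0 [] C = ℕ.≤-trans (ℕ.m≤m+n (1 * t) 1) (ℕ.≤-reflexive (r t))
  where
  r : ∀ t → 1 * t + 1 ≡ 1 * (t * 1 + 1 * 1)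
  r = ℕ-Solver.solve-∀
pm-perturb {n} t t>0 (p@(a , e) ∷ L) C = begin
  ∂ (mix t 1 p) F C * t
    ≡⟨ *-distribʳ-sum t (λ s → C [ s ] * mix t 1 p [ s ] * F (dec C s)) ⟩
  ∑ (λ s → C [ s ] * mix t 1 p [ s ] * F (dec C s) * t)
    ≤⟨ ∑-mono term ⟩
  ∑ (λ s → T * (t * (C [ s ] * a [ s ] * G (dec C s))) + T * (2 * K * (C [ s ] * mix 1 1 p [ s ] * H (dec C s))))
    ≡⟨ ∑-distrib-+ (λ s → T * (t * (C [ s ] * a [ s ] * G (dec C s)))) _ ⟩
  ∑ (λ s → T * (t * (C [ s ] * a [ s ] * G (dec C s)))) + ∑ (λ s → T * (2 * K * (C [ s ] * mix 1 1 p [ s ] * H (dec C s))))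
    ≡⟨ cong₂ _+_ (pull T t (λ s → C [ s ] * a [ s ] * G (dec C s))) (pull T (2 * K) (λ s → C [ s ] * mix 1 1 p [ s ] * H (dec C s))) ⟩
  T * (t * ∂ a G C) + T * (2 * K * ∂ (mix 1 1 p) H C)
    ≡⟨ sym (ℕ.*-distribˡ-+ T (t * ∂ a G C) _) ⟩
  T * (t * ∂ a G C + 2 * K * ∂ (mix 1 1 p) H C) ∎
  where
  open ℕ.≤-Reasoning
  F = pm (map (mix t 1) L)
  G = pm (map proj₁ L)
  H = pm (map (mix 1 1) L)
  K = 2 ^ length L
  T = t ^ suc (length L)
  pull : ∀ x y (f : Fin n → ℕ) → ∑ (λ s → x * (y * f s)) ≡ x * (y * ∑ f)
  pull x y f = trans (sym (*-distribˡ-sum x (λ s → y * f s))) (cong (x *_) (sym (*-distribˡ-sum y f)))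
  lookup-mix : ∀ x y s → mix x y p [ s ] ≡ x * a [ s ] + y * e [ s ]
  lookup-mix x y s = Vec.lookup-zipWith _ s a e
  G≤H : ∀ C → G C ≤ H C
  G≤H = pm-mono proj₁ (mix 1 1) (λ { (a , e) s → ℕ.≤-trans (ℕ.m≤m+n (a [ s ]) (1 * e [ s ]))
    (ℕ.≤-reflexive (trans (cong (_+ 1 * e [ s ]) (sym (ℕ.*-identityˡ (a [ s ])))) (sym (Vec.lookup-zipWith _ s a e)))) }) L
  ineq : ∀ c a e T t g h K → 0 < t → 0 < K → g ≤ h →
    c * (t * a + 1 * e) * (T * (t * g + K * h)) ≤ t * T * (t * (c * a * g)) + t * T * (2 * K * (c * (1 * a + 1 * e) * h))
  ineq c a e T (suc t) g h (suc K) _ _ g≤h with ℕ.m≤n⇒∃[o]m+o≡n g≤h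
  ... | o , refl = ℕ.≤-trans (ℕ.m≤m+n _ _) (ℕ.≤-reflexive (r c a e T t g o K))
    where
    r : ∀ c a e T t g o K → let t′ = suc t; K′ = suc K; h = g + o in
      c * (t′ * a + 1 * e) * (T * (t′ * g + K′ * h)) + c * T * (t′ * a * K′ * h + t′ * e * (K * g + K′ * o) + t * e * K′ * h) ≡
      t′ * T * (t′ * (c * a * g)) + t′ * T * (2 * K′ * (c * (1 * a + 1 * e) * h))
    r = ℕ-Solver.solve-∀
  term : ∀ s → C [ s ] * mix t 1 p [ s ] * F (dec C s) * t ≤
    T * (t * (C [ s ] * a [ s ] * G (dec C s))) + T * (2 * K * (C [ s ] * mix 1 1 p [ s ] * H (dec C s)))
  term s = begin
    C [ s ] * mix t 1 p [ s ] * F (dec C s) * t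
      ≡⟨ trans (ℕ.*-assoc (C [ s ] * mix t 1 p [ s ]) _ t) (cong (λ z → C [ s ] * z * (F (dec C s) * t)) (lookup-mix t 1 s)) ⟩
    C [ s ] * (t * a [ s ] + 1 * e [ s ]) * (F (dec C s) * t)
      ≤⟨ ℕ.*-monoʳ-≤ (C [ s ] * (t * a [ s ] + 1 * e [ s ])) (pm-perturb t t>0 L (dec C s)) ⟩
    C [ s ] * (t * a [ s ] + 1 * e [ s ]) * (t ^ length L * (t * G (dec C s) + K * H (dec C s)))
      ≤⟨ ineq (C [ s ]) (a [ s ]) (e [ s ]) (t ^ length L) t (G (dec C s)) (H (dec C s)) K t>0 (ℕ.m^n>0 2 (length L)) (G≤H (dec C s)) ⟩
    T * (t * (C [ s ] * a [ s ] * G (dec C s))) + T * (2 * K * (C [ s ] * (1 * a [ s ] + 1 * e [ s ]) * H (dec C s)))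
      ≡⟨ cong (λ z → T * (t * (C [ s ] * a [ s ] * G (dec C s))) + T * (2 * K * (C [ s ] * z * H (dec C s)))) (sym (lookup-mix 1 1 s)) ⟩
    T * (t * (C [ s ] * a [ s ] * G (dec C s))) + T * (2 * K * (C [ s ] * mix 1 1 p [ s ] * H (dec C s))) ∎

-- Let t → ∞ in perturbed.
pm-lower : ∀ {d} {L : List (Pair n)} → Regular d L → 0 < d →
  (d !) ^ n ≤ 2 * (4 * d) ^ n * (2 * pm (map proj₁ L) (replicate n 1)) ^ d
pm-lower {n} {d} {L} R d>0 = conclude (P ℕ.≟ 0)
  where
  open ℕ.≤-Reasoning
  open Regular R
  P = pm (map proj₁ L) (replicate n 1)
  K = 2 ^ length L * pm (map (mix 1 1) L) (replicate n 1)
  B = 2 * (4 * d) ^ n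
  B>0 : 0 < B
  B>0 = *-pos {2} (s≤s z≤n) (^-pos n (*-pos {4} (s≤s z≤n) d>0))
  -- This t serves both cases below: P = 0 would give t^d ≤ (B K)^d, and for P ≠ 0 it gives K ≤ t P,
  -- at the price of a factor 2^d.
  t = suc (B * K)
  Q = pm (map (mix t 1) L) (replicate n 1)
  bound : (d !) ^ n * t ^ d ≤ B * (t * P + K) ^ d
  bound = *-cancel-pos {(t ^ d) ^ n} _ _ (^-pos n (^-pos d (s≤s z≤n))) (begin
    (t ^ d) ^ n * ((d !) ^ n * t ^ d)
      ≡⟨ r₁ ((t ^ d) ^ n) ((d !) ^ n) (t ^ d) ⟩
    (d !) ^ n * (t ^ d) ^ n * t ^ d
      ≤⟨ ℕ.*-monoˡ-≤ (t ^ d) (perturbed R t (s≤s z≤n) d>0) ⟩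
    2 * ((4 * d) ^ n * Q ^ d) * t ^ d
      ≡⟨ trans (r₂ ((4 * d) ^ n) (Q ^ d) (t ^ d)) (cong (B *_) (sym (^-distrib-* Q t d))) ⟩
    B * (Q * t) ^ d
      ≤⟨ ℕ.*-monoʳ-≤ B (ℕ.^-monoˡ-≤ d (pm-perturb t (s≤s z≤n) L (replicate n 1))) ⟩
    B * (t ^ length L * (t * P + K)) ^ d
      ≡⟨ cong (B *_) (trans (^-distrib-* (t ^ length L) (t * P + K) d) (cong (_* (t * P + K) ^ d) (trans (cong (λ z → (t ^ z) ^ d) size) (^-swap t n d)))) ⟩
    B * ((t ^ d) ^ n * (t * P + K) ^ d)
      ≡⟨ r₃ B ((t ^ d) ^ n) _ ⟩
    (t ^ d) ^ n * (B * (t * P + K) ^ d) ∎)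
    where
    r₁ : ∀ a b c → a * (b * c) ≡ b * a * c
    r₁ = ℕ-Solver.solve-∀
    r₂ : ∀ a b c → 2 * (a * b) * c ≡ 2 * a * (b * c)
    r₂ = ℕ-Solver.solve-∀
    r₃ : ∀ a b c → a * (b * c) ≡ b * (a * c)
    r₃ = ℕ-Solver.solve-∀
  conclude : _ → (d !) ^ n ≤ B * (2 * P) ^ d
  conclude (yes P≡0) = ⊥-elim (ℕ.<-irrefl refl (begin-strict
    t ^ d                   ≤⟨ ℕ.m≤n*m (t ^ d) ((d !) ^ n) {{>-nonZero (^-pos n (ℕ.1≤n! d))}} ⟩
    (d !) ^ n * t ^ d       ≤⟨ bound ⟩
    B * (t * P + K) ^ d     ≡⟨ cong (λ z → B * (z + K) ^ d) (trans (cong (t *_) P≡0) (ℕ.*-zeroʳ t)) ⟩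
    B * K ^ d               ≤⟨ ℕ.*-monoˡ-≤ (K ^ d) (B≤B^d d d>0) ⟩
    B ^ d * K ^ d           ≡⟨ sym (^-distrib-* B K d) ⟩
    (B * K) ^ d             <⟨ ℕ.^-monoˡ-< d {{>-nonZero d>0}} (ℕ.n<1+n (B * K)) ⟩
    t ^ d ∎))
    where
    B≤B^d : ∀ d → 0 < d → B ≤ B ^ d
    B≤B^d (suc d) _ = ℕ.m≤m*n B (B ^ d) {{>-nonZero (^-pos d B>0)}}
  conclude (no P≢0) = *-cancel-pos {t ^ d} _ _ (^-pos d (s≤s z≤n)) (begin
    t ^ d * (d !) ^ n           ≡⟨ ℕ.*-comm (t ^ d) _ ⟩
    (d !) ^ n * t ^ d           ≤⟨ bound ⟩
    B * (t * P + K) ^ d         ≤⟨ ℕ.*-monoʳ-≤ B (ℕ.^-monoˡ-≤ d (ℕ.+-monoʳ-≤ (t * P) K≤tP)) ⟩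
    B * (t * P + t * P) ^ d     ≡⟨ cong (B *_) (trans (cong (_^ d) (r t P)) (^-distrib-* t (2 * P) d)) ⟩
    B * (t ^ d * (2 * P) ^ d)   ≡⟨ r₃ B (t ^ d) _ ⟩
    t ^ d * (B * (2 * P) ^ d) ∎)
    where
    r : ∀ t P → t * P + t * P ≡ t * (2 * P)
    r = ℕ-Solver.solve-∀
    r₃ : ∀ a b c → a * (b * c) ≡ b * (a * c)
    r₃ = ℕ-Solver.solve-∀
    K≤tP : K ≤ t * P
    K≤tP = ℕ.≤-trans (ℕ.m≤n*m K B {{>-nonZero B>0}}) (ℕ.≤-trans (ℕ.n≤1+n (B * K)) (ℕ.m≤m*n t P {{≢-nonZero P≢0}}))

-- Brègman's theorem

dec-comm : (C : Vec ℕ n) (s t : Fin n) → dec (dec C s) t ≡ dec (dec C t) s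
dec-comm C s t with s ≟ t
... | yes refl = refl
... | no s≢t   = Vec.updateAt-commutes t s (λ e → s≢t (sym e)) C

lookup-dec : (C : Vec ℕ n) (s : Fin n) → dec C s [ s ] ≡ pred (C [ s ])
lookup-dec C s = Vec.lookup∘updateAt s C

lookup-dec′ : (C : Vec ℕ n) {s t : Fin n} → t ≢ s → dec C s [ t ] ≡ C [ t ]
lookup-dec′ C {s} {t} t≢s = Vec.lookup∘updateAt′ t s t≢s C

falling-comm : (C : Vec ℕ n) (s t : Fin n) → C [ s ] * dec C s [ t ] ≡ C [ t ] * dec C t [ s ]
falling-comm C s t with s ≟ t
... | yes refl = refl
... | no s≢t   = trans (cong (C [ s ] *_) (lookup-dec′ C (λ e → s≢t (sym e))))
  (trans (ℕ.*-comm (C [ s ]) _) (cong (C [ t ] *_) (sym (lookup-dec′ C s≢t))))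

∂-comm : ∀ (F : Vec ℕ n → ℕ) w w′ C → ∂ w (∂ w′ F) C ≡ ∂ w′ (∂ w F) C
∂-comm F w w′ C = begin
  ∑ (λ s → C [ s ] * w [ s ] * ∑ (λ t → dec C s [ t ] * w′ [ t ] * F (dec (dec C s) t)))
    ≡⟨ sum-cong-≗ (λ s → *-distribˡ-sum (C [ s ] * w [ s ]) (λ t → dec C s [ t ] * w′ [ t ] * F (dec (dec C s) t))) ⟩
  ∑ (λ s → ∑ (λ t → C [ s ] * w [ s ] * (dec C s [ t ] * w′ [ t ] * F (dec (dec C s) t))))
    ≡⟨ ∑-comm (λ s t → C [ s ] * w [ s ] * (dec C s [ t ] * w′ [ t ] * F (dec (dec C s) t))) ⟩
  ∑ (λ t → ∑ (λ s → C [ s ] * w [ s ] * (dec C s [ t ] * w′ [ t ] * F (dec (dec C s) t))))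
    ≡⟨ sum-cong-≗ (λ t → sum-cong-≗ (λ s → term s t)) ⟩
  ∑ (λ t → ∑ (λ s → C [ t ] * w′ [ t ] * (dec C t [ s ] * w [ s ] * F (dec (dec C t) s))))
    ≡⟨ sum-cong-≗ (λ t → sym (*-distribˡ-sum (C [ t ] * w′ [ t ]) (λ s → dec C t [ s ] * w [ s ] * F (dec (dec C t) s)))) ⟩
  ∑ (λ t → C [ t ] * w′ [ t ] * ∑ (λ s → dec C t [ s ] * w [ s ] * F (dec (dec C t) s))) ∎
  where
  open ≡-Reasoning
  r : ∀ a b c d e → a * b * (c * d * e) ≡ (a * c) * (b * d * e)
  r = ℕ-Solver.solve-∀
  r′ : ∀ a b c d e → (a * c) * (b * d * e) ≡ a * d * (c * b * e)
  r′ = ℕ-Solver.solve-∀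
  term : ∀ s t → C [ s ] * w [ s ] * (dec C s [ t ] * w′ [ t ] * F (dec (dec C s) t)) ≡
                 C [ t ] * w′ [ t ] * (dec C t [ s ] * w [ s ] * F (dec (dec C t) s))
  term s t = trans (r (C [ s ]) (w [ s ]) (dec C s [ t ]) (w′ [ t ]) _)
    (trans (cong₂ (λ a b → a * (w [ s ] * w′ [ t ] * F b)) (falling-comm C s t) (dec-comm C s t))
           (r′ (C [ t ]) (w [ s ]) (dec C t [ s ]) (w′ [ t ]) _))

expand-row : ∀ (ws : List (Vec ℕ n)) i C → pm ws C ≡ ∂ (List.lookup ws i) (pm (removeAt ws i)) C
expand-row (w ∷ ws) zero    C = refl
expand-row (w ∷ ws) (suc i) C = trans (∂-cong w C (expand-row ws i)) (∂-comm (pm (removeAt ws i)) w (List.lookup ws i) C)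

δ : Fin n → Fin n → ℕ
δ s t = if does (s ≟ t) then 1 else 0

δ-refl : (s : Fin n) → δ s s ≡ 1
δ-refl s with s ≟ s
... | yes _ = refl
... | no p  = ⊥-elim (p refl)

δ-≢ : {s t : Fin n} → s ≢ t → δ s t ≡ 0
δ-≢ {s = s} {t} p with s ≟ t
... | yes e = ⊥-elim (p e)
... | no _  = refl

∑-zero : {f : Fin n → ℕ} → (∀ i → f i ≡ 0) → ∑ f ≡ 0
∑-zero {n} h = trans (sum-cong-≗ h) (sum-replicate-zero n)

∑≡0⇒≡0 : ∀ (f : Fin n → ℕ) → ∑ f ≡ 0 → ∀ i → f i ≡ 0
∑≡0⇒≡0 f e zero    = ℕ.m+n≡0⇒m≡0 (f zero) e
∑≡0⇒≡0 f e (suc i) = ∑≡0⇒≡0 (f ∘ suc) (ℕ.m+n≡0⇒n≡0 (f zero) e) i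

∑-δ : ∀ (s : Fin n) (f : Fin n → ℕ) → ∑ (λ t → δ t s * f t) ≡ f s
∑-δ {suc n} s f = trans (sum-remove {i = s} (λ t → δ t s * f t))
  (trans (cong₂ _+_ (trans (cong (_* f s) (δ-refl s)) (ℕ.*-identityˡ (f s)))
                    (∑-zero (λ i → cong (_* f (punchIn s i)) (δ-≢ (punchInᵢ≢i s i)))))
         (ℕ.+-identityʳ (f s)))

lookup≤total : (C : Vec ℕ n) (s : Fin n) → C [ s ] ≤ total C
lookup≤total (x ∷ C) zero    = ℕ.m≤m+n x _
lookup≤total (x ∷ C) (suc s) = ℕ.≤-trans (lookup≤total C s) (ℕ.m≤n+m _ x)

-- Either the first row takes column s, which occurs once, or it takes some t ≠ s; then the
-- expansion of the smaller matrix along s commutes with the removal of t.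
expand-column : ∀ (ws : List (Vec ℕ n)) C s → C [ s ] ≡ 1 → total C ≡ length ws →
  pm ws C ≡ ∑ (λ i → List.lookup ws i [ s ] * pm (removeAt ws i) (dec C s))
expand-column []       C s Cs e = ⊥-elim (ℕ.<⇒≱ (s≤s z≤n) (ℕ.≤-trans (ℕ.≤-reflexive (sym Cs)) (ℕ.≤-trans (lookup≤total C s) (ℕ.≤-reflexive e))))
expand-column {n} (w ∷ ws) C s Cs e = begin
  ∑ (λ t → C [ t ] * w [ t ] * pm ws (dec C t))
    ≡⟨ sum-cong-≗ term ⟩
  ∑ (λ t → δ t s * (w [ t ] * pm ws (dec C t)) + ∑ (λ i → X i t))
    ≡⟨ ∑-distrib-+ (λ t → δ t s * (w [ t ] * pm ws (dec C t))) _ ⟩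
  ∑ (λ t → δ t s * (w [ t ] * pm ws (dec C t))) + ∑ (λ t → ∑ (λ i → X i t))
    ≡⟨ cong₂ _+_ (∑-δ s (λ t → w [ t ] * pm ws (dec C t))) (trans (∑-comm (λ t i → X i t))
         (sum-cong-≗ (λ i → sym (*-distribˡ-sum (List.lookup ws i [ s ]) (λ t → dec C s [ t ] * w [ t ] * pm (removeAt ws i) (dec (dec C s) t)))))) ⟩
  w [ s ] * pm ws (dec C s) + ∑ (λ i → List.lookup ws i [ s ] * ∂ w (pm (removeAt ws i)) (dec C s)) ∎
  where
  open ≡-Reasoning
  X : Fin (length ws) → Fin n → ℕ
  X i t = List.lookup ws i [ s ] * (dec C s [ t ] * w [ t ] * pm (removeAt ws i) (dec (dec C s) t))
  r : ∀ a b c d → a * b * (c * d) ≡ c * (a * b * d)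
  r = ℕ-Solver.solve-∀
  term : ∀ t → C [ t ] * w [ t ] * pm ws (dec C t) ≡ δ t s * (w [ t ] * pm ws (dec C t)) + ∑ (λ i → X i t)
  term t with t ≟ s
  ... | yes refl = trans (cong (λ c → c * w [ t ] * pm ws (dec C t)) Cs)
    (trans (ℕ.*-assoc 1 (w [ t ]) _) (sym (trans (cong (λ z → 1 * (w [ t ] * pm ws (dec C t)) + z) (∑-zero X0)) (ℕ.+-identityʳ _))))
    where
    X0 : ∀ i → X i t ≡ 0
    X0 i = trans (cong (λ c → List.lookup ws i [ t ] * (c * w [ t ] * pm (removeAt ws i) (dec (dec C t) t)))
      (trans (lookup-dec C t) (cong pred Cs))) (ℕ.*-zeroʳ (List.lookup ws i [ t ]))
  ... | no t≢s with C [ t ] ℕ.≟ 0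
  ...   | yes z = trans (cong (λ c → c * w [ t ] * pm ws (dec C t)) z) (sym (∑-zero X0))
    where
    X0 : ∀ i → X i t ≡ 0
    X0 i = trans (cong (λ c → List.lookup ws i [ s ] * (c * w [ t ] * pm (removeAt ws i) (dec (dec C s) t)))
      (trans (lookup-dec′ C t≢s) z)) (ℕ.*-zeroʳ (List.lookup ws i [ s ]))
  ...   | no nz = begin
    C [ t ] * w [ t ] * pm ws (dec C t)
      ≡⟨ cong (C [ t ] * w [ t ] *_) (expand-column ws (dec C t) s (trans (lookup-dec′ C (λ e → t≢s (sym e))) Cs)
           (ℕ.suc-injective (trans (total-dec C t nz) e))) ⟩
    C [ t ] * w [ t ] * ∑ (λ i → List.lookup ws i [ s ] * pm (removeAt ws i) (dec (dec C t) s))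
      ≡⟨ *-distribˡ-sum (C [ t ] * w [ t ]) (λ i → List.lookup ws i [ s ] * pm (removeAt ws i) (dec (dec C t) s)) ⟩
    ∑ (λ i → C [ t ] * w [ t ] * (List.lookup ws i [ s ] * pm (removeAt ws i) (dec (dec C t) s)))
      ≡⟨ sum-cong-≗ (λ i → trans (r (C [ t ]) (w [ t ]) (List.lookup ws i [ s ]) _)
           (cong₂ (λ c x → List.lookup ws i [ s ] * (c * w [ t ] * pm (removeAt ws i) x)) (sym (lookup-dec′ C t≢s)) (dec-comm C t s))) ⟩
    ∑ (λ i → X i t) ∎

∏-mono : {f g : Fin n → ℕ} → (∀ i → f i ≤ g i) → ∏ f ≤ ∏ g
∏-mono {zero}  h = s≤s z≤n
∏-mono {suc n} h = ℕ.*-mono-≤ (h zero) (∏-mono (h ∘ suc))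

∏-^ : ∀ (f : Fin n → ℕ) k → ∏ (λ i → f i ^ k) ≡ ∏ f ^ k
∏-^ {zero}  f k = sym (ℕ.^-zeroˡ k)
∏-^ {suc n} f k = trans (cong (f zero ^ k *_) (∏-^ (f ∘ suc) k)) (sym (^-distrib-* (f zero) (∏ (f ∘ suc)) k))

^-∑ : ∀ b (e : Fin n → ℕ) → ∏ (λ i → b ^ e i) ≡ b ^ ∑ e
^-∑ {zero}  b e = refl
^-∑ {suc n} b e = trans (cong (b ^ e zero *_) (^-∑ b (e ∘ suc))) (sym (ℕ.^-distribˡ-+-* b (e zero) _))

∏-const : ∀ m k → ∏ {m} (λ _ → k) ≡ k ^ m
∏-const zero    k = refl
∏-const (suc m) k = cong (k *_) (∏-const m k)

∏-pos : {f : Fin n → ℕ} → (∀ i → 0 < f i) → 0 < ∏ f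
∏-pos {zero}  h = s≤s z≤n
∏-pos {suc n} h = *-pos (h zero) (∏-pos (h ∘ suc))

∏L≡∏ : ∀ {A : Set} (g : A → ℕ) (ws : List A) → ∏L g ws ≡ ∏ (λ i → g (List.lookup ws i))
∏L≡∏ g []       = refl
∏L≡∏ g (w ∷ ws) = cong (g w *_) (∏L≡∏ g ws)

∏L-removeAt : ∀ {A : Set} (g : A → ℕ) (ws : List A) i → ∏L g (removeAt ws i) * g (List.lookup ws i) ≡ ∏L g ws
∏L-removeAt g (w ∷ ws) zero    = ℕ.*-comm _ (g w)
∏L-removeAt g (w ∷ ws) (suc i) = trans (ℕ.*-assoc (g w) _ _) (cong (g w *_) (∏L-removeAt g ws i))

-- Convexity of x log x with integer data

-- AM-GM for x copies of y and y copies of r x, with sum (r + 1) x y. It weighs one term of value x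
-- against r terms of total y.
two-term-gibbs : ∀ r x y → (x + y) ^ (x + y) * r ^ y ≤ suc r ^ (x + y) * (x ^ x * y ^ y)
two-term-gibbs r zero y = ℕ.≤-trans (ℕ.≤-reflexive (c (y ^ y) (r ^ y))) (ℕ.*-monoˡ-≤ (1 * y ^ y) (ℕ.^-monoˡ-≤ y (ℕ.n≤1+n r)))
  where
  c : ∀ a b → a * b ≡ b * (1 * a)
  c = ℕ-Solver.solve-∀
two-term-gibbs r x@(suc m) zero rewrite ℕ.+-identityʳ m = ℕ.≤-trans (ℕ.m≤n*m (x ^ x * 1) (suc r ^ x) {{ℕ.m^n≢0 (suc r) x}}) ℕ.≤-refl
two-term-gibbs r x@(suc _) y@(suc _) = *-cancel-pos {y ^ x * x ^ y} _ _ (*-pos (^-pos x (s≤s z≤n)) (^-pos y (s≤s z≤n))) (begin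
  y ^ x * x ^ y * (m ^ m * r ^ y)       ≡⟨ c₁ (y ^ x) (x ^ y) (m ^ m) (r ^ y) ⟩
  y ^ x * (r ^ y * x ^ y) * m ^ m       ≡⟨ cong (λ z → y ^ x * z * m ^ m) (sym (^-distrib-* r x y)) ⟩
  y ^ x * (r * x) ^ y * m ^ m           ≤⟨ am-gm x y y (r * x) ⟩
  (x * y + y * (r * x)) ^ m             ≡⟨ cong (_^ m) (c₂ x y r) ⟩
  (suc r * (x * y)) ^ m                 ≡⟨ trans (^-distrib-* (suc r) (x * y) m) (cong (suc r ^ m *_) (^-distrib-* x y m)) ⟩
  suc r ^ m * (x ^ m * y ^ m)           ≡⟨ cong₂ (λ a b → suc r ^ m * (a * b)) (ℕ.^-distribˡ-+-* x x y) (ℕ.^-distribˡ-+-* y x y) ⟩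
  suc r ^ m * (x ^ x * x ^ y * (y ^ x * y ^ y)) ≡⟨ c₃ (suc r ^ m) (x ^ x) (x ^ y) (y ^ x) (y ^ y) ⟩
  y ^ x * x ^ y * (suc r ^ m * (x ^ x * y ^ y)) ∎)
  where
  open ℕ.≤-Reasoning
  m = x + y
  c₁ : ∀ a b c d → a * b * (c * d) ≡ a * (d * b) * c
  c₁ = ℕ-Solver.solve-∀
  c₂ : ∀ x y r → x * y + y * (r * x) ≡ suc r * (x * y)
  c₂ = ℕ-Solver.solve-∀
  c₃ : ∀ a b c d e → a * (b * c * (d * e)) ≡ d * c * (a * (b * e))
  c₃ = ℕ-Solver.solve-∀

-- Jensen's inequality for x log x on the selected coordinates, peeled off one at a time. The factor
-- r^T that is cancelled is positive even for r = 0, as then T = 0.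
gibbs : ∀ (c x : Fin n → ℕ) → (∀ s → c s ≤ 1) → let T = ∑ (λ s → c s * x s) in
  T ^ T ≤ ∑ c ^ T * ∏ (λ s → x s ^ (c s * x s))
gibbs {zero}  c x h = s≤s z≤n
gibbs {suc n} c x h = step (c zero) (h zero)
  where
  open ℕ.≤-Reasoning
  x₀ = x zero
  T = ∑ (λ s → c (suc s) * x (suc s))
  r = ∑ (c ∘ suc)
  π = ∏ (λ s → x (suc s) ^ (c (suc s) * x (suc s)))
  ih : T ^ T ≤ r ^ T * π
  ih = gibbs (c ∘ suc) (x ∘ suc) (h ∘ suc)
  r^T>0 : ∀ r → ∑ (c ∘ suc) ≡ r → 0 < r ^ T
  r^T>0 (suc r) _ = ^-pos T (s≤s z≤n)
  r^T>0 zero    e = ℕ.≤-reflexive (sym (cong (0 ^_) (∑-zero (λ s → cong (_* x (suc s)) (∑≡0⇒≡0 (c ∘ suc) e s)))))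
  step : ∀ c₀ → c₀ ≤ 1 → (c₀ * x₀ + T) ^ (c₀ * x₀ + T) ≤ (c₀ + r) ^ (c₀ * x₀ + T) * (x₀ ^ (c₀ * x₀) * π)
  step zero          _ = ℕ.≤-trans ih (ℕ.≤-reflexive (cong (r ^ T *_) (sym (ℕ.*-identityˡ π))))
  step (suc zero)    _ rewrite ℕ.+-identityʳ x₀ = *-cancel-pos {r ^ T} _ _ (r^T>0 r refl) (begin
    r ^ T * (x₀ + T) ^ (x₀ + T)                      ≡⟨ ℕ.*-comm (r ^ T) _ ⟩
    (x₀ + T) ^ (x₀ + T) * r ^ T                      ≤⟨ two-term-gibbs r x₀ T ⟩
    suc r ^ (x₀ + T) * (x₀ ^ x₀ * T ^ T)             ≤⟨ ℕ.*-monoʳ-≤ (suc r ^ (x₀ + T)) (ℕ.*-monoʳ-≤ (x₀ ^ x₀) ih) ⟩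
    suc r ^ (x₀ + T) * (x₀ ^ x₀ * (r ^ T * π))       ≡⟨ c₁ (suc r ^ (x₀ + T)) (x₀ ^ x₀) (r ^ T) π ⟩
    r ^ T * (suc r ^ (x₀ + T) * (x₀ ^ x₀ * π)) ∎)
    where
    c₁ : ∀ a b c d → a * (b * (c * d)) ≡ c * (a * (b * d))
    c₁ = ℕ-Solver.solve-∀
  step (suc (suc _)) (s≤s ())

rowSum : Vec ℕ n → Vec ℕ n → ℕ
rowSum C w = ∑ (λ s → C [ s ] * w [ s ])

Bitsᶠ : Vec ℕ n → Set
Bitsᶠ {n} C = (s : Fin n) → C [ s ] ≤ 1

bit : ∀ {b} → b ≤ 1 → b ≡ 0 ⊎ b ≡ 1
bit z≤n       = inj₁ refl
bit (s≤s z≤n) = inj₂ refl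

dec-bits : (C : Vec ℕ n) (s : Fin n) → Bitsᶠ C → Bitsᶠ (dec C s)
dec-bits C s h t with t ≟ s
... | yes refl = ℕ.≤-trans (ℕ.≤-reflexive (lookup-dec C t)) (ℕ.≤-trans ℕ.pred[n]≤n (h t))
... | no t≢s   = ℕ.≤-trans (ℕ.≤-reflexive (lookup-dec′ C t≢s)) (h t)

rowSum-dec : ∀ (C w : Vec ℕ n) s → C [ s ] ≡ 1 → rowSum C w ≡ w [ s ] + rowSum (dec C s) w
rowSum-dec C w s Cs = trans (sum-cong-≗ term)
  (trans (∑-distrib-+ (λ t → δ t s * w [ t ]) _) (cong (_+ rowSum (dec C s) w) (∑-δ s (w [_]))))
  where
  term : ∀ t → C [ t ] * w [ t ] ≡ δ t s * w [ t ] + dec C s [ t ] * w [ t ]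
  term t with t ≟ s
  ... | yes refl rewrite Cs | lookup-dec C t | Cs = sym (ℕ.+-identityʳ _)
  ... | no t≢s = cong (_* w [ t ]) (sym (lookup-dec′ C t≢s))

-- Schrijver's proof of Brègman's theorem: apply gibbs to P = pm ws C expanded along every row, then
-- the induction hypothesis to every minor, and collect exponents by the expansions along columns.
module Bregman (D N : ℕ) (f : ℕ → ℕ) (D>0 : 0 < D) (f>0 : ∀ r → 0 < f r)
  (f-step : ∀ r → r < N → f (suc r) ^ suc r ≡ suc r ^ D * f r ^ r) where

  module _ (ws : List (Vec ℕ n)) (C : Vec ℕ n) (wbits : All Bitsᶠ ws) (Cbits : Bitsᶠ C)
    (size : total C ≡ length ws) (size≤ : total C ≤ N)
    (ih : ∀ i s → C [ s ] ≡ 1 → pm (removeAt ws i) (dec C s) ^ D ≤ ∏L (λ w → f (rowSum (dec C s) w)) (removeAt ws i)) where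

    private
      I = Fin (length ws)
      w : I → Vec ℕ n
      w = List.lookup ws
      wb : ∀ i → Bitsᶠ (w i)
      wb i = All.lookup wbits (∈-lookup i)
      P = pm ws C
      Q : I → Fin n → ℕ
      Q i s = pm (removeAt ws i) (dec C s)
      c : I → Fin n → ℕ
      c i s = C [ s ] * w i [ s ]
      cb : ∀ i s → c i s ≤ 1
      cb i s = ℕ.*-mono-≤ (Cbits s) (wb i s)
      e : I → Fin n → ℕ
      e i s = c i s * Q i s
      r : I → ℕ
      r i = rowSum C (w i)
      g : Fin n → Vec ℕ n → ℕ
      g s v = f (rowSum (dec C s) v)

    row : ∀ i → ∑ (e i) ≡ P
    row i = sym (expand-row ws i C)

    column : ∀ s → ∑ (λ i → e i s) ≡ C [ s ] * P
    column s with bit (Cbits s)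
    ... | inj₁ z rewrite z = ∑-zero {length ws} {λ i → 0 * w i [ s ] * Q i s} (λ i → refl)
    ... | inj₂ o = trans (sum-cong-≗ (λ i → trans (cong (λ x → x * w i [ s ] * Q i s) o) (cong (_* Q i s) (ℕ.*-identityˡ (w i [ s ])))))
      (trans (sym (expand-column ws C s o size)) (trans (sym (ℕ.*-identityˡ P)) (cong (_* P) (sym o))))

    open ℕ.≤-Reasoning

    -- The induction hypothesis lacks the factor of the removed row i. Supplying it makes the right
    -- side independent of i, so that the exponents can be added up along a column.
    entry : ∀ i s → (Q i s ^ D * g s (w i)) ^ e i s ≤ (∏ (λ j → g s (w j))) ^ e i s
    entry i s with bit (Cbits s)
    ... | inj₁ z rewrite z = s≤s z≤n
    ... | inj₂ o = ℕ.^-monoˡ-≤ (e i s) (begin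
      Q i s ^ D * g s (w i)                ≤⟨ ℕ.*-monoˡ-≤ (g s (w i)) (ih i s o) ⟩
      ∏L (g s) (removeAt ws i) * g s (w i) ≡⟨ trans (∏L-removeAt (g s) ws i) (∏L≡∏ (g s) ws) ⟩
      ∏ (λ j → g s (w j)) ∎)

    -- The factors supplied in `entry`, collected over all cells; they are positive and cancel at
    -- the end of `bregman-step`.
    Z : ℕ
    Z = ∏ (λ i → ∏ (λ s → g s (w i) ^ e i s))

    entries : ∏ (λ i → ∏ (λ s → Q i s ^ e i s)) ^ D * Z ≤ ∏ (λ j → ∏ (λ s → g s (w j) ^ (C [ s ] * P)))
    entries = begin
      ∏ (λ i → ∏ (λ s → Q i s ^ e i s)) ^ D * Z
        ≡⟨ cong (_* Z) (sym (trans (∏-cong (λ i → ∏-^ (λ s → Q i s ^ e i s) D)) (∏-^ (λ i → ∏ (λ s → Q i s ^ e i s)) D))) ⟩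
      ∏ (λ i → ∏ (λ s → (Q i s ^ e i s) ^ D)) * Z
        ≡⟨ sym (trans (∏-cong (λ i → ∏-distrib-* (λ s → (Q i s ^ e i s) ^ D) _)) (∏-distrib-* (λ i → ∏ (λ s → (Q i s ^ e i s) ^ D)) _)) ⟩
      ∏ (λ i → ∏ (λ s → (Q i s ^ e i s) ^ D * g s (w i) ^ e i s))
        ≡⟨ ∏-cong (λ i → ∏-cong (λ s → trans (cong (_* g s (w i) ^ e i s) (^-swap (Q i s) (e i s) D)) (sym (^-distrib-* (Q i s ^ D) (g s (w i)) (e i s))))) ⟩
      ∏ (λ i → ∏ (λ s → (Q i s ^ D * g s (w i)) ^ e i s))
        ≤⟨ ∏-mono (λ i → ∏-mono (λ s → entry i s)) ⟩
      ∏ (λ i → ∏ (λ s → (∏ (λ j → g s (w j))) ^ e i s))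
        ≡⟨ ∏-comm (λ i s → (∏ (λ j → g s (w j))) ^ e i s) ⟩
      ∏ (λ s → ∏ (λ i → (∏ (λ j → g s (w j))) ^ e i s))
        ≡⟨ ∏-cong (λ s → trans (^-∑ (∏ (λ j → g s (w j))) (λ i → e i s)) (cong ((∏ (λ j → g s (w j))) ^_) (column s))) ⟩
      ∏ (λ s → (∏ (λ j → g s (w j))) ^ (C [ s ] * P))
        ≡⟨ ∏-cong (λ s → sym (∏-^ (λ j → g s (w j)) (C [ s ] * P))) ⟩
      ∏ (λ s → ∏ (λ j → g s (w j) ^ (C [ s ] * P)))
        ≡⟨ ∏-comm (λ s j → g s (w j) ^ (C [ s ] * P)) ⟩
      ∏ (λ j → ∏ (λ s → g s (w j) ^ (C [ s ] * P))) ∎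

    c̄ : I → Fin n → ℕ
    c̄ i s = C [ s ] ∸ c i s

    c≤C : ∀ i s → c i s ≤ C [ s ]
    c≤C i s = ℕ.≤-trans (ℕ.*-monoʳ-≤ (C [ s ]) (wb i s)) (ℕ.≤-reflexive (ℕ.*-identityʳ _))

    r+r̄ : ∀ i → r i + ∑ (c̄ i) ≡ length ws
    r+r̄ i = trans (sym (∑-distrib-+ (c i) (c̄ i))) (trans (sum-cong-≗ (λ s → ℕ.m+[n∸m]≡n (c≤C i s))) size)

    r≤N : ∀ i → r i ≤ N
    r≤N i = ℕ.≤-trans (∑-mono (c≤C i)) size≤

    g-on : ∀ i s → c i s ≡ 1 → ∀ ρ → r i ≡ suc ρ → g s (w i) ≡ f ρ
    g-on i s c≡1 ρ ri with bit (Cbits s)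
    ... | inj₁ z = ⊥-elim (ℕ.1+n≢0 (sym (trans (cong (_* w i [ s ]) (sym z)) c≡1)))
    ... | inj₂ o = cong f (ℕ.suc-injective (trans (cong (_+ rowSum (dec C s) (w i)) (sym ws≡1)) (trans (sym (rowSum-dec C (w i) s o)) ri)))
      where
      ws≡1 : w i [ s ] ≡ 1
      ws≡1 = trans (sym (ℕ.*-identityˡ _)) (trans (cong (_* w i [ s ]) (sym o)) c≡1)

    g-off : ∀ i s → C [ s ] ≡ 1 → c i s ≡ 0 → g s (w i) ≡ f (r i)
    g-off i s o c≡0 = cong f (trans (cong (_+ rowSum (dec C s) (w i)) (sym ws≡0)) (sym (rowSum-dec C (w i) s o)))
      where
      ws≡0 : w i [ s ] ≡ 0
      ws≡0 = trans (sym (ℕ.*-identityˡ _)) (trans (cong (_* w i [ s ]) (sym o)) c≡0)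

    g-cell : ∀ i ρ → r i ≡ suc ρ → ∀ s → g s (w i) ^ (C [ s ] * P) ≡ f ρ ^ (c i s * P) * f (r i) ^ (c̄ i s * P)
    g-cell i ρ ri s with bit (Cbits s)
    ... | inj₁ z rewrite z = refl
    ... | inj₂ o with bit (cb i s)
    ...   | inj₁ c0 = trans (cong₂ (λ a b → a ^ (b * P)) (g-off i s o c0) o)
            (sym (trans (cong₂ (λ a b → f ρ ^ (a * P) * f (r i) ^ ((b ∸ a) * P)) c0 o) (ℕ.*-identityˡ _)))
    ...   | inj₂ c1 = trans (cong₂ (λ a b → a ^ (b * P)) (g-on i s c1 ρ ri) o)
            (sym (trans (cong₂ (λ a b → f ρ ^ (a * P) * f (r i) ^ ((b ∸ a) * P)) c1 o) (ℕ.*-identityʳ _)))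

    g-exp : ∀ i ρ → r i ≡ suc ρ → ∀ s → g s (w i) ^ e i s ≡ f ρ ^ e i s
    g-exp i ρ ri s with bit (cb i s)
    ... | inj₁ c0 rewrite c0 = refl
    ... | inj₂ c1 = cong (_^ e i s) (g-on i s c1 ρ ri)

    -- Removing column s leaves the row sum r - 1 for the r ones of the row and r otherwise. By
    -- `f-step`, r^D f(r-1)^(r-1) = f(r)^r completes the exponent of f(r), and the remaining
    -- f(r-1)^P is the share of the row in Z. A zero row forces P = 0.
    row-bound : ∀ i → (r i ^ P) ^ D * ∏ (λ s → g s (w i) ^ (C [ s ] * P)) ≤ f (r i) ^ (length ws * P) * ∏ (λ s → g s (w i) ^ e i s)
    row-bound i = go (r i) refl
      where
      go : ∀ ρ → r i ≡ ρ → (r i ^ P) ^ D * ∏ (λ s → g s (w i) ^ (C [ s ] * P)) ≤ f (r i) ^ (length ws * P) * ∏ (λ s → g s (w i) ^ e i s)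
      go zero ri = ℕ.≤-reflexive (cong₂ _*_
        (trans (cong (λ p → (r i ^ p) ^ D) P≡0) (trans (ℕ.^-zeroˡ D) (sym (cong (f (r i) ^_) (trans (cong (length ws *_) P≡0) (ℕ.*-zeroʳ (length ws)))))))
        (∏-cong (λ s → cong (g s (w i) ^_) (trans (cong (C [ s ] *_) P≡0) (trans (ℕ.*-zeroʳ (C [ s ])) (sym (e≡0 s)))))))
        where
        c≡0 : ∀ s → c i s ≡ 0
        c≡0 s with bit (cb i s)
        ... | inj₁ c0 = c0
        ... | inj₂ c1 = ⊥-elim (ℕ.1+n≰n (ℕ.≤-trans (ℕ.≤-reflexive (sym c1)) (ℕ.≤-trans (term≤∑ (c i) s) (ℕ.≤-reflexive ri))))
          where
          term≤∑ : ∀ {m} (h : Fin m → ℕ) s → h s ≤ ∑ h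
          term≤∑ h zero    = ℕ.m≤m+n (h zero) _
          term≤∑ h (suc s) = ℕ.≤-trans (term≤∑ (h ∘ suc) s) (ℕ.m≤n+m _ (h zero))
        e≡0 : ∀ s → e i s ≡ 0
        e≡0 s = cong (_* Q i s) (c≡0 s)
        P≡0 : P ≡ 0
        P≡0 = trans (sym (row i)) (∑-zero e≡0)
      go (suc ρ) ri = ℕ.≤-reflexive (begin-equality
        (r i ^ P) ^ D * ∏ (λ s → g s (w i) ^ (C [ s ] * P))
          ≡⟨ cong ((r i ^ P) ^ D *_) (trans (∏-cong (g-cell i ρ ri)) (trans (∏-distrib-* (λ s → f ρ ^ (c i s * P)) _)
               (cong₂ _*_ (powers (f ρ) (c i)) (powers (f (r i)) (c̄ i))))) ⟩
        (r i ^ P) ^ D * ((f ρ ^ r i) ^ P * (f (r i) ^ r̄) ^ P)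
          ≡⟨ cong₂ (λ a b → a * (b ^ P * (f (r i) ^ r̄) ^ P)) (^-swap (r i) P D) (cong (f ρ ^_) ri) ⟩
        (r i ^ D) ^ P * ((f ρ * f ρ ^ ρ) ^ P * (f (r i) ^ r̄) ^ P)
          ≡⟨ cong (λ z → (r i ^ D) ^ P * (z * (f (r i) ^ r̄) ^ P)) (^-distrib-* (f ρ) (f ρ ^ ρ) P) ⟩
        (r i ^ D) ^ P * (f ρ ^ P * (f ρ ^ ρ) ^ P * (f (r i) ^ r̄) ^ P)
          ≡⟨ rr ((r i ^ D) ^ P) (f ρ ^ P) ((f ρ ^ ρ) ^ P) _ ⟩
        ((r i ^ D) ^ P * (f ρ ^ ρ) ^ P) * (f (r i) ^ r̄) ^ P * f ρ ^ P
          ≡⟨ cong (λ z → z * (f (r i) ^ r̄) ^ P * f ρ ^ P) (trans (sym (^-distrib-* (r i ^ D) (f ρ ^ ρ) P)) (cong (_^ P)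
               (trans (cong (λ z → z ^ D * f ρ ^ ρ) ri) (trans (sym (f-step ρ (ℕ.≤-trans (ℕ.≤-reflexive (sym ri)) (r≤N i)))) (cong (λ z → f z ^ z) (sym ri)))))) ⟩
        (f (r i) ^ r i) ^ P * (f (r i) ^ r̄) ^ P * f ρ ^ P
          ≡⟨ cong₂ _*_ (trans (sym (^-distrib-* (f (r i) ^ r i) (f (r i) ^ r̄) P))
                (trans (cong (_^ P) (trans (sym (ℕ.^-distribˡ-+-* (f (r i)) (r i) r̄)) (cong (f (r i) ^_) (r+r̄ i)))) (ℕ.^-*-assoc (f (r i)) (length ws) P)))
                (sym (trans (^-∑ (f ρ) (e i)) (cong (f ρ ^_) (row i)))) ⟩
        f (r i) ^ (length ws * P) * ∏ (λ s → f ρ ^ e i s)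
          ≡⟨ cong (f (r i) ^ (length ws * P) *_) (sym (∏-cong (g-exp i ρ ri))) ⟩
        f (r i) ^ (length ws * P) * ∏ (λ s → g s (w i) ^ e i s) ∎)
        where
        r̄ = ∑ (c̄ i)
        rr : ∀ a b c d → a * (b * c * d) ≡ a * c * d * b
        rr = ℕ-Solver.solve-∀
        powers : ∀ b (x : Fin n → ℕ) → ∏ (λ s → b ^ (x s * P)) ≡ (b ^ ∑ x) ^ P
        powers b x = trans (∏-cong (λ s → sym (ℕ.^-*-assoc b (x s) P))) (trans (∏-^ (λ s → b ^ x s) P) (cong (_^ P) (^-∑ b x)))

    bregman-step : 0 < length ws → P ^ D ≤ ∏L (λ v → f (rowSum C v)) ws
    bregman-step m>0 with P ℕ.≟ 0
    ... | yes z = ℕ.≤-trans (ℕ.≤-reflexive (trans (cong (_^ D) z) (0^n≡0 D>0))) z≤n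
    -- In this power every row contributes its own P^P, to which `gibbs` applies with the cells of
    -- the row; the exponent is positive because P ≠ 0.
    ... | no nz = ^-root (length ws * P) (*-pos m>0 (ℕ.n≢0⇒n>0 nz)) (*-cancel-pos {Z} _ _ Z>0 (begin
      Z * (P ^ D) ^ (length ws * P)
        ≡⟨ cong (Z *_) (trans (cong ((P ^ D) ^_) (ℕ.*-comm (length ws) P)) (trans (sym (ℕ.^-*-assoc (P ^ D) P (length ws)))
             (trans (cong (_^ length ws) (^-swap P D P)) (trans (^-swap (P ^ P) D (length ws)) (cong (_^ D) (sym (∏-const (length ws) (P ^ P)))))))) ⟩
      Z * ∏ {length ws} (λ i → P ^ P) ^ D
        ≤⟨ ℕ.*-monoʳ-≤ Z (ℕ.^-monoˡ-≤ D (∏-mono (λ i → subst (λ p → p ^ p ≤ r i ^ p * ∏ (λ s → Q i s ^ e i s)) (row i) (gibbs (c i) (Q i) (cb i))))) ⟩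
      Z * ∏ (λ i → r i ^ P * ∏ (λ s → Q i s ^ e i s)) ^ D
        ≡⟨ cong (λ z → Z * z ^ D) (∏-distrib-* (λ i → r i ^ P) _) ⟩
      Z * (∏ (λ i → r i ^ P) * ∏ (λ i → ∏ (λ s → Q i s ^ e i s))) ^ D
        ≡⟨ trans (cong (Z *_) (^-distrib-* (∏ (λ i → r i ^ P)) _ D)) (rr Z (∏ (λ i → r i ^ P) ^ D) _) ⟩
      ∏ (λ i → r i ^ P) ^ D * (∏ (λ i → ∏ (λ s → Q i s ^ e i s)) ^ D * Z)
        ≤⟨ ℕ.*-monoʳ-≤ (∏ (λ i → r i ^ P) ^ D) entries ⟩
      ∏ (λ i → r i ^ P) ^ D * ∏ (λ j → ∏ (λ s → g s (w j) ^ (C [ s ] * P)))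
        ≡⟨ trans (cong (_* ∏ (λ j → ∏ (λ s → g s (w j) ^ (C [ s ] * P)))) (sym (∏-^ (λ i → r i ^ P) D))) (sym (∏-distrib-* (λ i → (r i ^ P) ^ D) _)) ⟩
      ∏ (λ i → (r i ^ P) ^ D * ∏ (λ s → g s (w i) ^ (C [ s ] * P)))
        ≤⟨ ∏-mono row-bound ⟩
      ∏ (λ i → f (r i) ^ (length ws * P) * ∏ (λ s → g s (w i) ^ e i s))
        ≡⟨ ∏-distrib-* (λ i → f (r i) ^ (length ws * P)) _ ⟩
      ∏ (λ i → f (r i) ^ (length ws * P)) * Z
        ≡⟨ trans (ℕ.*-comm _ Z) (cong (Z *_) (trans (∏-^ (λ i → f (r i)) (length ws * P)) (cong (_^ (length ws * P)) (sym (∏L≡∏ (λ v → f (rowSum C v)) ws))))) ⟩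
      Z * ∏L (λ v → f (rowSum C v)) ws ^ (length ws * P) ∎))
      where
      Z>0 : 0 < Z
      Z>0 = ∏-pos (λ i → ∏-pos (λ s → ^-pos (e i s) (f>0 _)))
      rr : ∀ a b c → a * (b * c) ≡ b * (c * a)
      rr = ℕ-Solver.solve-∀

  All-removeAt : ∀ {A : Set} {P : A → Set} {ws : List A} i → All P ws → All P (removeAt ws i)
  All-removeAt zero    (p ∷ ps) = ps
  All-removeAt (suc i) (p ∷ ps) = p ∷ All-removeAt i ps

  bregman : ∀ m (ws : List (Vec ℕ n)) C → length ws ≡ m → All Bitsᶠ ws → Bitsᶠ C → total C ≡ length ws → total C ≤ N →
    pm ws C ^ D ≤ ∏L (λ w → f (rowSum C w)) ws
  bregman zero    []            C _ _  _  _  _ = ℕ.≤-reflexive (ℕ.^-zeroˡ D)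
  bregman (suc m) ws@(w₀ ∷ ws₀) C e wb Cb sz le = bregman-step ws C wb Cb sz le ih (s≤s z≤n)
    where
    ih : ∀ i s → C [ s ] ≡ 1 → pm (removeAt ws i) (dec C s) ^ D ≤ ∏L (λ w → f (rowSum (dec C s) w)) (removeAt ws i)
    ih i s o = bregman m (removeAt ws i) (dec C s) len (All-removeAt i wb) (dec-bits C s Cb)
      (ℕ.suc-injective (trans tot (trans sz (trans e (cong suc (sym len))))))
      (ℕ.≤-trans (ℕ.n≤1+n _) (ℕ.≤-trans (ℕ.≤-reflexive tot) le))
      where
      len : length (removeAt ws i) ≡ m
      len = trans (List.length-removeAt ws i) (cong pred e)
      tot : suc (total (dec C s)) ≡ total C
      tot = total-dec C s (λ z → ℕ.1+n≢0 (trans (sym o) z))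

private variable
  m : ℕ
  α β : Set

-- Counting Latin squares row by row

∑L : (α → ℕ) → List α → ℕ
∑L f []       = 0
∑L f (x ∷ xs) = f x + ∑L f xs

∑L-cong : {f g : α → ℕ} → (∀ x → f x ≡ g x) → ∀ xs → ∑L f xs ≡ ∑L g xs
∑L-cong h []       = refl
∑L-cong h (x ∷ xs) = cong₂ _+_ (h x) (∑L-cong h xs)

∑L-mono : {f g : α → ℕ} → (∀ x → f x ≤ g x) → ∀ xs → ∑L f xs ≤ ∑L g xs
∑L-mono h []       = z≤n
∑L-mono h (x ∷ xs) = ℕ.+-mono-≤ (h x) (∑L-mono h xs)

∑L-*ˡ : ∀ k (f : α → ℕ) xs → ∑L (λ x → k * f x) xs ≡ k * ∑L f xs
∑L-*ˡ k f []       = sym (ℕ.*-zeroʳ k)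
∑L-*ˡ k f (x ∷ xs) = trans (cong (k * f x +_) (∑L-*ˡ k f xs)) (sym (ℕ.*-distribˡ-+ k (f x) _))

∑L-+ : ∀ (f g : α → ℕ) xs → ∑L (λ x → f x + g x) xs ≡ ∑L f xs + ∑L g xs
∑L-+ f g []       = refl
∑L-+ f g (x ∷ xs) = trans (cong (f x + g x +_) (∑L-+ f g xs)) (r (f x) (g x) (∑L f xs) (∑L g xs))
  where
  r : ∀ a b c d → a + b + (c + d) ≡ a + c + (b + d)
  r = ℕ-Solver.solve-∀

∑L-zero : ∀ (xs : List α) → ∑L (λ _ → 0) xs ≡ 0
∑L-zero []       = refl
∑L-zero (x ∷ xs) = ∑L-zero xs

∑L-comm : ∀ (f : α → β → ℕ) xs ys → ∑L (λ x → ∑L (f x) ys) xs ≡ ∑L (λ y → ∑L (λ x → f x y) xs) ys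
∑L-comm f []       ys = sym (∑L-zero ys)
∑L-comm f (x ∷ xs) ys = trans (cong (∑L (f x) ys +_) (∑L-comm f xs ys)) (sym (∑L-+ (f x) (λ y → ∑L (λ x → f x y) xs) ys))

∑L-++ : ∀ (f : α → ℕ) xs ys → ∑L f (xs ++ ys) ≡ ∑L f xs + ∑L f ys
∑L-++ f []       ys = refl
∑L-++ f (x ∷ xs) ys = trans (cong (f x +_) (∑L-++ f xs ys)) (sym (ℕ.+-assoc (f x) _ _))

∑L-map : ∀ (f : β → ℕ) (h : α → β) xs → ∑L f (map h xs) ≡ ∑L (f ∘ h) xs
∑L-map f h []       = refl
∑L-map f h (x ∷ xs) = cong (f (h x) +_) (∑L-map f h xs)

∑L-concatMap : ∀ (f : β → ℕ) (h : α → List β) xs → ∑L f (concatMap h xs) ≡ ∑L (λ x → ∑L f (h x)) xs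
∑L-concatMap f h []       = refl
∑L-concatMap f h (x ∷ xs) = trans (∑L-++ f (h x) (concatMap h xs)) (cong (∑L f (h x) +_) (∑L-concatMap f h xs))

∑L-allVecs : ∀ (f : Vec α (suc m) → ℕ) xs → ∑L f (allVecs xs (suc m)) ≡ ∑L (λ x → ∑L (λ v → f (x ∷ v)) (allVecs xs m)) xs
∑L-allVecs {m = m} f xs = trans (∑L-concatMap f (λ x → map (x ∷_) (allVecs xs m)) xs) (∑L-cong (λ x → ∑L-map f (x ∷_) (allVecs xs m)) xs)

∑L-allFin : ∀ (f : Fin n → ℕ) → ∑L f (allFin n) ≡ ∑ f
∑L-allFin {n} f = go id f
  where
  go : ∀ {m} (h : Fin m → Fin n) (f : Fin n → ℕ) → ∑L f (List.tabulate h) ≡ ∑ (f ∘ h)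
  go {zero}  h f = refl
  go {suc m} h f = cong (f (h zero) +_) (go (h ∘ suc) f)

length-filter-≥ : ∀ {P : β → Set} (P? : Decidable P) (h : α → β) (g : α → ℕ) → (∀ x → g x ≤ 1) → (∀ x → g x ≢ 0 → P (h x)) →
  ∀ xs → ∑L g xs ≤ length (filter P? (map h xs))
length-filter-≥ P? h g g≤1 p []       = z≤n
length-filter-≥ P? h g g≤1 p (x ∷ xs) with P? (h x)
... | yes q = ℕ.+-mono-≤ (g≤1 x) (length-filter-≥ P? h g g≤1 p xs)
... | no ¬q with g x in eq
...   | zero  = length-filter-≥ P? h g g≤1 p xs
...   | suc _ = ⊥-elim (¬q (p x (λ z → ℕ.1+n≢0 (trans (sym eq) z))))

-- The indicator that the letters of r are distinct, when C is the all-ones vector.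
distinct : Vec (Fin n) m → Vec ℕ n → ℕ
distinct []      C = 1
distinct (s ∷ r) C = C [ s ] * distinct r (dec C s)

vals : Vec (Vec ℕ n) m → Vec (Fin n) m → ℕ
vals A r = ∏ (λ j → A [ j ] [ r [ j ] ])

-- Expanding along the first row chooses the first letter. Rows of A are thus positions of the word
-- and its columns are symbols, and the choices for the next row of a square are counted by a
-- permanent.
pm-∑ : ∀ (A : Vec (Vec ℕ n) m) C → ∑L (λ r → distinct r C * vals A r) (allVecs (allFin n) m) ≡ pm (toList A) C
pm-∑ []      C = refl
pm-∑ {n} {suc m} (w ∷ A) C = trans (∑L-allVecs (λ r → distinct r C * vals (w ∷ A) r) (allFin n))
  (trans (∑L-allFin (λ s → ∑L (λ v → distinct (s ∷ v) C * vals (w ∷ A) (s ∷ v)) (allVecs (allFin n) m))) (sum-cong-≗ (λ s →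
    trans (∑L-cong (λ v → c (C [ s ]) (distinct v (dec C s)) (w [ s ]) (vals A v)) (allVecs (allFin n) m))
    (trans (∑L-*ˡ (C [ s ] * w [ s ]) (λ v → distinct v (dec C s) * vals A v) (allVecs (allFin n) m))
           (cong (C [ s ] * w [ s ] *_) (pm-∑ A (dec C s)))))))
  where
  c : ∀ a b c d → a * b * (c * d) ≡ a * c * (b * d)
  c = ℕ-Solver.solve-∀

-- Row j of A marks the symbols that are still free in column j of the square; writing r as the next
-- row uses up one of them in every column.
_⊖_ : Vec (Vec ℕ n) m → Vec (Fin n) m → Vec (Vec ℕ n) m
_⊖_ = zipWith dec

lookup-⊖ : ∀ (A : Vec (Vec ℕ n) m) r j → (A ⊖ r) [ j ] ≡ dec (A [ j ]) (r [ j ])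
lookup-⊖ A r j = Vec.lookup-zipWith dec j A r

⊖-comm : ∀ (A : Vec (Vec ℕ n) m) r r′ → (A ⊖ r) ⊖ r′ ≡ (A ⊖ r′) ⊖ r
⊖-comm []      []      []        = refl
⊖-comm (w ∷ A) (s ∷ r) (s′ ∷ r′) = cong₂ _∷_ (dec-comm w s s′) (⊖-comm A r r′)

vals-comm : ∀ (A : Vec (Vec ℕ n) m) r r′ → vals A r * vals (A ⊖ r) r′ ≡ vals A r′ * vals (A ⊖ r′) r
vals-comm []      []      []        = refl
vals-comm (w ∷ A) (s ∷ r) (s′ ∷ r′) = trans (c (w [ s ]) (vals A r) (dec w s [ s′ ]) _)
  (trans (cong₂ _*_ (falling-comm w s s′) (vals-comm A r r′)) (sym (c (w [ s′ ]) (vals A r′) (dec w s′ [ s ]) _)))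
  where
  c : ∀ a b c d → a * b * (c * d) ≡ a * c * (b * d)
  c = ℕ-Solver.solve-∀

∏-zero⁻ : {f : Fin n → ℕ} → ∏ f ≢ 0 → ∀ i → f i ≢ 0
∏-zero⁻ {f = f} h zero    e = h (cong (_* ∏ (f ∘ suc)) e)
∏-zero⁻ {f = f} h (suc i) e = ∏-zero⁻ {f = f ∘ suc} (λ z → h (trans (cong (f zero *_) z) (ℕ.*-zeroʳ (f zero)))) i e

∏≤1 : {f : Fin n → ℕ} → (∀ i → f i ≤ 1) → ∏ f ≤ 1
∏≤1 {zero}  h = s≤s z≤n
∏≤1 {suc n} h = ℕ.*-mono-≤ (h zero) (∏≤1 (h ∘ suc))

∏≥1 : {f : Fin n → ℕ} → (∀ i → 1 ≤ f i) → 1 ≤ ∏ f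
∏≥1 = ∏-pos

injective⇒bijective : (f : Fin n → Fin n) → (∀ x y → f x ≡ f y → x ≡ y) → Bijective _≡_ _≡_ f
injective⇒bijective {n} f inj = (λ {x} {y} → inj x y) , surj
  where
  surj : ∀ y → ∃[ x ] (∀ {z} → z ≡ x → f z ≡ y)
  surj y with any? (λ x → f x ≟ y)
  ... | yes (x , e) = x , λ { refl → e }
  surj y | no ¬e = ⊥-elim (contra f inj y ¬e)
    where
    contra : ∀ {n} (f : Fin n → Fin n) → (∀ x y → f x ≡ f y → x ≡ y) → ∀ y → ¬ (∃[ x ] f x ≡ y) → _
    contra {suc n} f inj y ¬e = ℕ.1+n≰n (injective⇒≤ {f = λ x → punchOut {i = y} {j = f x} (λ e → ¬e (x , sym e))}
      (λ {a} {b} e → inj a b (punchOut-injective (λ e → ¬e (a , sym e)) (λ e → ¬e (b , sym e)) e)))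

distinct≢0⇒C≢0 : ∀ (r : Vec (Fin n) m) C → distinct r C ≢ 0 → ∀ k → C [ r [ k ] ] ≢ 0
distinct≢0⇒C≢0 (s ∷ r) C h zero    e = h (cong (_* distinct r (dec C s)) e)
distinct≢0⇒C≢0 (s ∷ r) C h (suc k) e = distinct≢0⇒C≢0 r (dec C s)
  (λ z → h (trans (cong (C [ s ] *_) z) (ℕ.*-zeroʳ (C [ s ])))) k
  (dec≤ (r [ k ]))
  where
  dec≤ : ∀ t → dec C s [ r [ k ] ] ≡ 0
  dec≤ _ with r [ k ] ≟ s
  ... | yes q = trans (cong (dec C s [_]) q) (trans (lookup-dec C s) (cong pred (trans (cong (C [_]) (sym q)) e)))
  ... | no q  = trans (lookup-dec′ C q) e

distinct⇒injective : ∀ (r : Vec (Fin n) m) C → Bitsᶠ C → distinct r C ≢ 0 → ∀ k l → r [ k ] ≡ r [ l ] → k ≡ l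
distinct⇒injective (s ∷ r) C b h = inj
  where
  h′ : distinct r (dec C s) ≢ 0
  h′ z = h (trans (cong (C [ s ] *_) z) (ℕ.*-zeroʳ (C [ s ])))
  C′s : dec C s [ s ] ≡ 0
  C′s = trans (lookup-dec C s) (ℕ.n≤0⇒n≡0 (ℕ.pred-mono-≤ (b s)))
  inj : ∀ k l → (s ∷ r) [ k ] ≡ (s ∷ r) [ l ] → k ≡ l
  inj zero    zero    e = refl
  inj zero    (suc l) e = ⊥-elim (distinct≢0⇒C≢0 r (dec C s) h′ l (trans (cong (dec C s [_]) (sym e)) C′s))
  inj (suc k) zero    e = ⊥-elim (distinct≢0⇒C≢0 r (dec C s) h′ k (trans (cong (dec C s [_]) e) C′s))
  inj (suc k) (suc l) e = cong suc (distinct⇒injective r (dec C s) (dec-bits C s b) h′ k l e)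

injective⇒distinct : ∀ (r : Vec (Fin n) m) C → (∀ k → C [ r [ k ] ] ≡ 1) → (∀ k l → r [ k ] ≡ r [ l ] → k ≡ l) → distinct r C ≡ 1
injective⇒distinct []      C h inj = refl
injective⇒distinct (s ∷ r) C h inj = trans (cong₂ _*_ (h zero) (injective⇒distinct r (dec C s)
  (λ k → trans (lookup-dec′ C (λ e → 0≢suc (inj zero (suc k) (sym e)))) (h (suc k)))
  (λ k l e → suc-inj (inj (suc k) (suc l) e)))) refl
  where
  0≢suc : ∀ {m} {k : Fin m} → Fin.zero ≢ suc k
  0≢suc ()
  suc-inj : ∀ {m} {k l : Fin m} → Fin.suc k ≡ suc l → k ≡ l
  suc-inj refl = refl

distinct≤1 : ∀ (r : Vec (Fin n) m) C → Bitsᶠ C → distinct r C ≤ 1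
distinct≤1 []      C b = s≤s z≤n
distinct≤1 (s ∷ r) C b = ℕ.*-mono-≤ (b s) (distinct≤1 r (dec C s) (dec-bits C s b))

𝟏 : Vec ℕ n
𝟏 = replicate _ 1

lookup-𝟏 : (s : Fin n) → 𝟏 [ s ] ≡ 1
lookup-𝟏 s = Vec.lookup-replicate s 1

bits-𝟏 : Bitsᶠ (𝟏 {n})
bits-𝟏 s = ℕ.≤-reflexive (lookup-𝟏 s)

-- Completing a partial square by rows that avoid a box

module Box {n : ℕ} (Y Z : Subset n) where

  -- Row types: true for the rows of the box, which must avoid Z on Y.
  allowed : Bool → Bool → Fin n → ℕ
  allowed t y s = if t ∧ y ∧ Z [ s ] then 0 else 1

  allowed≤1 : ∀ t y s → allowed t y s ≤ 1
  allowed≤1 t y s with t ∧ y ∧ Z [ s ]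
  ... | true  = z≤n
  ... | false = s≤s z≤n

  avoid : Bool → Vec (Fin n) n → ℕ
  avoid t r = ∏ (λ j → allowed t (Y [ j ]) (r [ j ]))

  weight : Bool → Vec (Vec ℕ n) n → Vec (Fin n) n → ℕ
  weight t A r = distinct r 𝟏 * (vals A r * avoid t r)

  -- Moves the avoidance condition from the words into the matrix, so that the admissible rows are
  -- again counted by a permanent.
  mask : Bool → Vec (Vec ℕ n) n → Vec (Vec ℕ n) n
  mask t A = Vec.tabulate (λ j → Vec.tabulate (λ s → A [ j ] [ s ] * allowed t (Y [ j ]) s))

  lookup-mask : ∀ t A j s → mask t A [ j ] [ s ] ≡ A [ j ] [ s ] * allowed t (Y [ j ]) s
  lookup-mask t A j s = trans (cong (_[ s ]) (Vec.lookup∘tabulate (λ j → Vec.tabulate (λ s → A [ j ] [ s ] * allowed t (Y [ j ]) s)) j))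
    (Vec.lookup∘tabulate (λ s → A [ j ] [ s ] * allowed t (Y [ j ]) s) s)

  words : List (Vec (Fin n) n)
  words = allVecs (allFin n) n

  ∑-weight : ∀ t A → ∑L (weight t A) words ≡ pm (toList (mask t A)) 𝟏
  ∑-weight t A = trans (∑L-cong (λ r → cong (distinct r 𝟏 *_) (trans (sym (∏-distrib-* (λ j → A [ j ] [ r [ j ] ]) _))
    (∏-cong (λ j → sym (lookup-mask t A j (r [ j ])))))) words) (pm-∑ (mask t A) 𝟏)

  -- The matrix of free symbols is all that the later rows need to know about the earlier ones.
  completions : List Bool → Vec (Vec ℕ n) n → ℕ
  completions []      A = 1
  completions (t ∷ p) A = ∑L (λ r → weight t A r * completions p (A ⊖ r)) words

  -- Two adjacent rows use up the same symbols in either order, and the avoidance factors travel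
  -- with their rows. This allows the rows of the box to be moved to the front.
  completions-swap : ∀ t t′ p A → completions (t ∷ t′ ∷ p) A ≡ completions (t′ ∷ t ∷ p) A
  completions-swap t t′ p A = begin
    ∑L (λ r → weight t A r * ∑L (λ r′ → weight t′ (A ⊖ r) r′ * completions p ((A ⊖ r) ⊖ r′)) words) words
      ≡⟨ ∑L-cong (λ r → sym (∑L-*ˡ (weight t A r) (λ r′ → weight t′ (A ⊖ r) r′ * completions p ((A ⊖ r) ⊖ r′)) words)) words ⟩
    ∑L (λ r → ∑L (λ r′ → weight t A r * (weight t′ (A ⊖ r) r′ * completions p ((A ⊖ r) ⊖ r′))) words) words
      ≡⟨ ∑L-comm (λ r r′ → weight t A r * (weight t′ (A ⊖ r) r′ * completions p ((A ⊖ r) ⊖ r′))) words words ⟩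
    ∑L (λ r′ → ∑L (λ r → weight t A r * (weight t′ (A ⊖ r) r′ * completions p ((A ⊖ r) ⊖ r′))) words) words
      ≡⟨ ∑L-cong (λ r′ → ∑L-cong (λ r → term r r′) words) words ⟩
    ∑L (λ r′ → ∑L (λ r → weight t′ A r′ * (weight t (A ⊖ r′) r * completions p ((A ⊖ r′) ⊖ r))) words) words
      ≡⟨ ∑L-cong (λ r′ → ∑L-*ˡ (weight t′ A r′) (λ r → weight t (A ⊖ r′) r * completions p ((A ⊖ r′) ⊖ r)) words) words ⟩
    ∑L (λ r′ → weight t′ A r′ * ∑L (λ r → weight t (A ⊖ r′) r * completions p ((A ⊖ r′) ⊖ r)) words) words ∎
    where
    open ≡-Reasoning
    c₁ : ∀ d v a d′ v′ a′ x → d * (v * a) * (d′ * (v′ * a′) * x) ≡ d * d′ * (a * a′) * ((v * v′) * x)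
    c₁ = ℕ-Solver.solve-∀
    c₂ : ∀ d v a d′ v′ a′ x → d′ * d * (a′ * a) * ((v * v′) * x) ≡ d * (v * a) * (d′ * (v′ * a′) * x)
    c₂ = ℕ-Solver.solve-∀
    term : ∀ r r′ → weight t A r * (weight t′ (A ⊖ r) r′ * completions p ((A ⊖ r) ⊖ r′)) ≡
                    weight t′ A r′ * (weight t (A ⊖ r′) r * completions p ((A ⊖ r′) ⊖ r))
    term r r′ = trans (c₁ (distinct r 𝟏) (vals A r) (avoid t r) (distinct r′ 𝟏) (vals (A ⊖ r) r′) (avoid t′ r′) _)
      (trans (cong₂ (λ a b → distinct r 𝟏 * distinct r′ 𝟏 * (avoid t r * avoid t′ r′) * (a * completions p b)) (vals-comm A r r′) (⊖-comm A r r′))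
             (c₂ (distinct r′ 𝟏) (vals A r′) (avoid t′ r′) (distinct r 𝟏) (vals (A ⊖ r′) r) (avoid t r) _))

  completions-↭ : ∀ {p q} → p ↭ q → ∀ A → completions p A ≡ completions q A
  completions-↭ Perm.refl        A = refl
  completions-↭ (Perm.prep t h)  A = ∑L-cong (λ r → cong (weight t A r *_) (completions-↭ h (A ⊖ r))) words
  completions-↭ (Perm.swap {xs = p} t t′ h) A = trans (completions-swap t t′ p A)
    (∑L-cong (λ r → cong (weight t′ A r *_) (∑L-cong (λ r′ → cong (weight t (A ⊖ r) r′ *_) (completions-↭ h ((A ⊖ r) ⊖ r′))) words)) words)
  completions-↭ (Perm.trans h h′) A = trans (completions-↭ h A) (completions-↭ h′ A)

  squareWeight : Vec Bool m → Vec (Vec (Fin n) n) m → Vec (Vec ℕ n) n → ℕ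
  squareWeight []      []      A = 1
  squareWeight (t ∷ p) (r ∷ v) A = weight t A r * squareWeight p v (A ⊖ r)

  ∑-squareWeight : ∀ (p : Vec Bool m) A → ∑L (λ v → squareWeight p v A) (allVecs words m) ≡ completions (toList p) A
  ∑-squareWeight []      A = refl
  ∑-squareWeight {suc m} (t ∷ p) A = trans (∑L-allVecs (λ v → squareWeight (t ∷ p) v A) words)
    (∑L-cong (λ r → trans (∑L-*ˡ (weight t A r) (λ v → squareWeight p v (A ⊖ r)) (allVecs words m))
      (cong (weight t A r *_) (∑-squareWeight p (A ⊖ r)))) words)

  column : Vec (Vec (Fin n) n) m → Fin n → Vec (Fin n) m
  column v j = Vec.map (_[ j ]) v

  -- Asking in every row for symbols that are still free amounts, regrouped by columns, to asking
  -- for distinct letters in every column.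
  squareWeight-split : ∀ (p : Vec Bool m) v A → squareWeight p v A ≡
    ∏ (λ i → distinct (v [ i ]) 𝟏) * ∏ (λ i → avoid (p [ i ]) (v [ i ])) * ∏ (λ j → distinct (column v j) (A [ j ]))
  squareWeight-split []      []      A = sym (trans (ℕ.+-identityʳ _) (∏-replicate-one n))
  squareWeight-split (t ∷ p) (r ∷ v) A = begin
    distinct r 𝟏 * (vals A r * avoid t r) * squareWeight p v (A ⊖ r)
      ≡⟨ cong (distinct r 𝟏 * (vals A r * avoid t r) *_) (squareWeight-split p v (A ⊖ r)) ⟩
    distinct r 𝟏 * (vals A r * avoid t r) * (X * W * ∏ (λ j → distinct (column v j) ((A ⊖ r) [ j ])))
      ≡⟨ c (distinct r 𝟏) (vals A r) (avoid t r) X W _ ⟩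
    (distinct r 𝟏 * X) * (avoid t r * W) * (vals A r * ∏ (λ j → distinct (column v j) ((A ⊖ r) [ j ])))
      ≡⟨ cong ((distinct r 𝟏 * X) * (avoid t r * W) *_) (trans (sym (∏-distrib-* (λ j → A [ j ] [ r [ j ] ]) _))
           (∏-cong (λ j → cong (λ z → A [ j ] [ r [ j ] ] * distinct (column v j) z) (lookup-⊖ A r j)))) ⟩
    (distinct r 𝟏 * X) * (avoid t r * W) * ∏ (λ j → distinct (column (r ∷ v) j) (A [ j ])) ∎
    where
    open ≡-Reasoning
    X = ∏ (λ i → distinct (v [ i ]) 𝟏)
    W = ∏ (λ i → avoid (p [ i ]) (v [ i ]))
    c : ∀ d v a x w y → d * (v * a) * (x * w * y) ≡ d * x * (a * w) * (v * y)
    c = ℕ-Solver.solve-∀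

  𝟙 : Vec (Vec ℕ n) n
  𝟙 = replicate n 𝟏

  lookup-𝟙 : ∀ j → 𝟙 [ j ] ≡ 𝟏
  lookup-𝟙 j = Vec.lookup-replicate j 𝟏

  grid : Vec (Vec (Fin n) n) n → Grid n
  grid v i j = lookup (lookup v i) j

  lookup-column : ∀ (v : Vec (Vec (Fin n) n) m) j i → column v j [ i ] ≡ v [ i ] [ j ]
  lookup-column v j i = Vec.lookup-map i (_[ j ]) v

  squareWeight≤1 : ∀ (p : Vec Bool n) v → squareWeight p v 𝟙 ≤ 1
  squareWeight≤1 p v = ℕ.≤-trans (ℕ.≤-reflexive (squareWeight-split p v 𝟙)) (ℕ.*-mono-≤ (ℕ.*-mono-≤
    (∏≤1 (λ i → distinct≤1 (v [ i ]) 𝟏 bits-𝟏)) (∏≤1 (λ i → ∏≤1 (λ j → allowed≤1 (p [ i ]) (Y [ j ]) (v [ i ] [ j ])))))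
    (∏≤1 (λ j → ℕ.≤-trans (ℕ.≤-reflexive (cong (distinct (column v j)) (lookup-𝟙 j))) (distinct≤1 (column v j) 𝟏 bits-𝟏))))

  squareWeight⇒Latin : ∀ (p : Vec Bool n) v → squareWeight p v 𝟙 ≢ 0 → IsLatin (grid v)
  squareWeight⇒Latin p v h = rowsOK , colsOK
    where
    h′ : ∏ (λ i → distinct (v [ i ]) 𝟏) * ∏ (λ i → avoid (p [ i ]) (v [ i ])) * ∏ (λ j → distinct (column v j) (𝟙 [ j ])) ≢ 0
    h′ z = h (trans (squareWeight-split p v 𝟙) z)
    rowsOK : ∀ i → Bijective _≡_ _≡_ (λ j → grid v i j)
    rowsOK i = injective⇒bijective _ (distinct⇒injective (v [ i ]) 𝟏 bits-𝟏
      (∏-zero⁻ {f = λ i → distinct (v [ i ]) 𝟏} (λ z → h′ (trans (cong (λ x → x * ∏ (λ i → avoid (p [ i ]) (v [ i ])) * ∏ (λ j → distinct (column v j) (𝟙 [ j ]))) z) refl)) i))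
    colsOK : ∀ j → Bijective _≡_ _≡_ (λ i → grid v i j)
    colsOK j = injective⇒bijective _ (λ k l e → distinct⇒injective (column v j) 𝟏 bits-𝟏
      (λ z → ∏-zero⁻ {f = λ j → distinct (column v j) (𝟙 [ j ])} (λ z → h′ (trans (cong (∏ (λ i → distinct (v [ i ]) 𝟏) * ∏ (λ i → avoid (p [ i ]) (v [ i ])) *_) z) (ℕ.*-zeroʳ (∏ (λ i → distinct (v [ i ]) 𝟏) * ∏ (λ i → avoid (p [ i ]) (v [ i ])))))) j
        (trans (cong (distinct (column v j)) (lookup-𝟙 j)) z)) k l
      (trans (lookup-column v j k) (trans e (sym (lookup-column v j l)))))

  Latin⇒squareWeight : ∀ (X : Subset n) v → IsLatin (grid v) → IsEmptyBox (grid v) X Y Z → 1 ≤ squareWeight X v 𝟙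
  Latin⇒squareWeight X v (rw , cl) emp = ℕ.≤-trans (ℕ.*-mono-≤ (ℕ.*-mono-≤
    (∏≥1 (λ i → ℕ.≤-reflexive (sym (injective⇒distinct (v [ i ]) 𝟏 (λ k → lookup-𝟏 (v [ i ] [ k ])) (λ k l e → proj₁ (rw i) e)))))
    (∏≥1 (λ i → ∏≥1 (λ j → ok i j))))
    (∏≥1 (λ j → ℕ.≤-reflexive (sym (trans (cong (distinct (column v j)) (lookup-𝟙 j))
      (injective⇒distinct (column v j) 𝟏 (λ k → lookup-𝟏 (column v j [ k ]))
        (λ k l e → proj₁ (cl j) (trans (sym (lookup-column v j k)) (trans e (lookup-column v j l))))))))))
    (ℕ.≤-reflexive (sym (squareWeight-split X v 𝟙)))
    where
    ok : ∀ i j → 1 ≤ allowed (X [ i ]) (Y [ j ]) (v [ i ] [ j ])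
    ok i j with X [ i ] in eX | Y [ j ] in eY | Z [ v [ i ] [ j ] ] in eZ
    ... | true  | true  | true  = ⊥-elim (emp i j (Vec.lookup⇒[]= i X eX) (Vec.lookup⇒[]= j Y eY) (Vec.lookup⇒[]= (v [ i ] [ j ]) Z eZ))
    ... | true  | true  | false = s≤s z≤n
    ... | true  | false | _     = s≤s z≤n
    ... | false | _     | _     = s≤s z≤n

vec-ext : ∀ {A : Set} {xs ys : Vec A m} → (∀ i → xs [ i ] ≡ ys [ i ]) → xs ≡ ys
vec-ext {xs = xs} {ys} h = trans (sym (Vec.tabulate∘lookup xs)) (trans (Vec.tabulate-cong h) (Vec.tabulate∘lookup ys))

-- Regular matrices of free symbols

record RegularMatrix (d : ℕ) (A : Vec (Vec ℕ n) n) : Set where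
  field
    bits : ∀ j → Bitsᶠ (A [ j ])
    rowSums : ∀ j → total (A [ j ]) ≡ d
    columns : ∀ s → ∑ (λ j → A [ j ] [ s ]) ≡ d

∑-one : ∀ n → ∑ {n} (λ _ → 1) ≡ n
∑-one zero    = refl
∑-one (suc n) = cong suc (∑-one n)

injective⇒∑δ : ∀ (r : Vec (Fin n) n) → (∀ k l → r [ k ] ≡ r [ l ] → k ≡ l) → ∀ s → ∑ (λ j → δ (r [ j ]) s) ≡ 1
injective⇒∑δ r inj s with proj₂ (injective⇒bijective (r [_]) inj) s
... | j₀ , p = trans (sum-cong-≗ (λ j → trans (same j) (sym (ℕ.*-identityʳ (δ j j₀))))) (∑-δ j₀ (λ _ → 1))
  where
  rj₀ : r [ j₀ ] ≡ s
  rj₀ = p refl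
  same : ∀ j → δ (r [ j ]) s ≡ δ j j₀
  same j with j ≟ j₀
  ... | yes refl = trans (cong (λ z → δ z s) rj₀) (δ-refl s)
  ... | no j≢    = δ-≢ (λ e → j≢ (inj j j₀ (trans e (sym rj₀))))

lookup-total : (C : Vec ℕ n) (s : Fin n) → C [ s ] ≢ 0 → Bitsᶠ C → ∀ t → C [ t ] ≡ δ s t + dec C s [ t ]
lookup-total C s nz b t with s ≟ t
... | yes refl = trans Cs (cong suc (sym (trans (lookup-dec C s) (cong pred Cs))))
  where
  Cs : C [ s ] ≡ 1
  Cs with bit (b s)
  ... | inj₁ z = ⊥-elim (nz z)
  ... | inj₂ o = o
... | no s≢t = sym (lookup-dec′ C (λ e → s≢t (sym e)))

∣∣≡∑ : (Z : Subset n) → ∣ Z ∣ ≡ ∑ (λ s → if Z [ s ] then 1 else 0)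
∣∣≡∑ []          = refl
∣∣≡∑ (true  ∷ Z) = cong suc (∣∣≡∑ Z)
∣∣≡∑ (false ∷ Z) = ∣∣≡∑ Z

sort-↭ : (X : Vec Bool n) → ∃[ m ] (∣ X ∣ + m ≡ n × toList X ↭ List.replicate ∣ X ∣ true ++ List.replicate m false)
sort-↭ []          = 0 , refl , Perm.refl
sort-↭ (true  ∷ X) with sort-↭ X
... | m , e , p = m , cong suc e , Perm.prep true p
sort-↭ (false ∷ X) with sort-↭ X
... | m , e , p = suc m , trans (ℕ.+-suc ∣ X ∣ m) (cong suc e) , Perm.trans (Perm.prep false p) (move ∣ X ∣)
  where
  move : ∀ a → false ∷ (List.replicate a true ++ List.replicate m false) ↭ List.replicate a true ++ (false ∷ List.replicate m false)
  move zero    = Perm.refl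
  move (suc a) = Perm.trans (Perm.swap false true Perm.refl) (Perm.prep true (move a))

toList≡tabulate : ∀ {A : Set} (xs : Vec A m) → toList xs ≡ List.tabulate (lookup xs)
toList≡tabulate []       = refl
toList≡tabulate (x ∷ xs) = cong (x ∷_) (toList≡tabulate xs)

lookup-sumV : ∀ (f : Fin m → Vec ℕ n) s → sumV (List.tabulate f) [ s ] ≡ ∑ (λ i → f i [ s ])
lookup-sumV {zero}  f s = lookup-𝟎 s
lookup-sumV {suc m} f s = trans (Vec.lookup-zipWith _+_ s (f zero) (sumV (List.tabulate (f ∘ suc)))) (cong (f zero [ s ] +_) (lookup-sumV (f ∘ suc) s))

lookup-unit : ∀ (i s : Fin n) → inc 𝟎 i [ s ] ≡ δ i s
lookup-unit i s with i ≟ s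
... | yes refl = trans (lookup-inc 𝟎 i) (cong suc (lookup-𝟎 i))
... | no i≢s   = trans (Vec.lookup∘updateAt′ s i (λ e → i≢s (sym e)) 𝟎) (lookup-𝟎 s)

allV : ∀ {A : Set} {P : A → Set} (xs : Vec A m) → (∀ i → P (xs [ i ])) → AllV P xs
allV []       h = []
allV (x ∷ xs) h = h zero ∷ allV xs (h ∘ suc)

-- The permutation matrix required by `Regular` is taken to be the identity.
pm-lower′ : ∀ {d} {A : Vec (Vec ℕ n) n} → RegularMatrix d A → 0 < d →
  (d !) ^ n ≤ 2 * (4 * d) ^ n * (2 * pm (toList A) 𝟏) ^ d
pm-lower′ {n} {d} {A} R d>0 = subst (λ z → (d !) ^ n ≤ 2 * (4 * d) ^ n * (2 * pm z 𝟏) ^ d) m₁ (pm-lower reg d>0)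
  where
  open RegularMatrix R
  pair : Fin n → Pair n
  pair i = A [ i ] , inc 𝟎 i
  L = List.tabulate pair
  m₁ : map proj₁ L ≡ toList A
  m₁ = trans (List.map-tabulate pair proj₁) (sym (toList≡tabulate A))
  δ≤1 : ∀ (i s : Fin n) → δ i s ≤ 1
  δ≤1 i s with does (i ≟ s)
  ... | true  = s≤s z≤n
  ... | false = z≤n
  reg : Regular d L
  reg = record
    { size = List.length-tabulate pair
    ; bits = All.tabulate⁺ {f = pair} (λ i → allV (A [ i ]) (bits i) , allV (inc 𝟎 i) (λ s → ℕ.≤-trans (ℕ.≤-reflexive (lookup-unit i s)) (δ≤1 i s)))
    ; rowsˡ = All.tabulate⁺ {f = pair} rowSums
    ; rowsʳ = All.tabulate⁺ {f = pair} (λ i → trans (total-inc 𝟎 i) (cong suc (total-𝟎 {n})))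
    ; columnsˡ = vec-ext (λ s → trans (cong (λ z → sumV z [ s ]) (List.map-tabulate pair proj₁)) (trans (lookup-sumV (lookup A) s) (trans (columns s) (sym (Vec.lookup-replicate s d)))))
    ; columnsʳ = vec-ext (λ s → trans (cong (λ z → sumV z [ s ]) (List.map-tabulate pair proj₂)) (trans (lookup-sumV (inc 𝟎) s)
        (trans (trans (sum-cong-≗ (λ i → trans (lookup-unit i s) (sym (ℕ.*-identityʳ (δ i s))))) (∑-δ s (λ _ → 1))) (sym (Vec.lookup-replicate s 1)))))
    }

-- Bounds for weighted sums and the growth of Brègman's factors

-- The bound (B/K)^(1/e) for the values of x need not be an integer; a number M that satisfies the
-- same inequality and majorises the values replaces it.
weighted-max : ∀ {A : Set} (w x : A → ℕ) e K B → 0 < e → (∀ r → w r ≢ 0 → x r ^ e * K ≤ B) →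
  ∀ rs → ∑L (λ r → w r * x r) rs ^ e * K ≤ ∑L w rs ^ e * B
weighted-max {A} w x e K B e>0 h rs = concl (go rs)
  where
  open ℕ.≤-Reasoning
  go : ∀ rs → ∃[ M ] (M ^ e * K ≤ B × ∑L (λ r → w r * x r) rs ≤ ∑L w rs * M)
  go [] = 0 , ℕ.≤-trans (ℕ.≤-reflexive (cong (_* K) (0^n≡0 e>0))) z≤n , z≤n
  go (r ∷ rs) with go rs | w r ℕ.≟ 0
  ... | M , p , q | yes z = M , p , ℕ.≤-trans (ℕ.≤-reflexive (cong (λ a → a * x r + ∑L (λ r → w r * x r) rs) z)) (ℕ.≤-trans q (ℕ.*-monoˡ-≤ M (ℕ.m≤n+m _ (w r))))
  ... | M , p , q | no nz with ℕ.≤-total M (x r)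
  ...   | inj₁ M≤x = x r , h r nz , ℕ.≤-trans (ℕ.+-monoʳ-≤ (w r * x r) (ℕ.≤-trans q (ℕ.*-monoʳ-≤ (∑L w rs) M≤x))) (ℕ.≤-reflexive (sym (ℕ.*-distribʳ-+ (x r) (w r) _)))
  ...   | inj₂ x≤M = M , p , ℕ.≤-trans (ℕ.+-mono-≤ (ℕ.*-monoʳ-≤ (w r) x≤M) q) (ℕ.≤-reflexive (sym (ℕ.*-distribʳ-+ M (w r) _)))
  concl : ∃[ M ] (M ^ e * K ≤ B × ∑L (λ r → w r * x r) rs ≤ ∑L w rs * M) → ∑L (λ r → w r * x r) rs ^ e * K ≤ ∑L w rs ^ e * B
  concl (M , p , q) = begin
    ∑L (λ r → w r * x r) rs ^ e * K   ≤⟨ ℕ.*-monoˡ-≤ K (ℕ.^-monoˡ-≤ e q) ⟩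
    (∑L w rs * M) ^ e * K             ≡⟨ trans (cong (_* K) (^-distrib-* (∑L w rs) M e)) (ℕ.*-assoc (∑L w rs ^ e) _ K) ⟩
    ∑L w rs ^ e * (M ^ e * K)         ≤⟨ ℕ.*-monoʳ-≤ (∑L w rs ^ e) p ⟩
    ∑L w rs ^ e * B ∎

weighted-min : ∀ {A : Set} (w x : A → ℕ) e K B → 0 < e → 0 < K → (∀ r → w r ≢ 0 → B ≤ x r ^ e * K) →
  ∀ rs → ∑L w rs ^ e * B ≤ ∑L (λ r → w r * x r) rs ^ e * K
weighted-min {A} w x e K B e>0 K>0 h rs = concl (go rs)
  where
  open ℕ.≤-Reasoning
  base : ∀ b {e} → 0 < e → b ≤ b ^ e * K
  base zero            _ = z≤n
  base (suc b) {suc e} _ = ℕ.≤-trans (ℕ.m≤m*n (suc b) (suc b ^ e) {{ℕ.m^n≢0 (suc b) e}}) (ℕ.m≤m*n _ K {{>-nonZero K>0}})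
  go : ∀ rs → ∃[ M ] (B ≤ M ^ e * K × ∑L w rs * M ≤ ∑L (λ r → w r * x r) rs)
  -- With no value to choose from, M = B qualifies, as B ≤ B^e K for positive e and K.
  go [] = B , base B e>0 , z≤n
  go (r ∷ rs) with go rs | w r ℕ.≟ 0
  ... | M , p , q | yes z = M , p , ℕ.≤-trans (ℕ.≤-reflexive (cong (λ a → (a + ∑L w rs) * M) z)) (ℕ.≤-trans q (ℕ.m≤n+m _ (w r * x r)))
  ... | M , p , q | no nz with ℕ.≤-total M (x r)
  ...   | inj₁ M≤x = M , p , ℕ.≤-trans (ℕ.≤-reflexive (ℕ.*-distribʳ-+ M (w r) _)) (ℕ.+-mono-≤ (ℕ.*-monoʳ-≤ (w r) M≤x) q)
  ...   | inj₂ x≤M = x r , h r nz , ℕ.≤-trans (ℕ.≤-reflexive (ℕ.*-distribʳ-+ (x r) (w r) _)) (ℕ.+-monoʳ-≤ (w r * x r) (ℕ.≤-trans (ℕ.*-monoʳ-≤ (∑L w rs) x≤M) q))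
  concl : ∃[ M ] (B ≤ M ^ e * K × ∑L w rs * M ≤ ∑L (λ r → w r * x r) rs) → ∑L w rs ^ e * B ≤ ∑L (λ r → w r * x r) rs ^ e * K
  concl (M , p , q) = begin
    ∑L w rs ^ e * B                   ≤⟨ ℕ.*-monoʳ-≤ (∑L w rs ^ e) p ⟩
    ∑L w rs ^ e * (M ^ e * K)         ≡⟨ sym (trans (cong (_* K) (^-distrib-* (∑L w rs) M e)) (ℕ.*-assoc (∑L w rs ^ e) _ K)) ⟩
    (∑L w rs * M) ^ e * K             ≤⟨ ℕ.*-monoˡ-≤ K (ℕ.^-monoˡ-≤ e q) ⟩
    ∑L (λ r → w r * x r) rs ^ e * K ∎

2k^k≤[1+k]^k : ∀ k → 0 < k → 2 * k ^ k ≤ suc k ^ k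
2k^k≤[1+k]^k k@(suc m) _ = ℕ.+-cancelʳ-≤ (m * k ^ k) _ _ (ℕ.≤-trans (ℕ.≤-reflexive (r m (k ^ m))) (tangent m (suc k) k))
  where
  r : ∀ m x → 2 * (suc m * x) + m * (suc m * x) ≡ suc m * (suc (suc m) * x)
  r = ℕ-Solver.solve-∀

-- The step is (1 + 1/k)^k ≥ 2 for k = d + 1. In roots it reads 2 (d!)^(1/d) ≤ d + 1, which is the
-- source of the factor 2 saved per forbidden symbol.
2^d*d!≤[1+d]^d : ∀ d → 2 ^ d * d ! ≤ suc d ^ d
2^d*d!≤[1+d]^d zero    = s≤s z≤n
2^d*d!≤[1+d]^d (suc d) = begin
  2 ^ suc d * (suc d * d !)    ≡⟨ r (2 ^ d) (suc d) (d !) ⟩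
  2 * (suc d * (2 ^ d * d !))  ≤⟨ ℕ.*-monoʳ-≤ 2 (ℕ.*-monoʳ-≤ (suc d) (2^d*d!≤[1+d]^d d)) ⟩
  2 * suc d ^ suc d            ≤⟨ 2k^k≤[1+k]^k (suc d) (s≤s z≤n) ⟩
  suc (suc d) ^ suc d ∎
  where
  open ℕ.≤-Reasoning
  r : ∀ a b c → 2 * a * (b * c) ≡ 2 * (b * (a * c))
  r = ℕ-Solver.solve-∀

-- f d = (d!)^(D/d), the D-th power of Brègman's row factor (d!)^(1/d).
module Factors (n : ℕ) (n>0 : 0 < n) where

  D : ℕ
  D = n !

  D>0 : 0 < D
  D>0 = ℕ.1≤n! n

  f : ℕ → ℕ
  f zero    = 1
  f (suc d) = (suc d !) ^ (D / suc d)

  f>0 : ∀ d → 0 < f d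
  f>0 zero    = s≤s z≤n
  f>0 (suc d) = ^-pos (D / suc d) (ℕ.1≤n! (suc d))

  div : ∀ d → suc d ≤ n → D / suc d * suc d ≡ D
  div d h = ℕ.m/n*n≡m (ℕ.∣-trans (ℕ.m∣m*n (d !)) (ℕ.m≤n⇒m!∣n! h))

  f^ : ∀ d → d ≤ n → f d ^ d ≡ (d !) ^ D
  f^ zero    h = sym (ℕ.^-zeroˡ D)
  f^ (suc d) h = trans (ℕ.^-*-assoc (suc d !) (D / suc d) (suc d)) (cong ((suc d !) ^_) (div d h))

  f-step : ∀ d → d < n → f (suc d) ^ suc d ≡ suc d ^ D * f d ^ d
  f-step d h = trans (f^ (suc d) h) (trans (^-distrib-* (suc d) (d !) D) (cong (suc d ^ D *_) (sym (f^ d (ℕ.<⇒≤ h)))))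

  -- A zero row makes the permanent vanish.
  f₀ : ℕ → ℕ
  f₀ zero    = 0
  f₀ (suc d) = f (suc d)

  -- Of the n factors, d + 1 yield 2^D, because 2^D f(d) ≤ (d + 1)^D and `f-step` turns this into
  -- growth of f; the others need only monotonicity. At d = 0 the inequality would fail for `f`,
  -- where f(0) = f(1) = 1.
  f₀-shift₁ : ∀ d → d < n → f₀ d ^ n * 2 ^ D ≤ f₀ (suc d) ^ n
  f₀-shift₁ zero    h = ℕ.≤-trans (ℕ.≤-reflexive (cong (_* 2 ^ D) (0^n≡0 n>0))) z≤n
  f₀-shift₁ d@(suc d′) h with ℕ.m≤n⇒∃[o]m+o≡n h
  ... | o , refl = begin
    f d ^ (suc d + o) * 2 ^ D           ≡⟨ trans (cong (_* 2 ^ D) (ℕ.^-distribˡ-+-* (f d) (suc d) o)) (r (f d ^ suc d) (f d ^ o) (2 ^ D)) ⟩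
    2 ^ D * f d ^ suc d * f d ^ o       ≤⟨ ℕ.*-mono-≤ grow (ℕ.^-monoˡ-≤ o f≤) ⟩
    f (suc d) ^ suc d * f (suc d) ^ o   ≡⟨ sym (ℕ.^-distribˡ-+-* (f (suc d)) (suc d) o) ⟩
    f (suc d) ^ (suc d + o) ∎
    where
    open ℕ.≤-Reasoning
    r : ∀ a b c → a * b * c ≡ c * a * b
    r = ℕ-Solver.solve-∀
    2^Df≤ : 2 ^ D * f d ≤ suc d ^ D
    2^Df≤ = ^-root d (s≤s z≤n) (begin
      (2 ^ D * f d) ^ d       ≡⟨ trans (^-distrib-* (2 ^ D) (f d) d) (cong₂ _*_ (^-swap 2 D d) (f^ d (ℕ.<⇒≤ h))) ⟩
      (2 ^ d) ^ D * (d !) ^ D ≡⟨ sym (^-distrib-* (2 ^ d) (d !) D) ⟩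
      (2 ^ d * d !) ^ D       ≤⟨ ℕ.^-monoˡ-≤ D (2^d*d!≤[1+d]^d d) ⟩
      (suc d ^ d) ^ D         ≡⟨ ^-swap (suc d) d D ⟩
      (suc d ^ D) ^ d ∎)
    grow : 2 ^ D * f d ^ suc d ≤ f (suc d) ^ suc d
    grow = begin
      2 ^ D * (f d * f d ^ d)   ≡⟨ sym (ℕ.*-assoc (2 ^ D) (f d) _) ⟩
      2 ^ D * f d * f d ^ d     ≤⟨ ℕ.*-monoˡ-≤ (f d ^ d) 2^Df≤ ⟩
      suc d ^ D * f d ^ d       ≡⟨ sym (f-step d h) ⟩
      f (suc d) ^ suc d ∎
    f≤ : f d ≤ f (suc d)
    f≤ = ^-root (suc d) (s≤s z≤n) (ℕ.≤-trans (ℕ.m≤n*m (f d ^ suc d) (2 ^ D) {{ℕ.m^n≢0 2 D}}) grow)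

  f₀-shift : ∀ c d → d + c ≤ n → f₀ d ^ n * 2 ^ (D * c) ≤ f₀ (d + c) ^ n
  f₀-shift zero    d h rewrite ℕ.*-zeroʳ D | ℕ.+-identityʳ d = ℕ.≤-reflexive (ℕ.*-identityʳ _)
  f₀-shift (suc c) d h rewrite ℕ.+-suc d c = begin
    f₀ d ^ n * 2 ^ (D * suc c)          ≡⟨ cong (f₀ d ^ n *_) (trans (cong (2 ^_) (trans (ℕ.*-suc D c) (ℕ.+-comm D (D * c)))) (ℕ.^-distribˡ-+-* 2 (D * c) D)) ⟩
    f₀ d ^ n * (2 ^ (D * c) * 2 ^ D)    ≡⟨ sym (ℕ.*-assoc (f₀ d ^ n) _ _) ⟩
    f₀ d ^ n * 2 ^ (D * c) * 2 ^ D      ≤⟨ ℕ.*-monoˡ-≤ (2 ^ D) (f₀-shift c d (ℕ.<⇒≤ h)) ⟩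
    f₀ (d + c) ^ n * 2 ^ D              ≤⟨ f₀-shift₁ (d + c) h ⟩
    f₀ (suc (d + c)) ^ n ∎
    where open ℕ.≤-Reasoning

  open Bregman D n f D>0 f>0 f-step using (bregman)

  harmonic : ℕ → ℕ
  harmonic zero    = 0
  harmonic (suc d) = D / suc d + harmonic d

  -- With d rows missing the two permanent bounds differ by the factor 2 B^(1/d), where B = 2 (4
  -- n)^n. This is the D-th power of that factor, multiplied over all rows still to come.
  loss : ℕ → ℕ
  loss d = (2 * (4 * n) ^ n) ^ harmonic d * 2 ^ (D * d)

  loss>0 : ∀ d → 0 < loss d
  loss>0 d = *-pos (^-pos (harmonic d) (*-pos {2} (s≤s z≤n) (^-pos n (*-pos {4} (s≤s z≤n) n>0)))) (ℕ.m^n>0 2 (D * d))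

  rowSum-𝟏 : (w : Vec ℕ n) → rowSum 𝟏 w ≡ total w
  rowSum-𝟏 w = sum-cong-≗ (λ s → trans (cong (_* w [ s ]) (lookup-𝟏 s)) (ℕ.*-identityˡ (w [ s ])))

  ∏-toList : ∀ (g : Vec ℕ n → ℕ) (A : Vec (Vec ℕ n) m) → ∏L g (toList A) ≡ ∏ (λ j → g (A [ j ]))
  ∏-toList g []      = refl
  ∏-toList g (w ∷ A) = cong (g w *_) (∏-toList g A)

  all-toList : ∀ {P : Vec ℕ n → Set} (A : Vec (Vec ℕ n) m) → (∀ j → P (A [ j ])) → All P (toList A)
  all-toList []      h = []
  all-toList (w ∷ A) h = h zero ∷ all-toList A (h ∘ suc)

  -- A matrix with nonzero permanent has no zero row, so `f` and `f₀` agree on its row sums.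
  pm≤∏f₀ : (A : Vec (Vec ℕ n) n) → (∀ j → Bitsᶠ (A [ j ])) → pm (toList A) 𝟏 ^ D ≤ ∏ (λ j → f₀ (total (A [ j ])))
  pm≤∏f₀ A b with pm (toList A) 𝟏 ℕ.≟ 0
  ... | yes z = ℕ.≤-trans (ℕ.≤-reflexive (trans (cong (_^ D) z) (0^n≡0 D>0))) z≤n
  ... | no nz = begin
    pm ws 𝟏 ^ D                          ≤⟨ bregman n ws 𝟏 len (all-toList A b) bits-𝟏 (trans tot (sym len)) (ℕ.≤-reflexive tot) ⟩
    ∏L (λ w → f (rowSum 𝟏 w)) ws         ≡⟨ ∏L≡∏ (λ w → f (rowSum 𝟏 w)) ws ⟩
    ∏ (λ i → f (rowSum 𝟏 (List.lookup ws i)))  ≡⟨ ∏-cong (λ i → f≡f₀ _ (nonzero i)) ⟩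
    ∏ (λ i → f₀ (rowSum 𝟏 (List.lookup ws i))) ≡⟨ trans (sym (∏L≡∏ (λ w → f₀ (rowSum 𝟏 w)) ws)) (∏-toList (λ w → f₀ (rowSum 𝟏 w)) A) ⟩
    ∏ (λ j → f₀ (rowSum 𝟏 (A [ j ])))    ≡⟨ ∏-cong (λ j → cong f₀ (rowSum-𝟏 (A [ j ]))) ⟩
    ∏ (λ j → f₀ (total (A [ j ]))) ∎
    where
    open ℕ.≤-Reasoning
    ws = toList A
    len : length ws ≡ n
    len = Vec.length-toList A
    tot : total (𝟏 {n}) ≡ n
    tot = trans (total-replicate n 1) (ℕ.*-identityʳ n)
    f≡f₀ : ∀ d → d ≢ 0 → f d ≡ f₀ d
    f≡f₀ zero    h = ⊥-elim (h refl)
    f≡f₀ (suc d) h = refl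
    nonzero : ∀ i → rowSum 𝟏 (List.lookup ws i) ≢ 0
    nonzero i z = nz (trans (expand-row ws i 𝟏) (∑-zero (λ s → cong (_* pm (removeAt ws i) (dec 𝟏 s)) (∑≡0⇒≡0 (λ s → 𝟏 [ s ] * List.lookup ws i [ s ]) z s))))

-- Two-sided bounds for the number of completions

module Counting (n : ℕ) (n>0 : 0 < n) (Y Z : Subset n) where
  open Factors n n>0
  open Box Y Z hiding (column)

  regular-𝟙 : RegularMatrix n 𝟙
  regular-𝟙 = record
    { bits = λ j → subst Bitsᶠ (sym (lookup-𝟙 j)) bits-𝟏
    ; rowSums = λ j → trans (cong total (lookup-𝟙 j)) (trans (total-replicate n 1) (ℕ.*-identityʳ n))
    ; columns = λ s → trans (sum-cong-≗ (λ j → trans (cong (_[ s ]) (lookup-𝟙 j)) (lookup-𝟏 s))) (∑-one n) }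

  weight≢0 : ∀ t A r → weight t A r ≢ 0 → distinct r 𝟏 ≢ 0 × vals A r ≢ 0 × avoid t r ≢ 0
  weight≢0 t A r h = (λ z → h (cong (_* (vals A r * avoid t r)) z))
    , (λ z → h (trans (cong (λ a → distinct r 𝟏 * (a * avoid t r)) z) (ℕ.*-zeroʳ (distinct r 𝟏))))
    , (λ z → h (trans (cong (λ a → distinct r 𝟏 * (vals A r * a)) z) (trans (cong (distinct r 𝟏 *_) (ℕ.*-zeroʳ (vals A r))) (ℕ.*-zeroʳ (distinct r 𝟏)))))

  regular-⊖ : ∀ {d A} t r → RegularMatrix (suc d) A → weight t A r ≢ 0 → RegularMatrix d (A ⊖ r)
  regular-⊖ {d} {A} t r R h = record
    { bits = λ j → subst Bitsᶠ (sym (lookup-⊖ A r j)) (dec-bits (A [ j ]) (r [ j ]) (bits j))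
    ; rowSums = λ j → ℕ.suc-injective (trans (cong (suc ∘ total) (lookup-⊖ A r j)) (trans (total-dec (A [ j ]) (r [ j ]) (nz j)) (rowSums j)))
    ; columns = λ s → ℕ.suc-injective (trans (cong₂ _+_ (sym (injective⇒∑δ r (distinct⇒injective r 𝟏 bits-𝟏 (proj₁ (weight≢0 t A r h))) s)) refl)
        (trans (sym (∑-distrib-+ (λ j → δ (r [ j ]) s) (λ j → (A ⊖ r) [ j ] [ s ])))
        (trans (sum-cong-≗ (λ j → trans (cong (λ z → δ (r [ j ]) s + z [ s ]) (lookup-⊖ A r j)) (sym (lookup-total (A [ j ]) (r [ j ]) (nz j) (bits j) s)))) (columns s)))) }
    where
    open RegularMatrix R
    nz : ∀ j → A [ j ] [ r [ j ] ] ≢ 0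
    nz = ∏-zero⁻ {f = λ j → A [ j ] [ r [ j ] ]} (proj₁ (proj₂ (weight≢0 t A r h)))

  -- The D-th power of the product of (i!)^(n/i) over i ≤ d, the main term of the lower and upper
  -- bounds alike.
  U : ℕ → ℕ
  U zero    = 1
  U (suc d) = f (suc d) ^ n * U d

  mask-false : ∀ A → mask false A ≡ A
  mask-false A = vec-ext (λ j → vec-ext (λ s → trans (lookup-mask false A j s) (ℕ.*-identityʳ _)))

  ∑-weight-false : ∀ A → ∑L (weight false A) words ≡ pm (toList A) 𝟏
  ∑-weight-false A = trans (∑-weight false A) (cong (λ z → pm (toList z) 𝟏) (mask-false A))

  pm-lower-f : ∀ {d} {A : Vec (Vec ℕ n) n} → RegularMatrix (suc d) A → suc d ≤ n →
    f (suc d) ^ n ≤ pm (toList A) 𝟏 ^ D * ((2 * (4 * n) ^ n) ^ (D / suc d) * 2 ^ D)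
  pm-lower-f {d} {A} R d<n = begin
    ((suc d !) ^ h) ^ n                                ≡⟨ ^-swap (suc d !) h n ⟩
    ((suc d !) ^ n) ^ h                                ≤⟨ ℕ.^-monoˡ-≤ h (pm-lower′ {A = A} R (s≤s z≤n)) ⟩
    (2 * (4 * suc d) ^ n * (2 * P) ^ suc d) ^ h        ≤⟨ ℕ.^-monoˡ-≤ h (ℕ.*-monoˡ-≤ ((2 * P) ^ suc d) (ℕ.*-monoʳ-≤ 2 (ℕ.^-monoˡ-≤ n (ℕ.*-monoʳ-≤ 4 d<n)))) ⟩
    (B * (2 * P) ^ suc d) ^ h                          ≡⟨ ^-distrib-* B ((2 * P) ^ suc d) h ⟩
    B ^ h * ((2 * P) ^ suc d) ^ h                      ≡⟨ cong (B ^ h *_) (trans (ℕ.^-*-assoc (2 * P) (suc d) h) (trans (cong ((2 * P) ^_) (trans (ℕ.*-comm (suc d) h) (div d d<n))) (^-distrib-* 2 P D))) ⟩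
    B ^ h * (2 ^ D * P ^ D)                            ≡⟨ r (B ^ h) (2 ^ D) (P ^ D) ⟩
    P ^ D * (B ^ h * 2 ^ D) ∎
    where
    open ℕ.≤-Reasoning
    h = D / suc d
    P = pm (toList A) 𝟏
    B = 2 * (4 * n) ^ n
    r : ∀ a b c → a * (b * c) ≡ c * (a * b)
    r = ℕ-Solver.solve-∀

  -- Every admissible row leaves a regular matrix again, and the bound for that matrix does not
  -- depend on the row; so the bounds for single rows multiply.
  lower : ∀ d {A} → d ≤ n → RegularMatrix d A → U d ≤ completions (List.replicate d false) A ^ D * loss d
  lower zero    {A} h R = ℕ.≤-reflexive (sym (cong₂ _*_ (ℕ.^-zeroˡ D) (cong (λ z → 1 * 2 ^ z) (ℕ.*-zeroʳ D))))
  lower (suc d) {A} h R = begin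
    f (suc d) ^ n * U d
      ≤⟨ ℕ.*-monoˡ-≤ (U d) (pm-lower-f {A = A} R h) ⟩
    P ^ D * (B ^ (D / suc d) * 2 ^ D) * U d
      ≡⟨ r₁ (P ^ D) (B ^ (D / suc d) * 2 ^ D) (U d) ⟩
    (B ^ (D / suc d) * 2 ^ D) * (P ^ D * U d)
      ≡⟨ cong (λ z → (B ^ (D / suc d) * 2 ^ D) * (z ^ D * U d)) (sym (∑-weight-false A)) ⟩
    (B ^ (D / suc d) * 2 ^ D) * (∑L (weight false A) words ^ D * U d)
      ≤⟨ ℕ.*-monoʳ-≤ (B ^ (D / suc d) * 2 ^ D) (weighted-min (weight false A) (λ r → completions p (A ⊖ r)) D (loss d) (U d) D>0 (loss>0 d)
           (λ r nz → lower d (ℕ.<⇒≤ h) (regular-⊖ false r R nz)) words) ⟩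
    (B ^ (D / suc d) * 2 ^ D) * (completions (false ∷ p) A ^ D * loss d)
      ≡⟨ r₂ (B ^ (D / suc d)) (2 ^ D) (completions (false ∷ p) A ^ D) (B ^ harmonic d) (2 ^ (D * d)) ⟩
    completions (false ∷ p) A ^ D * ((B ^ (D / suc d) * B ^ harmonic d) * (2 ^ D * 2 ^ (D * d)))
      ≡⟨ cong (completions (false ∷ p) A ^ D *_) (cong₂ _*_ (sym (ℕ.^-distribˡ-+-* B (D / suc d) (harmonic d)))
           (trans (sym (ℕ.^-distribˡ-+-* 2 D (D * d))) (cong (2 ^_) (sym (ℕ.*-suc D d))))) ⟩
    completions (false ∷ p) A ^ D * loss (suc d) ∎
    where
    open ℕ.≤-Reasoning
    P = pm (toList A) 𝟏
    B = 2 * (4 * n) ^ n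
    p = List.replicate d false
    r₁ : ∀ a b c → a * b * c ≡ b * (a * c)
    r₁ = ℕ-Solver.solve-∀
    r₂ : ∀ a b c d e → (a * b) * (c * (d * e)) ≡ c * ((a * d) * (b * e))
    r₂ = ℕ-Solver.solve-∀

  upper₀ : ∀ d {A} → d ≤ n → RegularMatrix d A → completions (List.replicate d false) A ^ (D * n) * 1 ≤ U d ^ n
  upper₀ zero    h R = ℕ.≤-reflexive (trans (cong (_* 1) (ℕ.^-zeroˡ (D * n))) (sym (ℕ.^-zeroˡ n)))
  upper₀ (suc d) {A} h R = begin
    completions (false ∷ p) A ^ (D * n) * 1
      ≤⟨ weighted-max (weight false A) (λ r → completions p (A ⊖ r)) (D * n) 1 (U d ^ n) (*-pos D>0 n>0)
           (λ r nz → upper₀ d (ℕ.<⇒≤ h) (regular-⊖ false r R nz)) words ⟩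
    ∑L (weight false A) words ^ (D * n) * U d ^ n
      ≡⟨ cong (_* U d ^ n) (trans (cong (_^ (D * n)) (∑-weight-false A)) (sym (ℕ.^-*-assoc (pm (toList A) 𝟏) D n))) ⟩
    (pm (toList A) 𝟏 ^ D) ^ n * U d ^ n
      ≤⟨ ℕ.*-monoˡ-≤ (U d ^ n) (ℕ.^-monoˡ-≤ n (ℕ.≤-trans (pm≤∏f₀ A bits) (ℕ.≤-reflexive (trans (∏-cong (λ j → cong f₀ (regRows j))) (∏-const n (f (suc d))))))) ⟩
    (f (suc d) ^ n) ^ n * U d ^ n
      ≡⟨ sym (^-distrib-* (f (suc d) ^ n) (U d) n) ⟩
    U (suc d) ^ n ∎
    where
    open ℕ.≤-Reasoning
    open RegularMatrix R using (bits) renaming (rowSums to regRows)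
    p = List.replicate d false

  -- True as long as only rows of the box have been written, since these put no symbol of Z into a
  -- column of Y. This is why they come first: the mask then deletes exactly |Z| ones for each
  -- column of Y.
  Untouched : Vec (Vec ℕ n) n → Set
  Untouched A = ∀ j s → Y [ j ] ≡ true → Z [ s ] ≡ true → A [ j ] [ s ] ≡ 1

  untouched-⊖ : ∀ {A} r → Untouched A → avoid true r ≢ 0 → Untouched (A ⊖ r)
  untouched-⊖ {A} r u h j s y z = trans (cong (_[ s ]) (lookup-⊖ A r j)) (trans (lookup-dec′ (A [ j ]) s≢) (u j s y z))
    where
    s≢ : s ≢ r [ j ]
    s≢ refl = ∏-zero⁻ {f = λ j → allowed true (Y [ j ]) (r [ j ])} h j (cong₂ (λ a b → if a ∧ b then 0 else 1) y z)

  b c : ℕ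
  b = ∣ Y ∣
  c = ∣ Z ∣

  mask-row : ∀ {d A} → RegularMatrix d A → Untouched A → ∀ j → total (mask true A [ j ]) + (if Y [ j ] then c else 0) ≡ d
  mask-row {d} {A} R u j with Y [ j ] in y
  ... | true = trans (cong (total (mask true A [ j ]) +_) (∣∣≡∑ Z)) (trans (sym (∑-distrib-+ (λ s → mask true A [ j ] [ s ]) _))
    (trans (sum-cong-≗ cell) (RegularMatrix.rowSums R j)))
    where
    cell : ∀ s → mask true A [ j ] [ s ] + (if Z [ s ] then 1 else 0) ≡ A [ j ] [ s ]
    cell s with Z [ s ] in z
    ... | true  = trans (cong (_+ 1) (trans (lookup-mask true A j s) (trans (cong (A [ j ] [ s ] *_) (cong₂ (λ a b → if a ∧ b then 0 else 1) y z)) (ℕ.*-zeroʳ (A [ j ] [ s ]))))) (sym (u j s y z))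
    ... | false = trans (ℕ.+-identityʳ _) (trans (lookup-mask true A j s) (trans (cong (A [ j ] [ s ] *_) (cong₂ (λ a b → if a ∧ b then 0 else 1) y z)) (ℕ.*-identityʳ _)))
  ... | false = trans (ℕ.+-identityʳ _) (trans (sum-cong-≗ (λ s → trans (lookup-mask true A j s)
    (trans (cong (λ a → A [ j ] [ s ] * (if a ∧ Z [ s ] then 0 else 1)) y) (ℕ.*-identityʳ _)))) (RegularMatrix.rowSums R j))

  mask-bits : ∀ {d A} → RegularMatrix d A → ∀ j → Bitsᶠ (mask true A [ j ])
  mask-bits {A = A} R j s = ℕ.≤-trans (ℕ.≤-reflexive (lookup-mask true A j s)) (ℕ.*-mono-≤ (RegularMatrix.bits R j s) (allowed≤1 true (Y [ j ]) s))

  -- For each of the |Y| columns the row sum drops by |Z|, and by `f₀-shift` each unit is worth 2^D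
  -- in the n-th power of Brègman's bound.
  pm-mask : ∀ {d A} → d < n → RegularMatrix (suc d) A → Untouched A →
    pm (toList (mask true A)) 𝟏 ^ (D * n) * 2 ^ (D * (b * c)) ≤ (f (suc d) ^ n) ^ n
  pm-mask {d} {A} h R u = begin
    P ^ (D * n) * 2 ^ (D * (b * c))
      ≡⟨ cong₂ _*_ (sym (ℕ.^-*-assoc P D n)) exps ⟩
    (P ^ D) ^ n * ∏ (λ j → 2 ^ (D * (if Y [ j ] then c else 0)))
      ≤⟨ ℕ.*-monoˡ-≤ _ (ℕ.^-monoˡ-≤ n (pm≤∏f₀ (mask true A) (mask-bits R))) ⟩
    ∏ (λ j → f₀ (x j)) ^ n * ∏ (λ j → 2 ^ (D * (if Y [ j ] then c else 0)))
      ≡⟨ trans (cong (_* ∏ (λ j → 2 ^ (D * (if Y [ j ] then c else 0)))) (sym (∏-^ (λ j → f₀ (x j)) n))) (sym (∏-distrib-* (λ j → f₀ (x j) ^ n) _)) ⟩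
    ∏ (λ j → f₀ (x j) ^ n * 2 ^ (D * (if Y [ j ] then c else 0)))
      ≤⟨ ∏-mono (λ j → ℕ.≤-trans (f₀-shift (if Y [ j ] then c else 0) (x j) (ℕ.≤-trans (ℕ.≤-reflexive (mask-row R u j)) h)) (ℕ.≤-reflexive (cong (λ z → f₀ z ^ n) (mask-row R u j)))) ⟩
    ∏ {n} (λ j → f (suc d) ^ n)
      ≡⟨ ∏-const n (f (suc d) ^ n) ⟩
    (f (suc d) ^ n) ^ n ∎
    where
    open ℕ.≤-Reasoning
    P = pm (toList (mask true A)) 𝟏
    x : Fin n → ℕ
    x j = total (mask true A [ j ])
    choose : ∀ y → (if y then c else 0) ≡ (if y then 1 else 0) * c
    choose true  = sym (ℕ.+-identityʳ c)
    choose false = refl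
    exps : 2 ^ (D * (b * c)) ≡ ∏ (λ j → 2 ^ (D * (if Y [ j ] then c else 0)))
    exps = sym (trans (^-∑ 2 (λ j → D * (if Y [ j ] then c else 0))) (cong (2 ^_) (trans (sym (*-distribˡ-sum D (λ j → if Y [ j ] then c else 0)))
      (cong (D *_) (trans (sum-cong-≗ (λ j → choose (Y [ j ]))) (trans (sym (*-distribʳ-sum c (λ j → if Y [ j ] then 1 else 0))) (cong (_* c) (sym (∣∣≡∑ Y)))))))))

  upper : ∀ a m {A} → a + m ≤ n → RegularMatrix (a + m) A → Untouched A →
    completions (List.replicate a true ++ List.replicate m false) A ^ (D * n) * 2 ^ (D * (a * (b * c))) ≤ U (a + m) ^ n
  upper zero    m {A} h R u = ℕ.≤-trans (ℕ.≤-reflexive (cong (λ z → completions (List.replicate m false) A ^ (D * n) * 2 ^ z) (ℕ.*-zeroʳ D))) (upper₀ m h R)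
  upper (suc a) m {A} h R u = begin
    completions (true ∷ p) A ^ (D * n) * 2 ^ (D * (b * c + a * (b * c)))
      ≡⟨ cong (completions (true ∷ p) A ^ (D * n) *_) (trans (cong (2 ^_) (trans (ℕ.*-distribˡ-+ D (b * c) _) (ℕ.+-comm (D * (b * c)) _))) (ℕ.^-distribˡ-+-* 2 (D * (a * (b * c))) (D * (b * c)))) ⟩
    completions (true ∷ p) A ^ (D * n) * (2 ^ (D * (a * (b * c))) * 2 ^ (D * (b * c)))
      ≡⟨ sym (ℕ.*-assoc (completions (true ∷ p) A ^ (D * n)) _ _) ⟩
    completions (true ∷ p) A ^ (D * n) * 2 ^ (D * (a * (b * c))) * 2 ^ (D * (b * c))
      ≤⟨ ℕ.*-monoˡ-≤ (2 ^ (D * (b * c))) (weighted-max (weight true A) (λ r → completions p (A ⊖ r)) (D * n) (2 ^ (D * (a * (b * c)))) (U (a + m) ^ n) (*-pos D>0 n>0)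
           (λ r nz → upper a m (ℕ.<⇒≤ h) (regular-⊖ true r R nz) (untouched-⊖ {A} r u (proj₂ (proj₂ (weight≢0 true A r nz))))) words) ⟩
    ∑L (weight true A) words ^ (D * n) * U (a + m) ^ n * 2 ^ (D * (b * c))
      ≡⟨ trans (cong (λ z → z ^ (D * n) * U (a + m) ^ n * 2 ^ (D * (b * c))) (∑-weight true A)) (r (P ^ (D * n)) (U (a + m) ^ n) (2 ^ (D * (b * c)))) ⟩
    P ^ (D * n) * 2 ^ (D * (b * c)) * U (a + m) ^ n
      ≤⟨ ℕ.*-monoˡ-≤ (U (a + m) ^ n) (pm-mask h R u) ⟩
    (f (suc (a + m)) ^ n) ^ n * U (a + m) ^ n
      ≡⟨ sym (^-distrib-* (f (suc (a + m)) ^ n) (U (a + m)) n) ⟩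
    U (suc (a + m)) ^ n ∎
    where
    open ℕ.≤-Reasoning
    P = pm (toList (mask true A)) 𝟏
    p = List.replicate a true ++ List.replicate m false
    r : ∀ a b c → a * b * c ≡ a * c * b
    r = ℕ-Solver.solve-∀

  upper-box : ∀ (X : Subset n) → completions (toList X) 𝟙 ^ (D * n) * 2 ^ (D * (∣ X ∣ * (b * c))) ≤ U n ^ n
  upper-box X with sort-↭ X
  ... | m , e , p = ℕ.≤-trans (ℕ.≤-reflexive (cong (λ z → z ^ (D * n) * 2 ^ (D * (∣ X ∣ * (b * c)))) (completions-↭ p 𝟙)))
    (ℕ.≤-trans (upper ∣ X ∣ m (ℕ.≤-reflexive e) (subst (λ z → RegularMatrix z 𝟙) (sym e) regular-𝟙) (λ j s _ _ → trans (cong (_[ s ]) (lookup-𝟙 j)) (lookup-𝟏 s)))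
      (ℕ.≤-reflexive (cong (λ z → U z ^ n) e)))

-- The union bound

n≤2^⌈log₂n⌉ : ∀ n → n ≤ 2 ^ ⌈log₂ n ⌉
n≤2^⌈log₂n⌉ n = go n (<-wellFounded n)
  where
  open ℕ.≤-Reasoning
  m≤2⌈m/2⌉ : ∀ m → m ≤ 2 * ⌈ m /2⌉
  m≤2⌈m/2⌉ m = ℕ.≤-trans (ℕ.≤-reflexive (sym (ℕ.⌊n/2⌋+⌈n/2⌉≡n m))) (ℕ.≤-trans (ℕ.+-monoˡ-≤ ⌈ m /2⌉ (ℕ.⌊n/2⌋≤⌈n/2⌉ m))
    (ℕ.≤-reflexive (cong (⌈ m /2⌉ +_) (sym (ℕ.+-identityʳ ⌈ m /2⌉)))))
  go : ∀ n (a : Acc _<_ n) → n ≤ 2 ^ ⌈log2⌉ n a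
  go 0             _        = z≤n
  go 1             _        = s≤s z≤n
  go (suc (suc m)) (acc rs) = begin
    2 + m                    ≤⟨ ℕ.+-monoʳ-≤ 2 (m≤2⌈m/2⌉ m) ⟩
    2 + 2 * ⌈ m /2⌉          ≡⟨ sym (ℕ.*-suc 2 ⌈ m /2⌉) ⟩
    2 * suc ⌈ m /2⌉          ≤⟨ ℕ.*-monoʳ-≤ 2 (go (suc ⌈ m /2⌉) _) ⟩
    2 * 2 ^ ⌈log2⌉ (suc ⌈ m /2⌉) _ ∎

-- Harmonic sums and the total loss

module Harmonic (n : ℕ) (n>0 : 0 < n) where
  open Factors n n>0
  open ℕ.≤-Reasoning

  harmonic-+ : ∀ m j → harmonic (m + j) ≤ harmonic m + j * (D / suc m)
  harmonic-+ m zero    rewrite ℕ.+-identityʳ m | ℕ.+-identityʳ (harmonic m) = ℕ.≤-refl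
  harmonic-+ m (suc j) rewrite ℕ.+-suc m j = begin
    D / suc (m + j) + harmonic (m + j)             ≤⟨ ℕ.+-mono-≤ (ℕ./-monoʳ-≤ D (s≤s (ℕ.m≤m+n m j))) (harmonic-+ m j) ⟩
    D / suc m + (harmonic m + j * (D / suc m))     ≡⟨ r (D / suc m) (harmonic m) (j * (D / suc m)) ⟩
    harmonic m + (D / suc m + j * (D / suc m)) ∎
    where
    r : ∀ a b c → a + (b + c) ≡ b + (a + c)
    r = ℕ-Solver.solve-∀

  harmonic-mono : ∀ {m m′} → m ≤ m′ → harmonic m ≤ harmonic m′
  harmonic-mono {m} m≤m′ with ℕ.m≤n⇒∃[o]m+o≡n m≤m′
  ... | o , refl = go o
    where
    go : ∀ o → harmonic m ≤ harmonic (m + o)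
    go zero    = ℕ.≤-reflexive (cong harmonic (sym (ℕ.+-identityʳ m)))
    go (suc o) = ℕ.≤-trans (go o) (ℕ.≤-trans (ℕ.m≤n+m _ (D / suc (m + o))) (ℕ.≤-reflexive (cong harmonic (sym (ℕ.+-suc m o)))))

  -- Dyadic blocks: the 2^k terms that follow the first 2^k are at most D / (2^k + 1) each, hence at
  -- most D together.
  harmonic-2^ : ∀ k → harmonic (2 ^ k) ≤ D * suc k
  harmonic-2^ zero    = ℕ.≤-trans (ℕ.≤-reflexive (ℕ.+-identityʳ (D / 1))) (ℕ.≤-trans (ℕ.m/n≤m D 1) (ℕ.≤-reflexive (sym (ℕ.*-identityʳ D))))
  harmonic-2^ (suc k) = begin
    harmonic (2 ^ k + (2 ^ k + 0))               ≡⟨ cong (λ z → harmonic (2 ^ k + z)) (ℕ.+-identityʳ (2 ^ k)) ⟩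
    harmonic (2 ^ k + 2 ^ k)                     ≤⟨ harmonic-+ (2 ^ k) (2 ^ k) ⟩
    harmonic (2 ^ k) + 2 ^ k * (D / suc (2 ^ k)) ≤⟨ ℕ.+-mono-≤ (harmonic-2^ k) (ℕ.≤-trans (ℕ.*-monoˡ-≤ (D / suc (2 ^ k)) (ℕ.n≤1+n (2 ^ k)))
                                                      (ℕ.≤-trans (ℕ.≤-reflexive (ℕ.*-comm (suc (2 ^ k)) _)) (ℕ.m/n*n≤m D (suc (2 ^ k))))) ⟩
    D * suc k + D                                ≡⟨ trans (ℕ.+-comm (D * suc k) D) (sym (ℕ.*-suc D (suc k))) ⟩
    D * suc (suc k) ∎

  loss-bound : 0 < ⌈log₂ n ⌉ → loss n ≤ (2 ^ (9 * (n * ⌈log₂ n ⌉ ^ 2))) ^ D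
  loss-bound λ>0 = begin
    (2 * (4 * n) ^ n) ^ harmonic n * 2 ^ (D * n)
      ≤⟨ ℕ.*-mono-≤ (ℕ.≤-trans (ℕ.^-monoʳ-≤ (2 * (4 * n) ^ n) {{>-nonZero (*-pos {2} (s≤s z≤n) (^-pos n (*-pos {4} (s≤s z≤n) n>0)))}}
                       (ℕ.≤-trans (harmonic-mono (n≤2^⌈log₂n⌉ n)) (harmonic-2^ l)))
                     (ℕ.^-monoˡ-≤ (D * suc l) (ℕ.*-monoʳ-≤ 2 (ℕ.^-monoˡ-≤ n (ℕ.*-monoʳ-≤ 4 (n≤2^⌈log₂n⌉ n)))))) ℕ.≤-refl ⟩
    (2 * (4 * 2 ^ l) ^ n) ^ (D * suc l) * 2 ^ (D * n)
      ≡⟨ cong₂ _*_ (trans (cong (_^ (D * suc l)) (cong (2 *_) (trans (cong (_^ n) (sym (ℕ.^-distribˡ-+-* 2 2 l))) (ℕ.^-*-assoc 2 (2 + l) n))))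
                     (ℕ.^-*-assoc 2 (suc ((2 + l) * n)) (D * suc l))) refl ⟩
    2 ^ (suc ((2 + l) * n) * (D * suc l)) * 2 ^ (D * n)
      ≡⟨ sym (ℕ.^-distribˡ-+-* 2 (suc ((2 + l) * n) * (D * suc l)) (D * n)) ⟩
    2 ^ (suc ((2 + l) * n) * (D * suc l) + D * n)
      ≤⟨ ℕ.^-monoʳ-≤ 2 (ℕ.≤-trans (ℕ.≤-reflexive (r D l n)) (ℕ.*-monoˡ-≤ D (poly n l n>0 λ>0))) ⟩
    2 ^ (9 * (n * l ^ 2) * D)
      ≡⟨ sym (ℕ.^-*-assoc 2 (9 * (n * l ^ 2)) D) ⟩
    (2 ^ (9 * (n * l ^ 2))) ^ D ∎
    where
    l = ⌈log₂ n ⌉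
    r : ∀ D l n → suc ((2 + l) * n) * (D * suc l) + D * n ≡ (suc ((2 + l) * n) * suc l + n) * D
    r = ℕ-Solver.solve-∀
    poly : ∀ n l → 0 < n → 0 < l → suc ((2 + l) * n) * suc l + n ≤ 9 * (n * l ^ 2)
    -- The constant 9 is attained at n = l = 1; expanded around that point, the difference has
    -- nonnegative coefficients.
    poly (suc n) (suc l) _ _ = ℕ.≤-trans (ℕ.m≤m+n _ (12 * l + 8 * (l * l) + n * (2 + 13 * l + 8 * (l * l)))) (ℕ.≤-reflexive (e n l))
      where
      e : ∀ n l → suc ((2 + suc l) * suc n) * suc (suc l) + suc n + (12 * l + 8 * (l * l) + n * (2 + 13 * l + 8 * (l * l))) ≡ 9 * (suc n * (suc l * (suc l * 1)))
      e = ℕ-Solver.solve-∀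

-- With e = n ⌈log₂ n⌉², 2^(9e) absorbs loss and 2^(4e) the union bound.
C : ℕ
C = 13

-- Counting the bad squares by their boxes

ind : {P : Set} → Dec P → ℕ
ind d = if does d then 1 else 0

ind-yes : {P : Set} (d : Dec P) → P → ind d ≡ 1
ind-yes (yes _) p = refl
ind-yes (no ¬p) p = ⊥-elim (¬p p)

ind-no : {P : Set} (d : Dec P) → ¬ P → ind d ≡ 0
ind-no (yes p) ¬p = ⊥-elim (¬p p)
ind-no (no _)  ¬p = refl

length-filter : {P : α → Set} (P? : ∀ x → Dec (P x)) (xs : List α) → length (filter P? xs) ≡ ∑L (λ x → ind (P? x)) xs
length-filter P? []       = refl
length-filter P? (x ∷ xs) with P? x
... | yes _ = cong suc (length-filter P? xs)
... | no _  = length-filter P? xs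

length-filter² : {P Q : β → Set} (P? : ∀ x → Dec (P x)) (Q? : ∀ x → Dec (Q x)) (h : α → β) (g : α → ℕ) →
  (∀ x → P (h x) → Q (h x) → 1 ≤ g x) → ∀ xs → length (filter Q? (filter P? (map h xs))) ≤ ∑L g xs
length-filter² P? Q? h g p []       = z≤n
length-filter² P? Q? h g p (x ∷ xs) with P? (h x)
... | no _ = ℕ.≤-trans (length-filter² P? Q? h g p xs) (ℕ.m≤n+m _ (g x))
... | yes a with Q? (h x)
...   | yes b = ℕ.+-mono-≤ (p x a b) (length-filter² P? Q? h g p xs)
...   | no _  = ℕ.≤-trans (length-filter² P? Q? h g p xs) (ℕ.m≤n+m _ (g x))

length≡∑ : (xs : List α) → length xs ≡ ∑L (λ _ → 1) xs
length≡∑ []       = refl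
length≡∑ (x ∷ xs) = cong suc (length≡∑ xs)

∑L-const : ∀ k (xs : List α) → ∑L (λ _ → k) xs ≡ length xs * k
∑L-const k []       = refl
∑L-const k (x ∷ xs) = cong (k +_) (∑L-const k xs)

∑L-≤ : ∀ {f : α → ℕ} {k} → (∀ x → f x ≤ k) → ∀ xs → ∑L f xs ≤ length xs * k
∑L-≤ {k = k} h xs = ℕ.≤-trans (∑L-mono h xs) (ℕ.≤-reflexive (∑L-const k xs))

term≤∑L : ∀ (f : α → ℕ) {x xs} → x ∈.∈ xs → f x ≤ ∑L f xs
term≤∑L f (here refl) = ℕ.m≤m+n _ _
term≤∑L f (there m)   = ℕ.≤-trans (term≤∑L f m) (ℕ.m≤n+m _ _)

length-concatMap : ∀ {k} (h : α → List β) → (∀ x → length (h x) ≡ k) → ∀ xs → length (concatMap h xs) ≡ length xs * k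
length-concatMap h e []       = refl
length-concatMap h e (x ∷ xs) = trans (List.length-++ (h x)) (cong₂ _+_ (e x) (length-concatMap h e xs))

length-allVecs : ∀ (xs : List α) k → length (allVecs xs k) ≡ length xs ^ k
length-allVecs xs zero    = refl
length-allVecs xs (suc k) = length-concatMap _ (λ x → trans (List.length-map _ (allVecs xs k)) (length-allVecs xs k)) xs

length-allBoxes : ∀ n → length (allBoxes n) ≡ 2 ^ n * (2 ^ n * 2 ^ n)
length-allBoxes n = trans (length-concatMap _ (λ X → trans (length-concatMap _ (λ Y → trans (List.length-map _ (allSubsets n)) len) (allSubsets n)) (cong (_* 2 ^ n) len)) (allSubsets n)) (cong (_* (2 ^ n * 2 ^ n)) len)
  where
  len : length (allSubsets n) ≡ 2 ^ n
  len = length-allVecs _ n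

BoxOf : ℕ → Set
BoxOf n = Subset n × Subset n × Subset n

vol : BoxOf n → ℕ
vol (X , Y , Z) = volume X Y Z

-- The fold and the filter in `ε` use anonymous pattern-matching functions. Here they are
-- parameters, the first known only through its equation, so that unification can supply them.
large-box : ∀ B (f : BoxOf n → ℕ → ℕ) {P : BoxOf n → Set} (P? : ∀ b → Dec (P b)) → (∀ b m → f b m ≡ vol b ⊔ m) →
  ∀ bs → B < foldr f 0 (filter P? bs) → ∃[ b ] (b ∈.∈ bs × P b × B < vol b)
large-box B f P? h (b ∷ bs) lt with P? b
... | no _ with large-box B f P? h bs lt
...   | b′ , m , p , q = b′ , there m , p , q
large-box B f P? h (b ∷ bs) lt | yes p with ℕ.⊔-sel (vol b) (foldr f 0 (filter P? bs))
... | inj₁ e = b , here refl , p , ℕ.≤-trans lt (ℕ.≤-reflexive (trans (h b _) e))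
... | inj₂ e with large-box B f P? h bs (ℕ.≤-trans lt (ℕ.≤-reflexive (trans (h b _) e)))
...   | b′ , m , p′ , q = b′ , there m , p′ , q

emptyIn? : (L : Grid n) (b : BoxOf n) → Dec (IsEmptyBox L (proj₁ b) (proj₁ (proj₂ b)) (proj₂ (proj₂ b)))
emptyIn? L (X , Y , Z) = isEmptyBox? L X Y Z

good-or-box : ∀ B (L : Grid n) → 1 ≤ ind (ε L ℕ.≤? B) + ∑L (λ b → ind (suc B ℕ.≤? vol b) * ind (emptyIn? L b)) (allBoxes n)
good-or-box {n} B L = go (ε L ℕ.≤? B)
  where
  go : Dec (ε L ≤ B) → _
  go (yes p) = ℕ.≤-trans (ℕ.≤-reflexive (sym (ind-yes (ε L ℕ.≤? B) p))) (ℕ.m≤m+n _ _)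
  go (no ¬p) with large-box B _ _ (λ { (X , Y , Z) m → refl }) (allBoxes n) (ℕ.≰⇒> ¬p)
  ... | b , m , p , q = ℕ.≤-trans (ℕ.≤-reflexive (sym (cong₂ _*_ (ind-yes (suc B ℕ.≤? vol b) q) (ind-yes (emptyIn? L b) p))))
    (ℕ.≤-trans (term≤∑L (λ b → ind (suc B ℕ.≤? vol b) * ind (emptyIn? L b)) m) (ℕ.m≤n+m _ (ind (ε L ℕ.≤? B))))

emptyCount : BoxOf n → ℕ
emptyCount {n} b = length (filter (λ L → emptyIn? L b) (latinSquares n))

union-bound : ∀ n B → countLatin n ≤ countGood n B + ∑L (λ b → ind (suc B ℕ.≤? vol b) * emptyCount b) (allBoxes n)
union-bound n B = begin
  length Ls                   ≡⟨ length≡∑ Ls ⟩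
  ∑L (λ _ → 1) Ls             ≤⟨ ∑L-mono (good-or-box B) Ls ⟩
  ∑L (λ L → ind (ε L ℕ.≤? B) + ∑L (λ b → big b * ind (emptyIn? L b)) bs) Ls
    ≡⟨ ∑L-+ (λ L → ind (ε L ℕ.≤? B)) (λ L → ∑L (λ b → big b * ind (emptyIn? L b)) bs) Ls ⟩
  ∑L (λ L → ind (ε L ℕ.≤? B)) Ls + ∑L (λ L → ∑L (λ b → big b * ind (emptyIn? L b)) bs) Ls
    ≡⟨ cong₂ _+_ (sym (length-filter (λ L → ε L ℕ.≤? B) Ls)) (trans (∑L-comm (λ L b → big b * ind (emptyIn? L b)) Ls bs)
         (∑L-cong (λ b → trans (∑L-*ˡ (big b) (λ L → ind (emptyIn? L b)) Ls) (cong (big b *_) (sym (length-filter (λ L → emptyIn? L b) Ls)))) bs)) ⟩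
  countGood n B + ∑L (λ b → big b * emptyCount b) bs ∎
  where
  open ℕ.≤-Reasoning
  Ls = latinSquares n
  bs = allBoxes n
  big : BoxOf n → ℕ
  big b = ind (suc B ℕ.≤? vol b)

module _ (n : ℕ) (n>0 : 0 < n) (X Y Z : Subset n) where
  open Factors n n>0
  open Counting n n>0 Y Z
  open Box Y Z
  open Harmonic n n>0
  open ℕ.≤-Reasoning

  private
    x y l : ℕ
    x = completions (toList X) 𝟙
    y = completions (List.replicate n false) 𝟙
    l = ⌈log₂ n ⌉

  emptyCount≤ : emptyCount (X , Y , Z) ≤ x
  emptyCount≤ = ℕ.≤-trans (length-filter² isLatin? (λ L → isEmptyBox? L X Y Z) grid (λ v → squareWeight X v 𝟙) (λ v → Latin⇒squareWeight X v) (allVecs words n))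
    (ℕ.≤-reflexive (∑-squareWeight X 𝟙))

  -- The type `false` forbids nothing, and the weight is at most 1 and supported on Latin squares.
  ≤countLatin : y ≤ countLatin n
  ≤countLatin = ℕ.≤-trans (ℕ.≤-reflexive (trans (cong (λ p → completions p 𝟙) (sym (Vec.toList-replicate n false))) (sym (∑-squareWeight (replicate n false) 𝟙))))
    (length-filter-≥ isLatin? grid (λ v → squareWeight (replicate n false) v 𝟙) (squareWeight≤1 (replicate n false)) (squareWeight⇒Latin (replicate n false)) (allVecs words n))

  -- In (D n)-th powers, `upper-box` saves 2^(D v), where v ≥ 13 e n makes this at least (2^(13
  -- e))^(D n), while `lower` costs (2^(9 e))^(D n). What remains is 2^(4 e).
  box-bound : 0 < l → C * n ^ 2 * l ^ 2 < volume X Y Z → emptyCount (X , Y , Z) * 2 ^ (4 * (n * l ^ 2)) ≤ countLatin n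
  box-bound l>0 big = begin
    emptyCount (X , Y , Z) * 2 ^ (4 * e)   ≤⟨ ℕ.*-monoˡ-≤ (2 ^ (4 * e)) emptyCount≤ ⟩
    x * 2 ^ (4 * e)                        ≤⟨ *-cancel-pos {2 ^ (9 * e)} _ _ (ℕ.m^n>0 2 (9 * e)) (begin
        2 ^ (9 * e) * (x * 2 ^ (4 * e))    ≡⟨ trans (c₁ (2 ^ (9 * e)) x (2 ^ (4 * e))) (cong (x *_) (trans (sym (ℕ.^-distribˡ-+-* 2 (9 * e) (4 * e))) (cong (2 ^_) (sym (ℕ.*-distribʳ-+ e 9 4))))) ⟩
        x * 2 ^ (13 * e)                   ≤⟨ ^-root n n>0 nth ⟩
        y * 2 ^ (9 * e)                    ≡⟨ ℕ.*-comm y _ ⟩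
        2 ^ (9 * e) * y ∎) ⟩
    y                                      ≤⟨ ≤countLatin ⟩
    countLatin n ∎
    where
    e = n * l ^ 2
    c₁ : ∀ a b c → a * (b * c) ≡ b * (a * c)
    c₁ = ℕ-Solver.solve-∀
    v = ∣ X ∣ * (b * c)
    13en≤v : 13 * e * n ≤ v
    13en≤v = begin
      13 * e * n           ≡⟨ reassoc n (l ^ 2) ⟩
      C * n ^ 2 * l ^ 2    ≤⟨ ℕ.<⇒≤ big ⟩
      volume X Y Z         ≡⟨ ℕ.*-assoc (∣ X ∣) b c ⟩
      v ∎
      where
      reassoc : ∀ n m → 13 * (n * m) * n ≡ 13 * (n * (n * 1)) * m
      reassoc = ℕ-Solver.solve-∀
    nth : (x * 2 ^ (13 * e)) ^ n ≤ (y * 2 ^ (9 * e)) ^ n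
    nth = ^-root D D>0 (begin
      ((x * 2 ^ (13 * e)) ^ n) ^ D
        ≡⟨ cong (_^ D) (trans (^-distrib-* x (2 ^ (13 * e)) n) (cong (x ^ n *_) (ℕ.^-*-assoc 2 (13 * e) n))) ⟩
      (x ^ n * 2 ^ (13 * e * n)) ^ D
        ≤⟨ ℕ.^-monoˡ-≤ D (ℕ.*-monoʳ-≤ (x ^ n) (ℕ.^-monoʳ-≤ 2 13en≤v)) ⟩
      (x ^ n * 2 ^ v) ^ D
        ≡⟨ trans (^-distrib-* (x ^ n) (2 ^ v) D) (cong₂ _*_ (trans (ℕ.^-*-assoc x n D) (cong (x ^_) (ℕ.*-comm n D))) (trans (ℕ.^-*-assoc 2 v D) (cong (2 ^_) (ℕ.*-comm v D)))) ⟩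
      x ^ (D * n) * 2 ^ (D * v)
        ≤⟨ upper-box X ⟩
      U n ^ n
        ≤⟨ ℕ.^-monoˡ-≤ n (lower n ℕ.≤-refl regular-𝟙) ⟩
      (y ^ D * loss n) ^ n
        ≤⟨ ℕ.^-monoˡ-≤ n (ℕ.*-monoʳ-≤ (y ^ D) (loss-bound l>0)) ⟩
      (y ^ D * (2 ^ (9 * e)) ^ D) ^ n
        ≡⟨ trans (cong (_^ n) (sym (^-distrib-* y (2 ^ (9 * e)) D))) (^-swap (y * 2 ^ (9 * e)) D n) ⟩
      ((y * 2 ^ (9 * e)) ^ n) ^ D ∎)

few-bad : ∀ k n → suc (suc k) ≤ n → let B = C * n ^ 2 * ⌈log₂ n ⌉ ^ 2 in
  suc k * ∑L (λ b → ind (suc B ℕ.≤? vol b) * emptyCount b) (allBoxes n) ≤ countLatin n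
few-bad k n k<n = *-cancel-pos {S} _ _ (*-pos (ℕ.m^n>0 2 n) (*-pos (ℕ.m^n>0 2 n) (ℕ.m^n>0 2 n))) (begin
  S * (suc k * ∑L T bs)             ≡⟨ trans (sym (ℕ.*-assoc S (suc k) _)) (sym (∑L-*ˡ (S * suc k) T bs)) ⟩
  ∑L (λ b → S * suc k * T b) bs     ≤⟨ ∑L-≤ each bs ⟩
  length bs * countLatin n          ≡⟨ cong (_* countLatin n) (length-allBoxes n) ⟩
  S * countLatin n ∎)
  where
  open ℕ.≤-Reasoning
  l = ⌈log₂ n ⌉
  B = C * n ^ 2 * l ^ 2
  S = 2 ^ n * (2 ^ n * 2 ^ n)
  bs = allBoxes n
  T : BoxOf n → ℕ
  T b = ind (suc B ℕ.≤? vol b) * emptyCount b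
  l>0 : ∀ l → n ≤ 2 ^ l → 0 < l
  l>0 zero    h = ⊥-elim (ℕ.<⇒≱ (ℕ.≤-trans (s≤s (s≤s z≤n)) k<n) h)
  l>0 (suc l) h = s≤s z≤n
  n>0 : 0 < n
  n>0 = ℕ.≤-trans (s≤s z≤n) k<n
  -- Already 16^n suffices: 8^n for the boxes and 2^n for k + 1, as k + 2 ≤ n.
  small : S * suc k ≤ 2 ^ (4 * (n * l ^ 2))
  small = begin
    S * suc k                                 ≤⟨ ℕ.*-monoʳ-≤ S (ℕ.≤-trans (ℕ.<⇒≤ (n≤2^n (suc k))) (ℕ.^-monoʳ-≤ 2 (ℕ.<⇒≤ k<n))) ⟩
    2 ^ n * (2 ^ n * 2 ^ n) * 2 ^ n           ≡⟨ r (2 ^ n) ⟩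
    (2 ^ n) ^ 4                               ≡⟨ trans (ℕ.^-*-assoc 2 n 4) (cong (2 ^_) (ℕ.*-comm n 4)) ⟩
    2 ^ (4 * n)                               ≤⟨ ℕ.^-monoʳ-≤ 2 (ℕ.*-monoʳ-≤ 4 (ℕ.m≤m*n n (l ^ 2) {{>-nonZero (^-pos 2 (l>0 l (n≤2^⌈log₂n⌉ n)))}})) ⟩
    2 ^ (4 * (n * l ^ 2)) ∎
    where
    r : ∀ a → a * (a * a) * a ≡ a * (a * (a * (a * 1)))
    r = ℕ-Solver.solve-∀
  each : ∀ b → S * suc k * T b ≤ countLatin n
  each b@(X , Y , Z) = go (suc B ℕ.≤? vol b)
    where
    go : Dec (B < vol b) → S * suc k * T b ≤ countLatin n
    go (no ¬p)   = ℕ.≤-trans (ℕ.≤-reflexive (trans (cong (λ i → S * suc k * (i * emptyCount b)) (ind-no (suc B ℕ.≤? vol b) ¬p)) (ℕ.*-zeroʳ (S * suc k)))) z≤n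
    go (yes big) = begin
      S * suc k * T b                           ≡⟨ cong (S * suc k *_) (trans (cong (_* emptyCount b) (ind-yes (suc B ℕ.≤? vol b) big)) (ℕ.*-identityˡ (emptyCount b))) ⟩
      S * suc k * emptyCount b                  ≤⟨ ℕ.*-monoˡ-≤ (emptyCount b) small ⟩
      2 ^ (4 * (n * l ^ 2)) * emptyCount b      ≡⟨ ℕ.*-comm _ (emptyCount b) ⟩
      emptyCount b * 2 ^ (4 * (n * l ^ 2))      ≤⟨ box-bound n n>0 X Y Z (l>0 l (n≤2^⌈log₂n⌉ n)) big ⟩
      countLatin n ∎

theorem1p2 : ∃[ C ] (0 < C × ((k : ℕ) → ∃[ N ] ((n : ℕ) → N ≤ n →
    k * countLatin n ≤ suc k * countGood n (C * n ^ 2 * ⌈log₂ n ⌉ ^ 2))))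
-- The threshold k + 2 gives k + 1 ≤ 2^n and, through n ≥ 2, a positive logarithm. The proportion
-- k/(k + 1) tends to 1 with k.
theorem1p2 = C , s≤s z≤n , λ k → suc (suc k) , λ n k<n →
  let B = C * n ^ 2 * ⌈log₂ n ⌉ ^ 2
      bad = ∑L (λ b → ind (suc B ℕ.≤? vol b) * emptyCount b) (allBoxes n)
  -- One of k + 1 copies of `countLatin n` is spent on the bad squares, which are at most a (k +
  -- 1)-th part by `few-bad`.
  in ℕ.+-cancelˡ-≤ (countLatin n) _ _ (begin
    suc k * countLatin n                    ≤⟨ ℕ.*-monoʳ-≤ (suc k) (union-bound n B) ⟩
    suc k * (countGood n B + bad)           ≡⟨ ℕ.*-distribˡ-+ (suc k) (countGood n B) bad ⟩
    suc k * countGood n B + suc k * bad     ≤⟨ ℕ.+-monoʳ-≤ (suc k * countGood n B) (few-bad k n k<n) ⟩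
    suc k * countGood n B + countLatin n    ≡⟨ ℕ.+-comm (suc k * countGood n B) _ ⟩
    countLatin n + suc k * countGood n B ∎)
  where open ℕ.≤-Reasoning
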